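{- For $i\in\{1,2\}$ let $G_i$ be a finite graph on $n_i$ vertices and let $k_i$ be a natural number with $k_i\le n_i-2$. Then $\mathcal{B}_{\geq k_1}(G_1)\cong\mathcal{B}_{\geq k_2}(G_2)$ if and only if $G_1'\cong G_2'$ and either ($k_1\le\chi(G_1)$ and $k_2\le\chi(G_2)$) or $n_1-k_1=n_2-k_2$. Here $G_i'$ denotes the graph obtained from $G_i$ by removing all universal vertices.
   Context: All graphs are finite and simple; $\chi$ is the chromatic number. A vertex of $G$ is universal if it has degree $|V(G)|-1$. An independent set partition of $G$ is a partition of $V(G)$ into nonempty independent sets (parts). For such a partition $P$ and $v\in V(G)$, let $P-v$ be the partition of $V(G)\setminus\{v\}$ obtained by deleting $v$ from its part (discarding that part if it becomes empty). The Bell colouring graph $\mathcal{B}(G)$ has as vertices the independent set partitions of $G$, with $P\neq Q$ adjacent iff $P-v=Q-v$ for some $v\in V(G)$. For a natural number $k$, $\mathcal{B}_{\geq k}(G)$ is the induced subgraph of $\mathcal{B}(G)$ on the partitions with at least $k$ parts. -}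

module Defs where

open import Data.Nat using (ℕ; zero; suc; _+_; _∸_; _≤_; _<ᵇ_)
open import Data.Bool using (Bool; true; false; if_then_else_; _∧_; not)
open import Data.Fin using (Fin; toℕ)
open import Data.List using (List; allFin; map)
open import Data.Nat.ListAction using (sum)
open import Data.Bool.ListAction using (any)
open import Data.Product using (Σ; _×_; _,_; proj₁; ∃-syntax)
open import Data.Empty using (⊥)
open import Relation.Nullary using (¬_)
open import Relation.Binary.PropositionalEquality using (_≡_; _≢_)
open import Relation.Binary.Structures using (IsEquivalence)

record Graph (n : ℕ) : Set where
  field
    adj    : Fin n → Fin n → Bool
    sym    : ∀ x y → adj x y ≡ adj y x
    irrefl : ∀ x → adj x x ≡ false
open Graph public

countB : {A : Set} → (A → Bool) → List A → ℕ
countB p xs = sum (map (λ x → if p x then 1 else 0) xs)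

degree : ∀ {n} → Graph n → Fin n → ℕ
degree {n} G v = countB (λ u → adj G u v) (allFin n)

Universal : ∀ {n} → Graph n → Fin n → Set
Universal {n} G v = degree G v ≡ n ∸ 1

Colourable : ∀ {n} → Graph n → ℕ → Set
Colourable {n} G m =
  Σ (Fin n → Fin m) λ c → ∀ x y → adj G x y ≡ true → c x ≢ c y

-- k ≤ χ(G), where χ(G) is the least m such that G is m-colourable:
-- k ≤ χ(G) iff every m for which G is m-colourable satisfies k ≤ m.
_≤χ_ : ∀ {n} → ℕ → Graph n → Set
k ≤χ G = ∀ m → Colourable G m → k ≤ m

-- General graphs with a setoid of vertices (needed for vertex sets such
-- as the set of independent set partitions), and isomorphism.

record SGraph : Set₁ where
  field
    V       : Set
    _≈_     : V → V → Set
    ≈-equiv : IsEquivalence _≈_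
    E       : V → V → Set
    E-resp  : ∀ {x x' y y'} → x ≈ x' → y ≈ y' → E x y → E x' y'

record _≅_ (G H : SGraph) : Set where
  private
    module G = SGraph G
    module H = SGraph H
  field
    to       : G.V → H.V
    from     : H.V → G.V
    to-cong  : ∀ {x y} → x G.≈ y → to x H.≈ to y
    from-cong : ∀ {x y} → x H.≈ y → from x G.≈ from y
    to-from  : ∀ y → to (from y) H.≈ y
    from-to  : ∀ x → from (to x) G.≈ x
    E-to     : ∀ x y → G.E x y → H.E (to x) (to y)
    E-from   : ∀ x y → H.E (to x) (to y) → G.E x y

open import Relation.Binary.PropositionalEquality as Eq using (refl)

deleteUniversal : ∀ {n} → Graph n → SGraph
deleteUniversal {n} G = record
  { V = Σ (Fin n) (λ v → ¬ Universal G v)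
  ; _≈_ = λ a b → proj₁ a ≡ proj₁ b
  ; ≈-equiv = record { refl = refl ; sym = Eq.sym ; trans = Eq.trans }
  ; E = λ a b → adj G (proj₁ a) (proj₁ b) ≡ true
  ; E-resp = λ { refl refl e → e }
  }

-- Independent set partitions, represented by their "same part" relation

record IPartition {n} (G : Graph n) : Set where
  field
    same      : Fin n → Fin n → Bool
    same-refl : ∀ x → same x x ≡ true
    same-sym  : ∀ x y → same x y ≡ true → same y x ≡ true
    same-trans : ∀ x y z → same x y ≡ true → same y z ≡ true → same x z ≡ true
    indep     : ∀ x y → same x y ≡ true → adj G x y ≡ false
open IPartition public

-- number of parts = number of vertices that are the least element
-- (w.r.t. toℕ) of their part
numParts : ∀ {n} {G : Graph n} → IPartition G → ℕ
numParts {n} P =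
  countB (λ x → not (any (λ y → (toℕ y <ᵇ toℕ x) ∧ same P y x) (allFin n)))
         (allFin n)

_≈P_ : ∀ {n} {G : Graph n} → IPartition G → IPartition G → Set
P ≈P Q = ∀ x y → same P x y ≡ same Q x y

SameAfterDeleting : ∀ {n} {G : Graph n} → Fin n → IPartition G → IPartition G → Set
SameAfterDeleting v P Q = ∀ x y → x ≢ v → y ≢ v → same P x y ≡ same Q x y

Bell≥ : ∀ {n} → ℕ → Graph n → SGraph
Bell≥ {n} k G = record
  { V = Σ (IPartition G) (λ P → k ≤ numParts P)
  ; _≈_ = λ a b → proj₁ a ≈P proj₁ b
  ; ≈-equiv = record
      { refl = λ x y → refl
      ; sym = λ p x y → Eq.sym (p x y)
      ; trans = λ p q x y → Eq.trans (p x y) (q x y) }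
  ; E = λ a b → (¬ (proj₁ a ≈P proj₁ b)) ×
                 ∃[ v ] SameAfterDeleting v (proj₁ a) (proj₁ b)
  ; E-resp = λ {a} {a'} {b} {b'} p q (ne , v , s) →
      (λ r → ne (λ x y → Eq.trans (p x y) (Eq.trans (r x y) (Eq.sym (q x y)))))
      , v , (λ x y x≢v y≢v →
               Eq.trans (Eq.sym (p x y)) (Eq.trans (s x y x≢v y≢v) (q x y)))
  }

{-# OPTIONS --safe #-}

-- Let H be the complement of G. The neighbours of the discrete partition in the Bell
-- graph are the edges of H, two of them being adjacent when the edges share an end;
-- three edges that form a triangle, unlike those of a star, have a common neighbour
-- that is not near the discrete partition. An isomorphism φ need not preserve the
-- discrete partition, so let P be its image. A pair of adjacent neighbours of P can be
-- encoded by a path with two edges in H₂, and the encoding is injective. Such pairs at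
-- the discrete partition are the paths of H₁; so the paths of H₁ inject into those of
-- H₂ and conversely, and by finiteness every path of H₂ encodes a pair at P. This makes
-- P so rigid that its neighbours can be labelled injectively by edges of H₂, preserving
-- adjacency and triangles. Together with the same map for φ⁻¹ this yields a bijection
-- between the edges of H₁ and H₂ that preserves and reflects adjacency and triangles,
-- and hence, as in Whitney's theorem, an isomorphism of H₁ and H₂ up to isolated
-- vertices, which are the universal vertices of G₁ and G₂.
--
-- Conversely, an isomorphism of the G'ᵢ transfers partitions and preserves the number
-- of vertices minus the number of parts. If n₁ - k₁ < n₂ - k₂ and the Bell graphs are
-- isomorphic, this transfer is onto by finiteness; as that number can be lowered one
-- step at a time to any smaller value, it never exceeds n₁ - k₁ for either graph.

module Submission where

open import Defs
open import Data.Nat as ℕ using (ℕ; zero; suc; _+_; _∸_; _≤_; z≤n; s≤s)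
import Data.Nat.Properties as ℕP
open import Data.Bool using (Bool; true; false; if_then_else_; _∧_; not; T)
import Data.Bool.Properties as BoolP
open import Data.Bool.ListAction using (any)
open import Data.Fin as Fin using (Fin; zero; suc; toℕ)
import Data.Fin.Properties as FinP
open import Data.List using (tabulate; allFin)
import Data.List.Relation.Unary.Any.Properties as AnyP
open import Data.Product as Product using (Σ; _×_; _,_; proj₁; proj₂; ∃; ∃-syntax; map₂)
open import Data.Sum as Sum using (_⊎_; inj₁; inj₂; [_,_]′; swap)
open import Data.Empty using (⊥; ⊥-elim)
open import Relation.Nullary using (¬_; Dec; yes; no; does)
open import Relation.Nullary.Decidable using (dec-true; _×-dec_; _⊎-dec_; ¬?; map′)
open import Relation.Binary.PropositionalEquality as Eq
  using (_≡_; _≢_; refl; cong; subst; ≢-sym)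
open import Relation.Binary.Structures using (IsEquivalence)
open import Function using (_∘_; id)
open import Relation.Binary.Definitions using (Tri; tri<; tri≈; tri>)
open import Data.Maybe using (Maybe; just; nothing)
open import Data.Sum.Properties using (inj₁-injective; inj₂-injective)

-- If a graph has three vertices and no edges, and k ≤ 1, exchanging the discrete partition with the
-- partition into one part is an automorphism of the Bell graph. Parts of size three in the image P
-- are thus unavoidable; they account for the `opposes` marks and for some of the `rotate` codes.
-- The encoding would break down at one configuration only, a singleton of P that joins a part of
-- size two. `NoGrowth` names it, and it is excluded because two disjoint edges of H₁ have a common
-- neighbour that is not near the discrete partition. That neighbour, like the one that tells
-- triangles from stars, has two parts fewer than the discrete partition: this is the 2 in k + 2 ≤
-- n. Finiteness is applied to paths before edges because a neighbour of P has no evident edge as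
-- its label until all paths are known to occur as codes.

does-true : {A : Set} (a? : Dec A) → does a? ≡ true → A
does-true (yes a) _ = a

least : ∀ {n} {A : Fin n → Set} → (∀ x → Dec (A x)) → ∃ A →
  ∃ λ w → A w × (∀ z → A z → toℕ w ≤ toℕ z)
least {suc n} A? (x , Ax) with A? zero
... | yes A0 = zero , A0 , λ _ _ → z≤n
least {suc n} A? (zero , Ax) | no ¬A0 = ⊥-elim (¬A0 Ax)
least {suc n} A? (suc x , Ax) | no ¬A0
  with w , Aw , w≤ ← least (A? ∘ suc) (x , Ax) =
  suc w , Aw , λ { zero A0 → ⊥-elim (¬A0 A0) ; (suc z) Az → s≤s (w≤ z Az) }

-- Partitions and moves of a single vertex

-- Records rather than equations between Booleans, so that unification can recover
-- the partitions.
module _ {n : ℕ} {G : Graph n} where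

  infix 4 _[_~_] _≋_

  record _[_~_] (P : IPartition G) (x y : Fin n) : Set where
    constructor ⟦_⟧
    field same≡ : same P x y ≡ true
  open _[_~_] public

  ~? : (P : IPartition G) (x y : Fin n) → Dec (P [ x ~ y ])
  ~? P x y = map′ ⟦_⟧ same≡ (same P x y BoolP.≟ true)

  ~-refl : {P : IPartition G} {x : Fin n} → P [ x ~ x ]
  ~-refl {P} {x} = ⟦ same-refl P x ⟧

  ~-sym : {P : IPartition G} {x y : Fin n} → P [ x ~ y ] → P [ y ~ x ]
  ~-sym {P} {x} {y} ⟦ p ⟧ = ⟦ same-sym P x y p ⟧

  ~-trans : {P : IPartition G} {x y z : Fin n} → P [ x ~ y ] → P [ y ~ z ] → P [ x ~ z ]
  ~-trans {P} {x} {y} {z} ⟦ p ⟧ ⟦ q ⟧ = ⟦ same-trans P x y z p q ⟧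

  ≡⇒~ : {P : IPartition G} {x y : Fin n} → x ≡ y → P [ x ~ y ]
  ≡⇒~ refl = ~-refl

  record _≋_ (P Q : IPartition G) : Set where
    field
      ≋⇒ : ∀ {x y} → P [ x ~ y ] → Q [ x ~ y ]
      ≋⇐ : ∀ {x y} → Q [ x ~ y ] → P [ x ~ y ]
  open _≋_ public

  record Agree (v : Fin n) (P Q : IPartition G) : Set where
    field
      agree⇒ : ∀ {x y} → x ≢ v → y ≢ v → P [ x ~ y ] → Q [ x ~ y ]
      agree⇐ : ∀ {x y} → x ≢ v → y ≢ v → Q [ x ~ y ] → P [ x ~ y ]
  open Agree public

  Near : IPartition G → IPartition G → Set
  Near P Q = ∃[ v ] Agree v P Q

  ≋-refl : {P : IPartition G} → P ≋ P
  ≋-refl = record { ≋⇒ = id ; ≋⇐ = id }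

  ≋-sym : {P Q : IPartition G} → P ≋ Q → Q ≋ P
  ≋-sym e = record { ≋⇒ = ≋⇐ e ; ≋⇐ = ≋⇒ e }

  ≋-trans : {P Q R : IPartition G} → P ≋ Q → Q ≋ R → P ≋ R
  ≋-trans d e = record { ≋⇒ = ≋⇒ e ∘ ≋⇒ d ; ≋⇐ = ≋⇐ d ∘ ≋⇐ e }

  private
    true-iff : {b c : Bool} → (b ≡ true → c ≡ true) → (c ≡ true → b ≡ true) → b ≡ c
    true-iff {false} {false} f g = refl
    true-iff {false} {true}  f g = g refl
    true-iff {true}  {false} f g = Eq.sym (f refl)
    true-iff {true}  {true}  f g = refl

  ≋⇒≈ : {P Q : IPartition G} → P ≋ Q → P ≈P Q
  ≋⇒≈ e x y = true-iff (λ p → same≡ (≋⇒ e ⟦ p ⟧)) (λ q → same≡ (≋⇐ e ⟦ q ⟧))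

  ≈⇒≋ : {P Q : IPartition G} → P ≈P Q → P ≋ Q
  ≈⇒≋ e = record
    { ≋⇒ = λ { ⟦ p ⟧ → ⟦ Eq.trans (Eq.sym (e _ _)) p ⟧ }
    ; ≋⇐ = λ { ⟦ p ⟧ → ⟦ Eq.trans (e _ _) p ⟧ } }

  agree⇒same : {v : Fin n} {P Q : IPartition G} → Agree v P Q → SameAfterDeleting v P Q
  agree⇒same a x y x≢v y≢v =
    true-iff (λ p → same≡ (agree⇒ a x≢v y≢v ⟦ p ⟧)) (λ q → same≡ (agree⇐ a x≢v y≢v ⟦ q ⟧))

  same⇒agree : {v : Fin n} {P Q : IPartition G} → SameAfterDeleting v P Q → Agree v P Q
  same⇒agree s = record
    { agree⇒ = λ { x≢v y≢v ⟦ p ⟧ → ⟦ Eq.trans (Eq.sym (s _ _ x≢v y≢v)) p ⟧ }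
    ; agree⇐ = λ { x≢v y≢v ⟦ p ⟧ → ⟦ Eq.trans (s _ _ x≢v y≢v) p ⟧ } }

  agree-sym : {v : Fin n} {P Q : IPartition G} → Agree v P Q → Agree v Q P
  agree-sym a = record { agree⇒ = agree⇐ a ; agree⇐ = agree⇒ a }

  agree-trans : {v : Fin n} {P Q R : IPartition G} → Agree v P Q → Agree v Q R → Agree v P R
  agree-trans a b = record
    { agree⇒ = λ x≢v y≢v → agree⇒ b x≢v y≢v ∘ agree⇒ a x≢v y≢v
    ; agree⇐ = λ x≢v y≢v → agree⇐ a x≢v y≢v ∘ agree⇐ b x≢v y≢v }

  ≋⇒agree : {P Q : IPartition G} (v : Fin n) → P ≋ Q → Agree v P Q
  ≋⇒agree v e = record { agree⇒ = λ _ _ → ≋⇒ e ; agree⇐ = λ _ _ → ≋⇐ e }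

  near-sym : {P Q : IPartition G} → Near P Q → Near Q P
  near-sym (v , a) = v , agree-sym a

  near-resp : {P P' Q Q' : IPartition G} → P ≋ P' → Q ≋ Q' → Near P Q → Near P' Q'
  near-resp e f (v , a) =
    v , agree-trans (≋⇒agree v (≋-sym e)) (agree-trans a (≋⇒agree v f))

  ext : {P Q : IPartition G} → (∀ {x y} → x ≢ y → P [ x ~ y ] → Q [ x ~ y ]) →
    (∀ {x y} → x ≢ y → Q [ x ~ y ] → P [ x ~ y ]) → P ≋ Q
  ext f g = record { ≋⇒ = go f ; ≋⇐ = go g }
    where
    go : {P Q : IPartition G} → (∀ {x y} → x ≢ y → P [ x ~ y ] → Q [ x ~ y ]) →
      ∀ {x y} → P [ x ~ y ] → Q [ x ~ y ]
    go f {x} {y} p with x Fin.≟ y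
    ... | yes refl = ~-refl
    ... | no x≢y = f x≢y p

  agree-ext : {u : Fin n} {P Q : IPartition G} → Agree u P Q →
    (∀ {y} → y ≢ u → P [ u ~ y ] → Q [ u ~ y ]) →
    (∀ {y} → y ≢ u → Q [ u ~ y ] → P [ u ~ y ]) → P ≋ Q
  agree-ext {u} a f g = ext (go a f) (go (agree-sym a) g)
    where
    go : {P Q : IPartition G} → Agree u P Q → (∀ {y} → y ≢ u → P [ u ~ y ] → Q [ u ~ y ]) →
      ∀ {x y} → x ≢ y → P [ x ~ y ] → Q [ x ~ y ]
    go a f {x} {y} x≢y p with x Fin.≟ u | y Fin.≟ u
    ... | yes refl | _ = f (≢-sym x≢y) p
    ... | no x≢u | yes refl = ~-sym (f x≢u (~-sym p))
    ... | no x≢u | no y≢u = agree⇒ a x≢u y≢u p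

  agree-anchor : {u z : Fin n} {P Q : IPartition G} → Agree u P Q → z ≢ u →
    P [ u ~ z ] → Q [ u ~ z ] → P ≋ Q
  agree-anchor a z≢u p q = agree-ext a
    (λ y≢u r → ~-trans q (agree⇒ a z≢u y≢u (~-trans (~-sym p) r)))
    (λ y≢u r → ~-trans p (agree⇐ a z≢u y≢u (~-trans (~-sym q) r)))

  -- A step made by `u` may be credited to `w`: off `w` only the companions of `u` could differ, and
  -- the last two hypotheses compare these. It serves to find one vertex that makes both of two
  -- moves.
  agree-shift : {u w : Fin n} {P Q : IPartition G} → Agree u P Q →
    (∀ {z} → z ≢ u → z ≢ w → P [ u ~ z ] → Q [ u ~ z ]) →
    (∀ {z} → z ≢ u → z ≢ w → Q [ u ~ z ] → P [ u ~ z ]) → Agree w P Q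
  agree-shift {u} {w} a f g = record { agree⇒ = go a f ; agree⇐ = go (agree-sym a) g }
    where
    go : {P Q : IPartition G} → Agree u P Q →
      (∀ {z} → z ≢ u → z ≢ w → P [ u ~ z ] → Q [ u ~ z ]) →
      ∀ {x y} → x ≢ w → y ≢ w → P [ x ~ y ] → Q [ x ~ y ]
    go a f {x} {y} x≢w y≢w p with x Fin.≟ y
    ... | yes refl = ~-refl
    ... | no x≢y with x Fin.≟ u | y Fin.≟ u
    ... | yes refl | _ = f (≢-sym x≢y) y≢w p
    ... | no x≢u | yes refl = ~-sym (f x≢u x≢w (~-sym p))
    ... | no x≢u | no y≢u = agree⇒ a x≢u y≢u p

  record NonAdj (x y : Fin n) : Set where
    constructor nonAdj
    field
      apart  : x ≢ y
      no-adj : adj G x y ≡ false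
  open NonAdj public

  NonAdj? : ∀ x y → Dec (NonAdj x y)
  NonAdj? x y = map′ (λ (a , b) → nonAdj a b) (λ (nonAdj a b) → a , b)
    (¬? (x Fin.≟ y) ×-dec (adj G x y BoolP.≟ false))

  NonAdj-sym : ∀ {x y} → NonAdj x y → NonAdj y x
  NonAdj-sym {x} {y} (nonAdj x≢y e) = nonAdj (≢-sym x≢y) (Eq.trans (Graph.sym G y x) e)

  ~⇒NonAdj : {P : IPartition G} {x y : Fin n} → x ≢ y → P [ x ~ y ] → NonAdj x y
  ~⇒NonAdj {P} x≢y ⟦ p ⟧ = nonAdj x≢y (indep P _ _ p)

  Alone : IPartition G → Fin n → Set
  Alone Q u = ∀ {z} → Q [ u ~ z ] → z ≡ u

  -- The vertex w determines Q in both cases: u joins the part of w if they are apart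
  -- in P, and becomes a singleton if they are together.
  record Move (P Q : IPartition G) (u w : Fin n) : Set where
    constructor move
    field
      off  : Agree u P Q
      u≢target : u ≢ w
      how  : (¬ P [ u ~ w ] × Q [ u ~ w ]) ⊎ (P [ u ~ w ] × Alone Q u)
  open Move public

  move⇒NonAdj : {P Q : IPartition G} {u w : Fin n} → Move P Q u w → NonAdj u w
  move⇒NonAdj m with how m
  ... | inj₁ (_ , q) = ~⇒NonAdj (u≢target m) q
  ... | inj₂ (p , _) = ~⇒NonAdj (u≢target m) p

  -- `P` decides which case of `how` applies, so `Q` and `Q'` either both put `u` into the part of
  -- `w` or both make it a singleton.
  move-unique : {P Q Q' : IPartition G} {u w : Fin n} → Move P Q u w → Move P Q' u w → Q ≋ Q'
  move-unique {u = u} {w} m m' = agree-ext (agree-trans (agree-sym (off m)) (off m')) (go m m') (go m' m)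
    where
    go : {P Q Q' : IPartition G} → Move P Q u w → Move P Q' u w →
      ∀ {y} → y ≢ u → Q [ u ~ y ] → Q' [ u ~ y ]
    go m m' y≢u q with how m | how m'
    ... | inj₁ (_ , r) | inj₁ (_ , r') = ~-trans r' (agree⇒ (off m') w≢u y≢u (agree⇐ (off m) w≢u y≢u (~-trans (~-sym r) q)))
      where w≢u = ≢-sym (u≢target m)
    ... | inj₁ (¬p , _) | inj₂ (p , _) = ⊥-elim (¬p p)
    ... | inj₂ (p , _) | inj₁ (¬p , _) = ⊥-elim (¬p p)
    ... | inj₂ (_ , a) | inj₂ _ = ⊥-elim (y≢u (a q))

  -- Normal form for the target of a move; `u` is left out of the comparison because it may itself
  -- lie in the part of `w`.
  LeastIn : IPartition G → Fin n → Fin n → Set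
  LeastIn P u w = ∀ {z} → z ≢ u → P [ z ~ w ] → toℕ w ≤ toℕ z

  -- If `u` has company `z` in `Q`, the target is the least vertex other than `u` in the part of `z`
  -- in `P`. Otherwise `u` has left its part of `P`, and the target is the least vertex left behind.
  agree⇒move : {P Q : IPartition G} {u : Fin n} → Agree u P Q → ¬ P ≋ Q →
    ∃ λ w → Move P Q u w × LeastIn P u w
  agree⇒move {P} {Q} {u} a P≉Q
    with FinP.any? (λ z → ¬? (z Fin.≟ u) ×-dec ~? Q u z)
  ... | yes (z , z≢u , q)
    with least (λ w → ¬? (w Fin.≟ u) ×-dec ~? P z w) (z , z≢u , ~-refl)
  ... | w , (w≢u , p) , min = w ,
    move a (≢-sym w≢u) (inj₁ ((λ r → P≉Q (agree-anchor a z≢u (~-trans r (~-sym p)) q))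
                              , ~-trans q (agree⇒ a z≢u w≢u p))) ,
    λ {z'} z'≢u r → min z' (z'≢u , ~-trans p (~-sym r))
  agree⇒move {P} {Q} {u} a P≉Q | no none
    with FinP.any? (λ z → ¬? (z Fin.≟ u) ×-dec ~? P u z)
  ... | no none' = ⊥-elim (P≉Q (agree-ext a (λ y≢u p → ⊥-elim (none' (_ , y≢u , p)))
                                            (λ y≢u q → ⊥-elim (none (_ , y≢u , q)))))
  ... | yes (z , z≢u , p)
    with least (λ w → ¬? (w Fin.≟ u) ×-dec ~? P u w) (z , z≢u , p)
  ... | w , (w≢u , p') , min = w ,
    move a (≢-sym w≢u) (inj₂ (p' , alone)) ,
    λ {z'} z'≢u r → min z' (z'≢u , ~-trans p' (~-sym r))
    where
    alone : Alone Q u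
    alone {z} q with z Fin.≟ u
    ... | yes e = e
    ... | no z≢u = ⊥-elim (none (z , z≢u , q))

-- The number of parts

indicator : Bool → ℕ
indicator b = if b then 1 else 0

count : ∀ {n} → (Fin n → Bool) → ℕ
count {zero} p = 0
count {suc n} p = indicator (p zero) + count (p ∘ suc)

countB-tabulate : ∀ {n} {A : Set} (p : A → Bool) (f : Fin n → A) →
  countB p (tabulate f) ≡ count (p ∘ f)
countB-tabulate {zero} p f = refl
countB-tabulate {suc n} p f = cong (indicator (p (f zero)) +_) (countB-tabulate p (f ∘ suc))

countB-allFin : ∀ {n} (p : Fin n → Bool) → countB p (allFin n) ≡ count p
countB-allFin p = countB-tabulate p id

unrank : ∀ {n} (p : Fin n → Bool) → Fin (count p) → Fin n
unrank {suc n} p i with p zero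
unrank {suc n} p zero | true = zero
unrank {suc n} p (suc i) | true = suc (unrank (p ∘ suc) i)
unrank {suc n} p i | false = suc (unrank (p ∘ suc) i)

unrank-holds : ∀ {n} (p : Fin n → Bool) (i : Fin (count p)) → p (unrank p i) ≡ true
unrank-holds {suc n} p i with p zero in eq
unrank-holds {suc n} p zero | true = eq
unrank-holds {suc n} p (suc i) | true = unrank-holds (p ∘ suc) i
unrank-holds {suc n} p i | false = unrank-holds (p ∘ suc) i

unrank-injective : ∀ {n} (p : Fin n → Bool) {i j} → unrank p i ≡ unrank p j → i ≡ j
unrank-injective {suc n} p {i} {j} e with p zero
unrank-injective {suc n} p {zero} {zero} e | true = refl
unrank-injective {suc n} p {suc i} {suc j} e | true =
  cong suc (unrank-injective (p ∘ suc) (FinP.suc-injective e))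
unrank-injective {suc n} p e | false = unrank-injective (p ∘ suc) (FinP.suc-injective e)

unrank-surjective : ∀ {n} (p : Fin n → Bool) {x} → p x ≡ true → ∃ λ i → unrank p i ≡ x
unrank-surjective {suc n} p {x} px with p zero in eq
unrank-surjective {suc n} p {zero} px | true = zero , refl
unrank-surjective {suc n} p {suc x} px | true =
  let i , e = unrank-surjective (p ∘ suc) px in suc i , cong suc e
unrank-surjective {suc n} p {zero} px | false with () ← Eq.trans (Eq.sym eq) px
unrank-surjective {suc n} p {suc x} px | false =
  let i , e = unrank-surjective (p ∘ suc) px in i , cong suc e

module _ {n : ℕ} {G : Graph n} (P : IPartition G) where

  isLeader : Fin n → Bool
  isLeader x = not (any (λ y → (toℕ y ℕ.<ᵇ toℕ x) ∧ same P y x) (allFin n))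

  private
    not-true : ∀ {b} → (T b → ⊥) → not b ≡ true
    not-true {false} f = refl
    not-true {true} f = ⊥-elim (f _)

    not-true⁻ : ∀ {b} → not b ≡ true → T b → ⊥
    not-true⁻ {true} ()

    T-∧ : ∀ {a b} → T a → b ≡ true → T (a ∧ b)
    T-∧ {true} _ refl = _

    T-∧⁻ : ∀ {a b} → T (a ∧ b) → T a × b ≡ true
    T-∧⁻ {true} {true} _ = _ , refl

  leader-least : ∀ {x} → isLeader x ≡ true → ∀ {y} → P [ y ~ x ] → toℕ x ≤ toℕ y
  leader-least {x} l {y} ⟦ p ⟧ = ℕP.≮⇒≥ λ y<x → not-true⁻ l
    (AnyP.any⁺ _ (AnyP.tabulate⁺ {f = id} y (T-∧ (ℕP.<⇒<ᵇ y<x) p)))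

  least-leader : ∀ {x} → (∀ {y} → P [ y ~ x ] → toℕ x ≤ toℕ y) → isLeader x ≡ true
  least-leader {x} min = not-true λ t →
    let y , s = AnyP.tabulate⁻ {f = id} (AnyP.any⁻ _ (allFin n) t)
        y<x , p = T-∧⁻ s
    in ℕP.<⇒≱ (ℕP.<ᵇ⇒< _ _ y<x) (min ⟦ p ⟧)

  private
    numParts≡ : numParts P ≡ count isLeader
    numParts≡ = countB-allFin isLeader

    leaderOf : ∀ x → ∃ λ w → P [ x ~ w ] × isLeader w ≡ true
    leaderOf x with w , p , min ← least (~? P x) (x , ~-refl) =
      w , p , least-leader λ q → min _ (~-trans p (~-sym q))

    leader-unique : ∀ {x y} → isLeader x ≡ true → isLeader y ≡ true → P [ x ~ y ] → x ≡ y
    leader-unique lx ly p =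
      FinP.toℕ-injective (ℕP.≤-antisym (leader-least lx (~-sym p)) (leader-least ly p))

  leader : Fin (numParts P) → Fin n
  leader i = unrank isLeader (Fin.cast numParts≡ i)

  leader-apart : ∀ {i j} → P [ leader i ~ leader j ] → i ≡ j
  leader-apart {i} {j} p = FinP.toℕ-injective (begin
    toℕ i                          ≡⟨ FinP.toℕ-cast numParts≡ i ⟨
    toℕ (Fin.cast numParts≡ i)     ≡⟨ cong toℕ (unrank-injective isLeader
                                        (leader-unique (unrank-holds isLeader _) (unrank-holds isLeader _) p)) ⟩
    toℕ (Fin.cast numParts≡ j)     ≡⟨ FinP.toℕ-cast numParts≡ j ⟩
    toℕ j                          ∎)
    where open Eq.≡-Reasoning

  partIndex : Fin n → Fin (numParts P)
  partIndex x = Fin.cast (Eq.sym numParts≡)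
    (proj₁ (unrank-surjective isLeader (proj₂ (proj₂ (leaderOf x)))))

  leader-partIndex : ∀ x → P [ x ~ leader (partIndex x) ]
  leader-partIndex x = subst (λ w → P [ x ~ w ]) (Eq.sym (Eq.trans
      (cong (unrank isLeader) (FinP.cast-involutive numParts≡ (Eq.sym numParts≡) _))
      (proj₂ (unrank-surjective isLeader (proj₂ (proj₂ (leaderOf x)))))))
    (proj₁ (proj₂ (leaderOf x)))

  partIndex⇒~ : ∀ {x y} → partIndex x ≡ partIndex y → P [ x ~ y ]
  partIndex⇒~ {x} {y} e =
    ~-trans (leader-partIndex x)
      (~-trans (≡⇒~ (cong leader e)) (~-sym (leader-partIndex y)))

  numParts≤ : ∀ {m} (f : Fin n → Fin m) → (∀ {x y} → f x ≡ f y → P [ x ~ y ]) → numParts P ≤ m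
  numParts≤ f inj = FinP.injective⇒≤ {f = f ∘ leader} (leader-apart ∘ inj)

  ≤numParts : ∀ {m} (f : Fin m → Fin n) → (∀ {i j} → P [ f i ~ f j ] → i ≡ j) → m ≤ numParts P
  ≤numParts f inj = FinP.injective⇒≤ {f = partIndex ∘ f} (inj ∘ partIndex⇒~)

module _ {n : ℕ} {G : Graph n} where

  numParts-refine : {P Q : IPartition G} → (∀ {x y} → Q [ x ~ y ] → P [ x ~ y ]) →
    numParts P ≤ numParts Q
  numParts-refine {P} {Q} f = numParts≤ P (partIndex Q) (f ∘ partIndex⇒~ Q)

  numParts-resp : {P Q : IPartition G} → P ≋ Q → numParts P ≡ numParts Q
  numParts-resp e = ℕP.≤-antisym (numParts-refine (≋⇐ e)) (numParts-refine (≋⇒ e))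

  -- Vertices other than `v` are labelled by their parts in `Q`; the extra label is for `v`.
  numParts-agree : {v : Fin n} {P Q : IPartition G} → Agree v P Q → numParts P ≤ suc (numParts Q)
  numParts-agree {v} {P} {Q} a = numParts≤ P (λ x → index (x Fin.≟ v)) (λ {x} {y} → inj (x Fin.≟ v) (y Fin.≟ v))
    where
    index : ∀ {x} → Dec (x ≡ v) → Fin (suc (numParts Q))
    index (yes _) = zero
    index {x} (no _) = suc (partIndex Q x)
    inj : ∀ {x y} (d : Dec (x ≡ v)) (e : Dec (y ≡ v)) → index d ≡ index e → P [ x ~ y ]
    inj (yes refl) (yes refl) _ = ~-refl
    inj (no x≢v) (no y≢v) e = agree⇐ a x≢v y≢v (partIndex⇒~ Q (FinP.suc-injective e))

  -- Partitions from decidable equivalence relations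

  record PartRel : Set₁ where
    field
      _R_   : Fin n → Fin n → Set
      _R?_  : ∀ x y → Dec (x R y)
      equiv : IsEquivalence _R_
      R-ind : ∀ {x y} → x R y → x ≢ y → NonAdj {G = G} x y
    open IsEquivalence equiv public
  open PartRel using (_R_)

  fromRel : PartRel → IPartition G
  fromRel 𝓡 = record
    { same = λ x y → does (x R? y)
    ; same-refl = λ x → dec-true (x R? x) 𝓡.refl
    ; same-sym = λ x y p → dec-true (y R? x) (𝓡.sym (does-true (x R? y) p))
    ; same-trans = λ x y z p q →
        dec-true (x R? z) (𝓡.trans (does-true (x R? y) p) (does-true (y R? z) q))
    ; indep = ind
    }
    where
    module 𝓡 = PartRel 𝓡
    open 𝓡 using (_R?_)
    ind : ∀ x y → does (x R? y) ≡ true → adj G x y ≡ false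
    ind x y p with x Fin.≟ y
    ... | yes refl = irrefl G x
    ... | no x≢y = no-adj (𝓡.R-ind (does-true (x R? y) p) x≢y)

  ~⇒rel : (𝓡 : PartRel) → ∀ {x y} → fromRel 𝓡 [ x ~ y ] → _R_ 𝓡 x y
  ~⇒rel 𝓡 {x} {y} ⟦ p ⟧ = does-true (PartRel._R?_ 𝓡 x y) p

  rel⇒~ : (𝓡 : PartRel) → ∀ {x y} → _R_ 𝓡 x y → fromRel 𝓡 [ x ~ y ]
  rel⇒~ 𝓡 {x} {y} r = ⟦ dec-true (PartRel._R?_ 𝓡 x y) r ⟧

  private
    botRel : PartRel
    botRel = record { _R_ = _≡_ ; _R?_ = Fin._≟_ ; equiv = Eq.isEquivalence
                    ; R-ind = λ x≡y x≢y → ⊥-elim (x≢y x≡y) }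

  abstract
    bot : IPartition G
    bot = fromRel botRel

    bot⇒≡ : ∀ {x y} → bot [ x ~ y ] → x ≡ y
    bot⇒≡ = ~⇒rel botRel

  numParts-bot : n ≤ numParts bot
  numParts-bot = ≤numParts bot id bot⇒≡

  private
    restrictRel : (S : Fin n → Set) → (∀ x → Dec (S x)) → IPartition G → PartRel
    restrictRel S S? P = record
      { _R_ = λ x y → x ≡ y ⊎ (S x × S y × P [ x ~ y ])
      ; _R?_ = λ x y → (x Fin.≟ y) ⊎-dec (S? x ×-dec (S? y ×-dec ~? P x y))
      ; equiv = record
          { refl = inj₁ refl
          ; sym = λ { (inj₁ e) → inj₁ (Eq.sym e) ; (inj₂ (a , b , p)) → inj₂ (b , a , ~-sym p) }
          ; trans = λ { (inj₁ refl) r → r ; r (inj₁ refl) → r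
                      ; (inj₂ (a , _ , p)) (inj₂ (_ , c , q)) → inj₂ (a , c , ~-trans p q) } }
      ; R-ind = λ { (inj₁ e) ne → ⊥-elim (ne e) ; (inj₂ (_ , _ , p)) ne → ~⇒NonAdj ne p } }

  -- With all vertices but `u` as `S` this isolates `u`; with initial segments it gives the chain of
  -- partitions in `numParts-intermediate`.
  module Restrict (S : Fin n → Set) (S? : ∀ x → Dec (S x)) (P : IPartition G) where
    abstract
      restrict : IPartition G
      restrict = fromRel (restrictRel S S? P)

      restrict-cases : ∀ {x y} → restrict [ x ~ y ] → x ≡ y ⊎ (S x × S y × P [ x ~ y ])
      restrict-cases = ~⇒rel (restrictRel S S? P)

      restrict-keeps : ∀ {x y} → S x → S y → P [ x ~ y ] → restrict [ x ~ y ]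
      restrict-keeps a b p = rel⇒~ (restrictRel S S? P) (inj₂ (a , b , p))

      restrict-refines : ∀ {x y} → restrict [ x ~ y ] → P [ x ~ y ]
      restrict-refines r with restrict-cases r
      ... | inj₁ refl = ~-refl
      ... | inj₂ (_ , _ , p) = p

  module _ (u : Fin n) (P : IPartition G) where

    private module R = Restrict (_≢ u) (λ x → ¬? (x Fin.≟ u)) P

    isolate : IPartition G
    isolate = R.restrict

    isolate-agree : Agree u P isolate
    isolate-agree = record { agree⇒ = R.restrict-keeps ; agree⇐ = λ _ _ → R.restrict-refines }

    isolate-refines : ∀ {x y} → isolate [ x ~ y ] → P [ x ~ y ]
    isolate-refines = R.restrict-refines

    isolate-alone : Alone isolate u
    isolate-alone r with R.restrict-cases r
    ... | inj₁ e = Eq.sym e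
    ... | inj₂ (ne , _) = ⊥-elim (ne refl)

  -- Moving `v` to the part of `w` is the pullback of `P` along this map, so the equivalence laws
  -- are inherited without cases.
  redirect : Fin n → Fin n → Fin n → Fin n
  redirect v w x with x Fin.≟ v
  ... | yes _ = w
  ... | no _ = x

  redirect-≢ : ∀ {v w x} → x ≢ v → redirect v w x ≡ x
  redirect-≢ {v} {w} {x} x≢v with x Fin.≟ v
  ... | yes e = ⊥-elim (x≢v e)
  ... | no _ = refl

  redirect-≡ : ∀ v {w} → redirect v w v ≡ w
  redirect-≡ v with v Fin.≟ v
  ... | yes _ = refl
  ... | no ne = ⊥-elim (ne refl)

  module Join (v w : Fin n) (P : IPartition G)
    (h : ∀ {x} → P [ x ~ w ] → x ≢ v → NonAdj {G = G} v x) where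
    private
      ind : ∀ {x y} → P [ redirect v w x ~ redirect v w y ] → x ≢ y → NonAdj {G = G} x y
      ind {x} {y} p x≢y with x Fin.≟ v | y Fin.≟ v
      ... | yes refl | yes refl = ⊥-elim (x≢y refl)
      ... | yes refl | no y≢v = h (~-sym p) y≢v
      ... | no x≢v | yes refl = NonAdj-sym (h p x≢v)
      ... | no _ | no _ = ~⇒NonAdj x≢y p

      joinRel : PartRel
      joinRel = record
        { _R_ = λ x y → P [ redirect v w x ~ redirect v w y ]
        ; _R?_ = λ x y → ~? P _ _
        ; equiv = record { refl = ~-refl ; sym = ~-sym ; trans = ~-trans }
        ; R-ind = ind }

    abstract
      join : IPartition G
      join = fromRel joinRel

      join-agree : Agree v P join
      join-agree = record
        { agree⇒ = λ x≢v y≢v p → rel⇒~ joinRel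
            (~-trans (≡⇒~ (redirect-≢ x≢v)) (~-trans p (≡⇒~ (Eq.sym (redirect-≢ y≢v)))))
        ; agree⇐ = λ x≢v y≢v q →
            ~-trans (≡⇒~ (Eq.sym (redirect-≢ x≢v)))
              (~-trans (~⇒rel joinRel q) (≡⇒~ (redirect-≢ y≢v))) }

      join-joined : w ≢ v → join [ v ~ w ]
      join-joined w≢v = rel⇒~ joinRel
        (~-trans (≡⇒~ (redirect-≡ v)) (≡⇒~ (Eq.sym (redirect-≢ w≢v))))

-- Small merges of the discrete partition

module _ {n : ℕ} {G : Graph n} where

  module Pair {a b : Fin n} (h : NonAdj {G = G} a b) where

    private
      h' : ∀ {x} → bot {G = G} [ x ~ a ] → x ≢ b → NonAdj {G = G} b x
      h' p _ = subst (NonAdj b) (Eq.sym (bot⇒≡ p)) (NonAdj-sym h)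
      module J = Join {G = G} b a bot h'

    abstract
      pair : IPartition G
      pair = J.join

      pair-joined : pair [ a ~ b ]
      pair-joined = ~-sym (J.join-joined (apart h))

      pair-cases : ∀ {x y} → pair [ x ~ y ] → x ≡ y ⊎ (x ≡ a × y ≡ b) ⊎ (x ≡ b × y ≡ a)
      pair-cases {x} {y} p with x Fin.≟ b | y Fin.≟ b
      ... | yes refl | yes refl = inj₁ refl
      ... | yes refl | no y≢b =
        inj₂ (inj₂ (refl , Eq.sym (bot⇒≡ (agree⇐ J.join-agree (apart h) y≢b (~-trans pair-joined p)))))
      ... | no x≢b | yes refl =
        inj₂ (inj₁ (bot⇒≡ (agree⇐ J.join-agree x≢b (apart h) (~-trans p (~-sym pair-joined))) , refl))
      ... | no x≢b | no y≢b = inj₁ (bot⇒≡ (agree⇐ J.join-agree x≢b y≢b p))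

    pair-agree : ∀ {v} → v ≡ a ⊎ v ≡ b → Agree v bot pair
    pair-agree {v} v∈ = record { agree⇒ = λ _ _ p → ≡⇒~ (bot⇒≡ p) ; agree⇐ = back v∈ }
      where
      back : ∀ {v x y} → v ≡ a ⊎ v ≡ b → x ≢ v → y ≢ v → pair [ x ~ y ] → bot [ x ~ y ]
      back v∈ x≢v y≢v p with pair-cases p
      ... | inj₁ e = ≡⇒~ e
      back (inj₁ refl) x≢v y≢v p | inj₂ (inj₁ (e , _)) = ⊥-elim (x≢v e)
      back (inj₂ refl) x≢v y≢v p | inj₂ (inj₁ (_ , e)) = ⊥-elim (y≢v e)
      back (inj₁ refl) x≢v y≢v p | inj₂ (inj₂ (_ , e)) = ⊥-elim (y≢v e)
      back (inj₂ refl) x≢v y≢v p | inj₂ (inj₂ (e , _)) = ⊥-elim (x≢v e)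

    bot≉pair : ¬ bot ≋ pair
    bot≉pair e = apart h (bot⇒≡ (≋⇐ e pair-joined))

    pair-move : Move bot pair a b
    pair-move = move (pair-agree (inj₁ refl)) (apart h) (inj₁ (apart h ∘ bot⇒≡ , pair-joined))

    numParts-pair : n ≤ suc (numParts pair)
    numParts-pair = ℕP.≤-trans numParts-bot (numParts-agree (pair-agree (inj₁ refl)))

  open Pair public

  -- `pair` makes the same move of `u` with respect to `w`, and a move is determined by its vertex
  -- and target.
  near-bot⇒pair : {Q : IPartition G} {u : Fin n} → Agree u bot Q → ¬ bot ≋ Q →
    ∃ λ w → Σ (NonAdj u w) λ h → Q ≋ pair h
  near-bot⇒pair a ne with w , m , _ ← agree⇒move a ne =
    w , move⇒NonAdj m , move-unique m (pair-move (move⇒NonAdj m))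

  module TwoPairs {a b c d : Fin n} (h : NonAdj {G = G} a b) (h' : NonAdj {G = G} c d)
    (a≢c : a ≢ c) (a≢d : a ≢ d) (b≢c : b ≢ c) (b≢d : b ≢ d) where

    private
      ok : ∀ {x} → pair h [ x ~ c ] → x ≢ d → NonAdj {G = G} d x
      ok p _ with pair-cases h p
      ... | inj₁ refl = NonAdj-sym h'
      ... | inj₂ (inj₁ (_ , e)) = ⊥-elim (b≢c (Eq.sym e))
      ... | inj₂ (inj₂ (_ , e)) = ⊥-elim (a≢c (Eq.sym e))
      module J = Join {G = G} d c (pair h) ok

    twoPairs : IPartition G
    twoPairs = J.join

    private
      joined : twoPairs [ d ~ c ]
      joined = J.join-joined (apart h')

      joined₁ : twoPairs [ a ~ b ]
      joined₁ = agree⇒ J.join-agree a≢d b≢d (pair-joined h)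

      mates-d : ∀ {y} → y ≢ d → twoPairs [ d ~ y ] → c ≡ y
      mates-d y≢d p with pair-cases h (agree⇐ J.join-agree (apart h') y≢d (~-trans (~-sym joined) p))
      ... | inj₁ e = e
      ... | inj₂ (inj₁ (e , _)) = ⊥-elim (a≢c (Eq.sym e))
      ... | inj₂ (inj₂ (e , _)) = ⊥-elim (b≢c (Eq.sym e))

    twoPairs-agree₁ : Agree d (pair h) twoPairs
    twoPairs-agree₁ = J.join-agree

    twoPairs-agree₂ : Agree b (pair h') twoPairs
    twoPairs-agree₂ = record { agree⇒ = λ _ _ → fwd ; agree⇐ = bwd }
      where
      fwd : ∀ {x y} → pair h' [ x ~ y ] → twoPairs [ x ~ y ]
      fwd p with pair-cases h' p
      ... | inj₁ refl = ~-refl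
      ... | inj₂ (inj₁ (refl , refl)) = ~-sym joined
      ... | inj₂ (inj₂ (refl , refl)) = joined
      bwd : ∀ {x y} → x ≢ b → y ≢ b → twoPairs [ x ~ y ] → pair h' [ x ~ y ]
      bwd {x} {y} x≢b y≢b p with x Fin.≟ d | y Fin.≟ d
      ... | yes refl | yes refl = ~-refl
      ... | yes refl | no y≢d = ~-sym (~-trans (≡⇒~ (Eq.sym (mates-d y≢d p))) (pair-joined h'))
      ... | no x≢d | yes refl = ~-trans (≡⇒~ (Eq.sym (mates-d x≢d (~-sym p)))) (pair-joined h')
      ... | no x≢d | no y≢d with pair-cases h (agree⇐ J.join-agree x≢d y≢d p)
      ... | inj₁ e = ≡⇒~ e
      ... | inj₂ (inj₁ (_ , e)) = ⊥-elim (y≢b e)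
      ... | inj₂ (inj₂ (e , _)) = ⊥-elim (x≢b e)

    -- Whichever vertex is deleted, one of the two pairs survives.
    twoPairs-far : ¬ Near bot twoPairs
    twoPairs-far (v , g) with v Fin.≟ a | v Fin.≟ b
    ... | yes refl | _ = apart h' (Eq.sym (bot⇒≡ (agree⇐ g (≢-sym a≢d) (≢-sym a≢c) joined)))
    ... | no _ | yes refl = apart h' (Eq.sym (bot⇒≡ (agree⇐ g (≢-sym b≢d) (≢-sym b≢c) joined)))
    ... | no v≢a | no v≢b = apart h (bot⇒≡ (agree⇐ g (≢-sym v≢a) (≢-sym v≢b) joined₁))

    numParts-twoPairs : n ≤ suc (suc (numParts twoPairs))
    numParts-twoPairs = ℕP.≤-trans (numParts-pair h) (s≤s (numParts-agree J.join-agree))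

  open TwoPairs public

  module Triple {a b c : Fin n} (ab : NonAdj {G = G} a b) (ac : NonAdj {G = G} a c)
    (bc : NonAdj {G = G} b c) where

    private
      ok : ∀ {x} → pair ab [ x ~ a ] → x ≢ c → NonAdj {G = G} c x
      ok p _ with pair-cases ab p
      ... | inj₁ refl = NonAdj-sym ac
      ... | inj₂ (inj₁ (e , _)) = subst (NonAdj c) (Eq.sym e) (NonAdj-sym ac)
      ... | inj₂ (inj₂ (e , _)) = subst (NonAdj c) (Eq.sym e) (NonAdj-sym bc)
      module J = Join {G = G} c a (pair ab) ok

    triple : IPartition G
    triple = J.join

    private
      joined : triple [ c ~ a ]
      joined = J.join-joined (apart ac)

      joined₁ : triple [ a ~ b ]
      joined₁ = agree⇒ J.join-agree (apart ac) (apart bc) (pair-joined ab)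

      mates-c : ∀ {y} → y ≢ c → triple [ c ~ y ] → y ≡ a ⊎ y ≡ b
      mates-c y≢c p with pair-cases ab (agree⇐ J.join-agree (apart ac) y≢c (~-trans (~-sym joined) p))
      ... | inj₁ e = inj₁ (Eq.sym e)
      ... | inj₂ (inj₁ (_ , e)) = inj₂ e
      ... | inj₂ (inj₂ (_ , e)) = inj₁ e

      cases : ∀ {x y} → triple [ x ~ y ] → x ≢ y → (x ≡ a ⊎ x ≡ b ⊎ x ≡ c) × (y ≡ a ⊎ y ≡ b ⊎ y ≡ c)
      cases {x} {y} p x≢y with x Fin.≟ c | y Fin.≟ c
      ... | yes refl | yes refl = ⊥-elim (x≢y refl)
      ... | yes refl | no y≢c = inj₂ (inj₂ refl) , Sum.map₂ inj₁ (mates-c y≢c p)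
      ... | no x≢c | yes refl = Sum.map₂ inj₁ (mates-c x≢c (~-sym p)) , inj₂ (inj₂ refl)
      ... | no x≢c | no y≢c with pair-cases ab (agree⇐ J.join-agree x≢c y≢c p)
      ... | inj₁ e = ⊥-elim (x≢y e)
      ... | inj₂ (inj₁ (e , f)) = inj₁ e , inj₂ (inj₁ f)
      ... | inj₂ (inj₂ (e , f)) = inj₂ (inj₁ e) , inj₁ f

      toPair : {u v w : Fin n} (h : NonAdj {G = G} v w) →
        (∀ {x} → x ≡ a ⊎ x ≡ b ⊎ x ≡ c → x ≢ u → x ≡ v ⊎ x ≡ w) → triple [ v ~ w ] →
        Agree u (pair h) triple
      toPair {u} {v} {w} h sub t = record { agree⇒ = λ _ _ → fwd ; agree⇐ = bwd }
        where
        fwd : ∀ {x y} → pair h [ x ~ y ] → triple [ x ~ y ]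
        fwd p with pair-cases h p
        ... | inj₁ refl = ~-refl
        ... | inj₂ (inj₁ (refl , refl)) = t
        ... | inj₂ (inj₂ (refl , refl)) = ~-sym t
        bwd : ∀ {x y} → x ≢ u → y ≢ u → triple [ x ~ y ] → pair h [ x ~ y ]
        bwd {x} {y} x≢u y≢u p with x Fin.≟ y
        ... | yes e = ≡⇒~ e
        ... | no x≢y with sub (proj₁ (cases p x≢y)) x≢u | sub (proj₂ (cases p x≢y)) y≢u
        ... | inj₁ refl | inj₁ refl = ~-refl
        ... | inj₁ refl | inj₂ refl = pair-joined h
        ... | inj₂ refl | inj₁ refl = ~-sym (pair-joined h)
        ... | inj₂ refl | inj₂ refl = ~-refl

    triple-agree-c : Agree c (pair ab) triple
    triple-agree-c = J.join-agree

    triple-agree-b : Agree b (pair ac) triple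
    triple-agree-b = toPair ac
      (λ { (inj₁ e) _ → inj₁ e ; (inj₂ (inj₁ e)) ne → ⊥-elim (ne e) ; (inj₂ (inj₂ e)) _ → inj₂ e })
      (~-sym joined)

    triple-agree-a : Agree a (pair bc) triple
    triple-agree-a = toPair bc
      (λ { (inj₁ e) ne → ⊥-elim (ne e) ; (inj₂ e) _ → e }) (~-trans (~-sym joined₁) (~-sym joined))

    -- Whichever vertex is deleted, two vertices of the triple stay together.
    triple-far : ¬ Near bot triple
    triple-far (v , g) with v Fin.≟ a | v Fin.≟ b
    ... | yes refl | _ = apart bc (Eq.sym (bot⇒≡ (agree⇐ g (≢-sym (apart ac)) (≢-sym (apart ab)) (~-trans joined joined₁))))
    ... | no _ | yes refl = apart ac (Eq.sym (bot⇒≡ (agree⇐ g (≢-sym (apart bc)) (apart ab) joined)))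
    ... | no v≢a | no v≢b = apart ab (bot⇒≡ (agree⇐ g (≢-sym v≢a) (≢-sym v≢b) joined₁))

    numParts-triple : n ≤ suc (suc (numParts triple))
    numParts-triple = ℕP.≤-trans (numParts-pair ab) (s≤s (numParts-agree J.join-agree))

  open Triple public

-- Encoding adjacent neighbours of a partition by paths

module _ {n : ℕ} {G : Graph n} where

  -- The obstruction to encoding: from {`a`, `c`}, {`b`} the partitions {`a`, `b`}, {`c`} and {`a`,
  -- `b`, `c`} are adjacent neighbours, reached by moving `a` and `b` respectively and in no other
  -- way, and neither form of `Code` fits them.
  NoGrowth : IPartition G → IPartition G → Set
  NoGrowth P Q = ∀ {u w x} → w ≢ x → P [ w ~ x ] → ¬ P [ u ~ w ] → Alone P u →
    (∀ {z} → P [ w ~ z ] → z ≡ w ⊎ z ≡ x) → Agree u P Q → ¬ Q [ u ~ w ]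

  -- The adjacent neighbours Q, Q' of P are encoded by a path w, u, w' in the
  -- complement of G. If one vertex can make both moves, it is the centre u; otherwise
  -- w and w' are together and move with respect to u.
  data Code (P Q Q' : IPartition G) (w u w' : Fin n) : Set where
    common : Move P Q u w → Move P Q' u w' → LeastIn P u w → LeastIn P u w' →
      ¬ P [ w ~ w' ] → Code P Q Q' w u w'
    rotate : Move P Q w u → Move P Q' w' u → w ≢ w' → P [ w ~ w' ] →
      (∀ {z} → P [ z ~ w ] ⊎ P [ z ~ u ] → z ≡ w ⊎ z ≡ u ⊎ z ≡ w') → Code P Q Q' w u w'

  private
    common-code : {P Q Q' : IPartition G} {u : Fin n} → Agree u P Q → Agree u P Q' →
      ¬ P ≋ Q → ¬ P ≋ Q' → ¬ Q ≋ Q' → ∃ λ w → ∃ λ w' → Code P Q Q' w u w'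
    common-code {P} {u = u} a a' ne ne' Q≉Q'
      with w , m , l ← agree⇒move a ne | w' , m' , l' ← agree⇒move a' ne' =
      w , w' , common m m' l l' apart'
      where
      apart' : ¬ P [ w ~ w' ]
      apart' p with refl ← FinP.toℕ-injective (ℕP.≤-antisym
          (l (≢-sym (u≢target m')) (~-sym p)) (l' (≢-sym (u≢target m)) p)) = Q≉Q' (move-unique m m')

  module Encode {P Q Q' : IPartition G} (P≉Q : ¬ P ≋ Q) (P≉Q' : ¬ P ≋ Q') (Q≉Q' : ¬ Q ≋ Q')
    (ng : NoGrowth P Q) (ng' : NoGrowth P Q') where

    private
      module Distinct {a b c : Fin n} (PQ : Agree a P Q) (PQ' : Agree b P Q') (QQ' : Agree c Q Q')
        (a≢b : a ≢ b) (a≢c : a ≢ c) (b≢c : b ≢ c) where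

        b≢a = ≢-sym a≢b
        c≢a = ≢-sym a≢c
        c≢b = ≢-sym b≢c

        -- A companion `z` outside {`a`, `b`, `c`} keeps its place in all three steps; carried
        -- around the triangle `P`, `Q`, `Q'` it anchors the moved vertex and makes two of the
        -- partitions equal.
        closedP : ∀ {v z} → v ≡ a ⊎ v ≡ b ⊎ v ≡ c → P [ v ~ z ] → z ≡ a ⊎ z ≡ b ⊎ z ≡ c
        closedP {v} {z} v∈ p with z Fin.≟ a | z Fin.≟ b | z Fin.≟ c
        ... | yes e | _ | _ = inj₁ e
        ... | no _ | yes e | _ = inj₂ (inj₁ e)
        ... | no _ | no _ | yes e = inj₂ (inj₂ e)
        closedP (inj₁ refl) p | no z≢a | no z≢b | no z≢c =
          ⊥-elim (P≉Q (agree-anchor PQ z≢a p (agree⇐ QQ' a≢c z≢c (agree⇒ PQ' a≢b z≢b p))))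
        closedP (inj₂ (inj₁ refl)) p | no z≢a | no z≢b | no z≢c =
          ⊥-elim (P≉Q' (agree-anchor PQ' z≢b p (agree⇒ QQ' b≢c z≢c (agree⇒ PQ b≢a z≢a p))))
        closedP (inj₂ (inj₂ refl)) p | no z≢a | no z≢b | no z≢c =
          ⊥-elim (Q≉Q' (agree-anchor QQ' z≢c (agree⇒ PQ c≢a z≢a p) (agree⇒ PQ' c≢b z≢b p)))

        closedQ : ∀ {v z} → v ≡ a ⊎ v ≡ b ⊎ v ≡ c → Q [ v ~ z ] → z ≡ a ⊎ z ≡ b ⊎ z ≡ c
        closedQ {v} {z} v∈ p with z Fin.≟ a | z Fin.≟ b | z Fin.≟ c
        ... | yes e | _ | _ = inj₁ e
        ... | no _ | yes e | _ = inj₂ (inj₁ e)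
        ... | no _ | no _ | yes e = inj₂ (inj₂ e)
        closedQ (inj₁ refl) p | no z≢a | no z≢b | no z≢c =
          closedP (inj₁ refl) (agree⇐ PQ' a≢b z≢b (agree⇒ QQ' a≢c z≢c p))
        closedQ v∈@(inj₂ (inj₁ refl)) p | no z≢a | no z≢b | no z≢c = closedP v∈ (agree⇐ PQ b≢a z≢a p)
        closedQ v∈@(inj₂ (inj₂ refl)) p | no z≢a | no z≢b | no z≢c = closedP v∈ (agree⇐ PQ c≢a z≢a p)

        closedQ' : ∀ {v z} → v ≡ a ⊎ v ≡ b ⊎ v ≡ c → Q' [ v ~ z ] → z ≡ a ⊎ z ≡ b ⊎ z ≡ c
        closedQ' {v} {z} v∈ p with z Fin.≟ a | z Fin.≟ b | z Fin.≟ c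
        ... | yes e | _ | _ = inj₁ e
        ... | no _ | yes e | _ = inj₂ (inj₁ e)
        ... | no _ | no _ | yes e = inj₂ (inj₂ e)
        closedQ' v∈@(inj₁ refl) p | no z≢a | no z≢b | no z≢c = closedP v∈ (agree⇐ PQ' a≢b z≢b p)
        closedQ' v∈@(inj₂ (inj₁ refl)) p | no z≢a | no z≢b | no z≢c =
          closedP v∈ (agree⇐ PQ b≢a z≢a (agree⇐ QQ' b≢c z≢c p))
        closedQ' v∈@(inj₂ (inj₂ refl)) p | no z≢a | no z≢b | no z≢c = closedP v∈ (agree⇐ PQ' c≢b z≢b p)

        in-a : a ≡ a ⊎ a ≡ b ⊎ a ≡ c
        in-a = inj₁ refl
        in-b : b ≡ a ⊎ b ≡ b ⊎ b ≡ c
        in-b = inj₂ (inj₁ refl)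
        in-c : c ≡ a ⊎ c ≡ b ⊎ c ≡ c
        in-c = inj₂ (inj₂ refl)

        lonely : {R : IPartition G} {v w w' : Fin n} →
          (∀ {z} → R [ v ~ z ] → z ≡ v ⊎ z ≡ w ⊎ z ≡ w') → ¬ R [ v ~ w ] → ¬ R [ v ~ w' ] → Alone R v
        lonely cl nw nw' r with cl r
        ... | inj₁ e = e
        ... | inj₂ (inj₁ refl) = ⊥-elim (nw r)
        ... | inj₂ (inj₂ refl) = ⊥-elim (nw' r)

        from-b : ∀ {z} → z ≡ a ⊎ z ≡ b ⊎ z ≡ c → z ≡ b ⊎ z ≡ a ⊎ z ≡ c
        from-b (inj₁ e) = inj₂ (inj₁ e)
        from-b (inj₂ (inj₁ e)) = inj₁ e
        from-b (inj₂ (inj₂ e)) = inj₂ (inj₂ e)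

        from-c : ∀ {z} → z ≡ a ⊎ z ≡ b ⊎ z ≡ c → z ≡ c ⊎ z ≡ a ⊎ z ≡ b
        from-c (inj₁ e) = inj₂ (inj₁ e)
        from-c (inj₂ (inj₁ e)) = inj₂ (inj₂ e)
        from-c (inj₂ (inj₂ e)) = inj₁ e

        none : {R : IPartition G} {v : Fin n} {A : Set} → Alone R v →
          ∀ {z} → z ≢ v → R [ v ~ z ] → A
        none al z≢v r = ⊥-elim (z≢v (al r))

        -- Everything happens among `a`, `b` and `c`, so it suffices to go through the five ways in
        -- which `P` can divide them.
        codes : ∃ λ w → ∃ λ u → ∃ λ w' → Code P Q Q' w u w'
        codes with ~? P a b | ~? P a c | ~? P b c
        -- One part {`a`, `b`, `c`}: `Q` isolates `a` and `Q'` isolates `b`, both away from the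
        -- centre `c`.
        codes | yes ab | yes ac | _ = a , c , b ,
          rotate (move PQ a≢c (inj₂ (ac , lonely (closedQ in-a) ¬qab ¬qac)))
                 (move PQ' b≢c (inj₂ (~-trans (~-sym ab) ac , lonely (from-b ∘ closedQ' in-b) (¬q'ab ∘ ~-sym) ¬q'bc)))
                 a≢b ab closed
          where
          ¬qab : ¬ Q [ a ~ b ]
          ¬qab q = P≉Q (agree-anchor PQ b≢a ab q)
          ¬qac : ¬ Q [ a ~ c ]
          ¬qac q = P≉Q (agree-anchor PQ c≢a ac q)
          ¬q'ab : ¬ Q' [ a ~ b ]
          ¬q'ab q = P≉Q' (agree-anchor PQ' a≢b (~-sym ab) (~-sym q))
          ¬q'bc : ¬ Q' [ b ~ c ]
          ¬q'bc q = ¬q'ab (~-trans (agree⇒ PQ' a≢b c≢b ac) (~-sym q))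
          closed : ∀ {z} → P [ z ~ a ] ⊎ P [ z ~ c ] → z ≡ a ⊎ z ≡ c ⊎ z ≡ b
          closed p with [ closedP in-a ∘ ~-sym , closedP in-c ∘ ~-sym ]′ p
          ... | inj₁ e = inj₁ e
          ... | inj₂ (inj₁ e) = inj₂ (inj₂ e)
          ... | inj₂ (inj₂ e) = inj₂ (inj₁ e)
        codes | yes ab | no ¬ac | yes bc = ⊥-elim (¬ac (~-trans ab bc))
        codes | yes ab | no ¬ac | no ¬bc = sub (~? Q a c) (~? Q' b c)
          where
          ¬qab : ¬ Q [ a ~ b ]
          ¬qab q = P≉Q (agree-anchor PQ b≢a ab q)
          ¬q'ab : ¬ Q' [ a ~ b ]
          ¬q'ab q = P≉Q' (agree-anchor PQ' a≢b (~-sym ab) (~-sym q))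
          ¬qbc : ¬ Q [ b ~ c ]
          ¬qbc q = ¬bc (agree⇐ PQ b≢a c≢a q)
          ¬q'ac : ¬ Q' [ a ~ c ]
          ¬q'ac q = ¬ac (agree⇐ PQ' a≢b c≢b q)
          closed : ∀ {z} → P [ z ~ a ] ⊎ P [ z ~ c ] → z ≡ a ⊎ z ≡ c ⊎ z ≡ b
          closed p with [ closedP in-a ∘ ~-sym , closedP in-c ∘ ~-sym ]′ p
          ... | inj₁ e = inj₁ e
          ... | inj₂ (inj₁ e) = inj₂ (inj₂ e)
          ... | inj₂ (inj₂ e) = inj₂ (inj₁ e)
          P-a : ∀ {z} → P [ a ~ z ] → z ≡ a ⊎ z ≡ b
          P-a p with closedP in-a p
          ... | inj₁ e = inj₁ e
          ... | inj₂ (inj₁ e) = inj₂ e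
          ... | inj₂ (inj₂ refl) = ⊥-elim (¬ac p)
          P-b : ∀ {z} → P [ b ~ z ] → z ≡ a ⊎ z ≡ b
          P-b p = P-a (~-trans ab p)
          sub : Dec (Q [ a ~ c ]) → Dec (Q' [ b ~ c ]) → ∃ λ w → ∃ λ u → ∃ λ w' → Code P Q Q' w u w'
          sub (yes qac) (yes q'bc) = a , c , b ,
            rotate (move PQ a≢c (inj₁ (¬ac , qac))) (move PQ' b≢c (inj₁ (¬bc , q'bc))) a≢b ab closed
          -- `Q'` splits the part {`a`, `b`}, a step that `a` makes as well as `b`.
          sub _ (no ¬q'bc) =
            let w , w' , code = common-code PQ PQ'-a P≉Q P≉Q' Q≉Q' in w , a , w' , code
            where
            PQ'-a : Agree a P Q'
            PQ'-a = agree-shift PQ'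
              (λ z≢b z≢a p → ⊥-elim ([ z≢a , z≢b ]′ (P-b p)))
              (λ z≢b z≢a → none (lonely (from-b ∘ closedQ' in-b) (¬q'ab ∘ ~-sym) ¬q'bc) z≢b)
          sub (no ¬qac) _ =
            let w , w' , code = common-code PQ-b PQ' P≉Q P≉Q' Q≉Q' in w , b , w' , code
            where
            PQ-b : Agree b P Q
            PQ-b = agree-shift PQ
              (λ z≢a z≢b p → ⊥-elim ([ z≢a , z≢b ]′ (P-a p)))
              (λ z≢a z≢b → none (lonely (closedQ in-a) ¬qab ¬qac) z≢a)
        codes | no ¬ab | yes ac | yes bc = ⊥-elim (¬ab (~-trans ac (~-sym bc)))
        codes | no ¬ab | yes ac | no ¬bc with ~? Q' b c
        -- The singleton `b` of `P` would join the part {`a`, `c`}.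
        ... | yes q'bc = ⊥-elim (ng' c≢a (~-sym ac) ¬bc (lonely (from-b ∘ closedP in-b) (¬ab ∘ ~-sym) ¬bc)
                part PQ' q'bc)
          where
          part : ∀ {z} → P [ c ~ z ] → z ≡ c ⊎ z ≡ a
          part p with closedP in-c p
          ... | inj₁ e = inj₂ e
          ... | inj₂ (inj₁ refl) = ⊥-elim (¬bc (~-sym p))
          ... | inj₂ (inj₂ e) = inj₁ e
        ... | no ¬q'bc = ⊥-elim (P≉Q' (agree-ext PQ'
                (none (lonely (from-b ∘ closedP in-b) (¬ab ∘ ~-sym) ¬bc))
                (none (lonely (from-b ∘ closedQ' in-b)
                  (λ q → ¬q'bc (~-trans q (agree⇒ PQ' a≢b c≢b ac))) ¬q'bc))))
        codes | no ¬ab | no ¬ac | yes bc with ~? Q a c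
        ... | yes qac = ⊥-elim (ng c≢b (~-sym bc) ¬ac (lonely (closedP in-a) ¬ab ¬ac) part PQ qac)
          where
          part : ∀ {z} → P [ c ~ z ] → z ≡ c ⊎ z ≡ b
          part p with closedP in-c p
          ... | inj₁ refl = ⊥-elim (¬ac (~-sym p))
          ... | inj₂ (inj₁ e) = inj₂ e
          ... | inj₂ (inj₂ e) = inj₁ e
        ... | no ¬qac = ⊥-elim (P≉Q (agree-ext PQ
                (none (lonely (closedP in-a) ¬ab ¬ac))
                (none (lonely (closedQ in-a)
                  (λ q → ¬qac (~-trans q (agree⇒ PQ b≢a c≢a bc))) ¬qac))))
        codes | no ¬ab | no ¬ac | no ¬bc with ~? Q a b
        -- `c` is then alone both in `Q` and in `Q'`, which differ only at `c`.
        ... | yes qab = ⊥-elim (Q≉Q' (agree-ext QQ'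
                (none (lonely (from-c ∘ closedQ in-c) (¬qbc ∘ ~-trans (~-sym qab) ∘ ~-sym) (¬qbc ∘ ~-sym)))
                (none (lonely (from-c ∘ closedQ' in-c) (¬q'ac ∘ ~-sym)
                  (¬q'ac ∘ ~-trans (agree⇒ QQ' a≢c b≢c qab) ∘ ~-sym)))))
          where
          ¬qbc : ¬ Q [ b ~ c ]
          ¬qbc q = ¬bc (agree⇐ PQ b≢a c≢a q)
          ¬q'ac : ¬ Q' [ a ~ c ]
          ¬q'ac q = ¬ac (agree⇐ PQ' a≢b c≢b q)
        -- `Q` can only have joined `a` to `c`, and `Q'` only `b` to `c`, so `c` makes both moves.
        ... | no ¬qab =
          let w , w' , code = common-code PQ-c PQ'-c P≉Q P≉Q' Q≉Q' in w , c , w' , code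
          where
          only-c : {R : IPartition G} {v w : Fin n} →
            (∀ {z} → R [ v ~ z ] → z ≡ v ⊎ z ≡ w ⊎ z ≡ c) → ¬ R [ v ~ w ] →
            ∀ {z} → z ≢ v → z ≢ c → {A : Set} → R [ v ~ z ] → A
          only-c cl nw z≢v z≢c r with cl r
          ... | inj₁ e = ⊥-elim (z≢v e)
          ... | inj₂ (inj₁ refl) = ⊥-elim (nw r)
          ... | inj₂ (inj₂ e) = ⊥-elim (z≢c e)
          PQ-c : Agree c P Q
          PQ-c = agree-shift PQ (λ d e → only-c (closedP in-a) ¬ab d e) (λ d e → only-c (closedQ in-a) ¬qab d e)
          PQ'-c : Agree c P Q'
          PQ'-c = agree-shift PQ' (λ d e → only-c (from-b ∘ closedP in-b) (¬ab ∘ ~-sym) d e)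
            (λ d e → only-c (from-b ∘ closedQ' in-b) (¬qab ∘ agree⇐ QQ' a≢c b≢c ∘ ~-sym) d e)

    encode : Near P Q → Near P Q' → Near Q Q' → ∃ λ w → ∃ λ u → ∃ λ w' → Code P Q Q' w u w'
    encode (a , PQ) (b , PQ') (c , QQ') with a Fin.≟ b | a Fin.≟ c | b Fin.≟ c
    ... | yes refl | _ | _ =
      let w , w' , code = common-code PQ PQ' P≉Q P≉Q' Q≉Q' in w , a , w' , code
    ... | no _ | yes refl | _ =
      let w , w' , code = common-code PQ (agree-trans PQ QQ') P≉Q P≉Q' Q≉Q' in w , a , w' , code
    ... | no _ | no _ | yes refl =
      let w , w' , code = common-code (agree-trans PQ' (agree-sym QQ')) PQ' P≉Q P≉Q' Q≉Q' in w , b , w' , code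
    ... | no a≢b | no a≢c | no b≢c = Distinct.codes PQ PQ' QQ' a≢b a≢c b≢c

  -- Whether `w` and `w'` are together in `P` tells the two forms apart; within each form moves are
  -- unique.
  code-unique : {P Q Q' R R' : IPartition G} {w u w' : Fin n} →
    Code P Q Q' w u w' → Code P R R' w u w' → Q ≋ R × Q' ≋ R'
  code-unique (common m m' _ _ _) (common r r' _ _ _) = move-unique m r , move-unique m' r'
  code-unique (common _ _ _ _ np) (rotate _ _ _ p _) = ⊥-elim (np p)
  code-unique (rotate _ _ _ p _) (common _ _ _ _ np) = ⊥-elim (np p)
  code-unique (rotate m m' _ _ _) (rotate r r' _ _ _) = move-unique m r , move-unique m' r'

-- Injective maps on finite sets, and paths

iterate : {A : Set} → (A → A) → ℕ → A → A
iterate f zero x = x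
iterate f (suc i) x = f (iterate f i x)

module _ {A : Set} {_≈_ : A → A → Set} {N : ℕ} (code : A → Fin N)
  (code-injective : ∀ {x y} → code x ≡ code y → x ≈ y)
  {f : A → A} (f-injective : ∀ {x y} → f x ≈ f y → x ≈ y) where

  -- Pigeonhole makes two iterates agree, and injectivity cancels their common initial steps. The
  -- positive exponent exhibits `x` as a value of `f` up to `≈`, hence surjectivity.
  periodic : ∀ x → ∃ λ j → iterate f (suc j) x ≈ x
  periodic x with i , j , i<j , e ← FinP.pigeonhole (ℕP.n<1+n N) (λ i → code (iterate f (toℕ i) x)) =
    toℕ j ∸ suc (toℕ i) , cancel (toℕ i) (subst (λ m → iterate f m x ≈ iterate f (toℕ i) x) (begin
      toℕ j                                  ≡⟨ ℕP.m∸n+n≡m i<j ⟨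
      toℕ j ∸ suc (toℕ i) + suc (toℕ i)      ≡⟨ ℕP.+-comm (toℕ j ∸ suc (toℕ i)) _ ⟩
      suc (toℕ i + (toℕ j ∸ suc (toℕ i)))    ≡⟨ ℕP.+-suc (toℕ i) _ ⟨
      toℕ i + suc (toℕ j ∸ suc (toℕ i))      ∎) (code-injective (Eq.sym e)))
    where
    open Eq.≡-Reasoning
    cancel : ∀ i {d} → iterate f (i + d) x ≈ iterate f i x → iterate f d x ≈ x
    cancel zero e = e
    cancel (suc i) e = cancel i (f-injective e)

record Path {n : ℕ} (G : Graph n) : Set where
  constructor path
  field
    {start centre end} : Fin n
    centre-start : NonAdj {G = G} centre start
    centre-end   : NonAdj {G = G} centre end
    start≢end    : start ≢ end
open Path public

record _≈ᵖ_ {n : ℕ} {G : Graph n} (d e : Path G) : Set where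
  constructor same-path
  field
    start≡  : start d ≡ start e
    centre≡ : centre d ≡ centre e
    end≡    : end d ≡ end e

pathCode : {n : ℕ} {G : Graph n} → Path G → Fin (n ℕ.* (n ℕ.* n))
pathCode d = Fin.combine (start d) (Fin.combine (centre d) (end d))

pathCode-injective : {n : ℕ} {G : Graph n} {d e : Path G} → pathCode d ≡ pathCode e → d ≈ᵖ e
pathCode-injective {d = d} {e} eq
  with p , q ← FinP.combine-injective (start d) (Fin.combine (centre d) (end d)) (start e) (Fin.combine (centre e) (end e)) eq
  with r , s ← FinP.combine-injective (centre d) (end d) (centre e) (end e) q = same-path p r s

≅-sym : {G H : SGraph} → G ≅ H → H ≅ G
≅-sym {G} {H} φ = record
  { to = φ.from ; from = φ.to ; to-cong = φ.from-cong ; from-cong = φ.to-cong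
  ; to-from = φ.from-to ; from-to = φ.to-from
  ; E-to = λ x y e → φ.E-from _ _ (SGraph.E-resp H (≈-sym (φ.to-from x)) (≈-sym (φ.to-from y)) e)
  ; E-from = λ x y e → SGraph.E-resp H (φ.to-from x) (φ.to-from y) (φ.E-to _ _ e) }
  where
  module φ = _≅_ φ
  ≈-sym = IsEquivalence.sym (SGraph.≈-equiv H)

module _ {n : ℕ} {G : Graph n} where

  code⇒path : {P Q Q' : IPartition G} {w u w' : Fin n} → Code P Q Q' w u w' → Path G
  code⇒path (common m m' _ _ np) =
    path (move⇒NonAdj m) (move⇒NonAdj m') (λ { refl → np ~-refl })
  code⇒path (rotate m m' w≢w' _ _) =
    path (NonAdj-sym (move⇒NonAdj m)) (NonAdj-sym (move⇒NonAdj m')) w≢w'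

  code⇒path-code : {P Q Q' : IPartition G} {w u w' : Fin n} (c : Code P Q Q' w u w') →
    Code P Q Q' (start (code⇒path c)) (centre (code⇒path c)) (end (code⇒path c))
  code⇒path-code c@(common _ _ _ _ _) = c
  code⇒path-code c@(rotate _ _ _ _ _) = c

  same-pair : {a b c d : Fin n} {h : NonAdj {G = G} a b} {h' : NonAdj {G = G} c d} →
    pair h ≋ pair h' → (a ≡ c × b ≡ d) ⊎ (a ≡ d × b ≡ c)
  same-pair {h = h} {h'} e with pair-cases h' (≋⇒ e (pair-joined h))
  ... | inj₁ a≡b = ⊥-elim (apart h a≡b)
  ... | inj₂ s = s

  pair-cong : {a b c d : Fin n} {h : NonAdj {G = G} a b} {h' : NonAdj {G = G} c d} →
    (a ≡ c × b ≡ d) ⊎ (a ≡ d × b ≡ c) → pair h ≋ pair h'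
  pair-cong {h = h} {h'} (inj₁ (refl , refl)) = move-unique (pair-move h) (pair-move h')
  pair-cong {h = h} {h'} (inj₂ (refl , refl)) = move-unique (pair-move h)
    (move (pair-agree h' (inj₂ refl)) (apart h) (inj₁ (apart h ∘ bot⇒≡ , ~-sym (pair-joined h'))))

  -- Combinatorial half of `base-noGrowth`: a common neighbour of `S`, which splits {`w`, `x`}, and
  -- `Q`, which adds `u` to it, cannot be far from `P`. The cases are the vertex `s` at which `R`
  -- differs from `S`.
  isolated-growth : {P S Q R : IPartition G} {u w x s t : Fin n} → w ≢ x → P [ w ~ x ] →
    ¬ P [ u ~ w ] → Alone P u → (∀ {z} → P [ w ~ z ] → z ≡ w ⊎ z ≡ x) →
    Agree u P Q → Q [ u ~ w ] → Agree w P S → (∀ {y z} → S [ y ~ z ] → P [ y ~ z ]) → Alone S w →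
    Agree s R S → Agree t R Q → Near P R
  isolated-growth {P} {S} {Q} {R} {u} {w} {x} {s} {t} w≢x wx ¬uw alone part PQ uw PS S⊆P S-alone RS RQ
    with s Fin.≟ w | s Fin.≟ x | s Fin.≟ u
  ... | yes refl | _ | _ = w , agree-trans PS (agree-sym RS)
  ... | no _ | yes refl | _ = x , agree-trans PS-x (agree-sym RS)
    where
    PS-x : Agree x P S
    PS-x = agree-shift PS (λ z≢w z≢x p → ⊥-elim ([ z≢w , z≢x ]′ (part p)))
      (λ z≢w _ q → ⊥-elim (z≢w (S-alone q)))
  -- `R` separates `w` from `x` and `Q` does not, so `t` is one of them; the other one leads from
  -- `P` to `R`.
  ... | no _ | no _ | yes refl = last
    where
    u≢w : u ≢ w
    u≢w refl = ¬uw ~-refl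
    u≢x : u ≢ x
    u≢x refl = ¬uw (~-sym wx)
    Q-wx : Q [ w ~ x ]
    Q-wx = agree⇒ PQ (≢-sym u≢w) (≢-sym u≢x) wx
    ¬R-wx : ¬ R [ w ~ x ]
    ¬R-wx r = w≢x (Eq.sym (S-alone (agree⇒ RS (≢-sym u≢w) (≢-sym u≢x) r)))
    PS-x : Agree x P S
    PS-x = agree-shift PS (λ z≢w z≢x p → ⊥-elim ([ z≢w , z≢x ]′ (part p)))
      (λ z≢w _ q → ⊥-elim (z≢w (S-alone q)))
    shift : ∀ {v v'} → Agree v R Q → u ≢ v → u ≢ v' → Agree v' P S → Q [ u ~ v' ] →
      v' ≢ v → (R [ v' ~ v ] → ⊥) → (∀ {z} → z ≢ u → Q [ u ~ z ] → z ≡ v ⊎ z ≡ v') → Near P R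
    shift {v} {v'} RQ u≢v u≢v' PS uv' v'≢v ¬vv' cl = v' , agree-trans PS (agree-shift (agree-sym RS)
      (λ z≢u _ q → ⊥-elim (z≢u (alone (S⊆P q))))
      (λ {z} z≢u z≢v' r → ⊥-elim (go z≢u z≢v' r (z Fin.≟ v))))
      where
      go : ∀ {z} → z ≢ u → z ≢ v' → R [ u ~ z ] → Dec (z ≡ v) → ⊥
      go z≢u z≢v' r (yes refl) = ¬vv' (~-trans (~-sym (agree⇐ RQ u≢v v'≢v uv')) r)
      go z≢u z≢v' r (no z≢v) = [ z≢v , z≢v' ]′ (cl z≢u (agree⇒ RQ u≢v z≢v r))
    cl : ∀ {z} → z ≢ u → Q [ u ~ z ] → z ≡ w ⊎ z ≡ x
    cl z≢u q = part (agree⇐ PQ (≢-sym u≢w) z≢u (~-trans (~-sym uw) q))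
    last : Near P R
    last with t Fin.≟ w | t Fin.≟ x
    ... | yes refl | _ = shift RQ u≢w u≢x PS-x (~-trans uw Q-wx) (≢-sym w≢x) (¬R-wx ∘ ~-sym) cl
    ... | no _ | yes refl = shift RQ u≢x u≢w PS uw w≢x ¬R-wx (λ ne q → swap (cl ne q))
    ... | no t≢w | no t≢x = ⊥-elim (¬R-wx (agree⇐ RQ (≢-sym t≢w) (≢-sym t≢x) Q-wx))
  -- `w`, `x` and `u` lie in three parts of `R` but in one part of `Q`, too much for the single move
  -- of `t`.
  ... | no s≢w | no s≢x | no s≢u = ⊥-elim impossible
    where
    u≢w : u ≢ w
    u≢w refl = ¬uw ~-refl
    u≢x : u ≢ x
    u≢x refl = ¬uw (~-sym wx)
    Q-wx : Q [ w ~ x ]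
    Q-wx = agree⇒ PQ (≢-sym u≢w) (≢-sym u≢x) wx
    ¬R-wx : ¬ R [ w ~ x ]
    ¬R-wx r = w≢x (Eq.sym (S-alone (agree⇒ RS (≢-sym s≢w) (≢-sym s≢x) r)))
    ¬R-u : ∀ {z} → z ≢ s → z ≢ u → ¬ R [ u ~ z ]
    ¬R-u z≢s z≢u r = z≢u (alone (S⊆P (agree⇒ RS (≢-sym s≢u) z≢s r)))
    impossible : ⊥
    impossible with t Fin.≟ w | t Fin.≟ u
    ... | yes refl | _ = ¬R-u (≢-sym s≢x) (≢-sym u≢x) (agree⇐ RQ u≢w (≢-sym w≢x) (~-trans uw Q-wx))
    ... | no t≢w | yes refl = ¬R-wx (agree⇐ RQ (≢-sym u≢w) (≢-sym u≢x) Q-wx)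
    ... | no t≢w | no t≢u = ¬R-u (≢-sym s≢w) (≢-sym u≢w) (agree⇐ RQ (≢-sym t≢u) (≢-sym t≢w) uw)

-- Neighbours of the image of the discrete partition

module Image {n₁ n₂ : ℕ} {G₁ : Graph n₁} {G₂ : Graph n₂} {k₁ k₂ : ℕ} (k₁+2≤n₁ : k₁ + 2 ≤ n₁)
  (φ : Bell≥ k₁ G₁ ≅ Bell≥ k₂ G₂) where

  private
    module φ = _≅_ φ
    B₁ = Σ (IPartition G₁) λ P → k₁ ≤ numParts P
    B₂ = Σ (IPartition G₂) λ P → k₂ ≤ numParts P

    abstract
      bound₀ : n₁ ≤ numParts {G = G₁} bot → k₁ ≤ numParts {G = G₁} bot
      bound₀ le = ℕP.≤-trans (ℕP.m≤m+n k₁ 2) (ℕP.≤-trans k₁+2≤n₁ le)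

      -- For `twoPairs` and `triple`, which are two merges away from the discrete partition.
      bound₂ : {m : ℕ} → n₁ ≤ suc (suc m) → k₁ ≤ m
      bound₂ le = ℕP.+-cancelʳ-≤ 2 k₁ _
        (subst (k₁ + 2 ≤_) (ℕP.+-comm 2 _) (ℕP.≤-trans k₁+2≤n₁ le))

      bound₁ : {m : ℕ} → n₁ ≤ suc m → k₁ ≤ m
      bound₁ le = bound₂ (ℕP.m≤n⇒m≤1+n le)

  bot₁ : B₁
  bot₁ = bot , bound₀ numParts-bot

  pair₁ : ∀ {a b} → NonAdj {G = G₁} a b → B₁
  pair₁ h = pair h , bound₁ (numParts-pair h)

  to-≋ : {p q : B₁} → proj₁ p ≋ proj₁ q → proj₁ (φ.to p) ≋ proj₁ (φ.to q)
  to-≋ {p} {q} e = ≈⇒≋ (φ.to-cong {p} {q} (≋⇒≈ e))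

  to-from-≋ : (q : B₂) → proj₁ (φ.to (φ.from q)) ≋ proj₁ q
  to-from-≋ q = ≈⇒≋ (φ.to-from q)

  from-to-≋ : (p : B₁) → proj₁ (φ.from (φ.to p)) ≋ proj₁ p
  from-to-≋ p = ≈⇒≋ (φ.from-to p)

  from-≋ : {p q : B₂} → proj₁ p ≋ proj₁ q → proj₁ (φ.from p) ≋ proj₁ (φ.from q)
  from-≋ {p} {q} e = ≈⇒≋ (φ.from-cong {p} {q} (≋⇒≈ e))

  to-injective : {p q : B₁} → proj₁ (φ.to p) ≋ proj₁ (φ.to q) → proj₁ p ≋ proj₁ q
  to-injective {p} {q} e =
    ≋-trans (≋-sym (from-to-≋ p)) (≋-trans (from-≋ {φ.to p} {φ.to q} e) (from-to-≋ q))

  to-near : {p q : B₁} → Near (proj₁ p) (proj₁ q) → ¬ proj₁ p ≋ proj₁ q →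
    Near (proj₁ (φ.to p)) (proj₁ (φ.to q))
  to-near {p} {q} (v , a) ne
    with _ , v' , a' ← φ.E-to p q ((ne ∘ ≈⇒≋) , v , agree⇒same a) = v' , same⇒agree a'

  near-from : {p q : B₁} → Near (proj₁ (φ.to p)) (proj₁ (φ.to q)) → ¬ proj₁ p ≋ proj₁ q →
    Near (proj₁ p) (proj₁ q)
  near-from {p} {q} (v , a) ne
    with _ , v' , a' ← φ.E-from p q
      ((λ e → ne (to-injective {p} {q} (≈⇒≋ e))) , v , agree⇒same a) = v' , same⇒agree a'

  base : IPartition G₂
  base = proj₁ (φ.to bot₁)

  image : ∀ {a b} → NonAdj {G = G₁} a b → IPartition G₂
  image h = proj₁ (φ.to (pair₁ h))

  image-bound : ∀ {a b} (h : NonAdj {G = G₁} a b) → k₂ ≤ numParts (image h)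
  image-bound h = proj₂ (φ.to (pair₁ h))

  image-near : ∀ {a b} (h : NonAdj {G = G₁} a b) → Near base (image h)
  image-near h = to-near {bot₁} {pair₁ h} (_ , pair-agree h (inj₁ refl)) (bot≉pair h)

  image-≉ : ∀ {a b} (h : NonAdj {G = G₁} a b) → ¬ base ≋ image h
  image-≉ h e = bot≉pair h (to-injective {bot₁} {pair₁ h} e)

  image-near₂ : ∀ {a b c d v} (h : NonAdj {G = G₁} a b) (h' : NonAdj {G = G₁} c d) →
    v ≡ a ⊎ v ≡ b → v ≡ c ⊎ v ≡ d → ¬ pair h ≋ pair h' → Near (image h) (image h')
  image-near₂ h h' v∈ v∈' ne = to-near {pair₁ h} {pair₁ h'}
    (_ , agree-trans (agree-sym (pair-agree h v∈)) (pair-agree h' v∈')) ne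

  -- Pulled back along `φ`, `Q` becomes a neighbour of the discrete partition, hence a pair.
  preimage : {Q : IPartition G₂} → k₂ ≤ numParts Q → Near base Q → ¬ base ≋ Q →
    ∃ λ a → ∃ λ b → Σ (NonAdj a b) λ h → image h ≋ Q
  preimage {Q} Q∈ near ne =
    let p = φ.from (Q , Q∈)
        e = to-from-≋ (Q , Q∈)
        bot≉p = λ eq → ne (≋-trans (to-≋ {bot₁} {p} eq) e)
        u , a = near-from {bot₁} {p} (near-resp ≋-refl (≋-sym e) near) bot≉p
        w , h , eq = near-bot⇒pair a bot≉p
    in u , w , h , ≋-trans (to-≋ {pair₁ h} {p} (≋-sym eq)) e

  -- The vertex `v` turns an equality of `bot` and `D` into nearness, which asks for a vertex.
  far-image : (D : B₁) → ¬ Near bot (proj₁ D) → Fin n₁ → ¬ Near base (proj₁ (φ.to D))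
  far-image D far v near = far (near-from {bot₁} {D} near λ e → far (v , ≋⇒agree v e))

  disjoint-images : ∀ {a b c d} (h : NonAdj {G = G₁} a b) (h' : NonAdj {G = G₁} c d) →
    a ≢ c → a ≢ d → b ≢ c → b ≢ d →
    ∃ λ R → Near R (image h) × Near R (image h') × ¬ Near base R
  disjoint-images {a} h h' a≢c a≢d b≢c b≢d =
    proj₁ (φ.to D) ,
    near-sym (to-near {pair₁ h} {D} (_ , twoPairs-agree₁ h h' a≢c a≢d b≢c b≢d)
      (λ e → far (_ , agree-trans (pair-agree h (inj₁ refl)) (≋⇒agree _ e)))) ,
    near-sym (to-near {pair₁ h'} {D} (_ , twoPairs-agree₂ h h' a≢c a≢d b≢c b≢d)
      (λ e → far (_ , agree-trans (pair-agree h' (inj₁ refl)) (≋⇒agree _ e)))) ,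
    far-image D far a
    where
    D : B₁
    D = twoPairs h h' a≢c a≢d b≢c b≢d , bound₂ (numParts-twoPairs h h' a≢c a≢d b≢c b≢d)
    far = twoPairs-far h h' a≢c a≢d b≢c b≢d

  triangle-images : ∀ {a b c} (ab : NonAdj {G = G₁} a b) (ac : NonAdj {G = G₁} a c)
    (bc : NonAdj {G = G₁} b c) →
    ∃ λ R → Near (image ab) R × Near (image ac) R × Near (image bc) R × ¬ Near base R
  triangle-images {a} ab ac bc =
    proj₁ (φ.to D) ,
    to-near {pair₁ ab} {D} (_ , triple-agree-c ab ac bc)
      (λ e → far (_ , agree-trans (pair-agree ab (inj₁ refl)) (≋⇒agree _ e))) ,
    to-near {pair₁ ac} {D} (_ , triple-agree-b ab ac bc)
      (λ e → far (_ , agree-trans (pair-agree ac (inj₁ refl)) (≋⇒agree _ e))) ,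
    to-near {pair₁ bc} {D} (_ , triple-agree-a ab ac bc)
      (λ e → far (_ , agree-trans (pair-agree bc (inj₁ refl)) (≋⇒agree _ e))) ,
    far-image D far a
    where
    D : B₁
    D = triple ab ac bc , bound₂ (numParts-triple ab ac bc)
    far = triple-far ab ac bc

  abstract
    -- The preimages of Q and of P with w split off would be disjoint pairs, so both
    -- partitions would have a common neighbour that is not near P.
    base-noGrowth : {Q : IPartition G₂} → k₂ ≤ numParts Q → NoGrowth base Q
    base-noGrowth {Q} Q∈ {u} {w} {x} w≢x wx ¬uw alone part PQ uw
      = contra (preimage {S} S∈ (w , PS) P≉S) (preimage {Q} Q∈ (u , PQ) P≉Q)
      where
      S : IPartition G₂
      S = isolate w base
      PS : Agree w base S
      PS = isolate-agree w base
      S∈ : k₂ ≤ numParts S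
      S∈ = ℕP.≤-trans (proj₂ (φ.to bot₁)) (numParts-refine (isolate-refines w base))
      P≉S : ¬ base ≋ S
      P≉S e = w≢x (Eq.sym (isolate-alone w base (≋⇒ e wx)))
      P≉Q : ¬ base ≋ Q
      P≉Q e = ¬uw (≋⇐ e uw)
      Q-wx : Q [ w ~ x ]
      Q-wx = agree⇒ PQ (λ { refl → ¬uw ~-refl }) (λ { refl → ¬uw (~-sym wx) }) wx
      u≢w : u ≢ w
      u≢w refl = ¬uw ~-refl
      u≢x : u ≢ x
      u≢x refl = ¬uw (~-sym wx)
      S≉Q : ¬ Near S Q
      S≉Q (v , SQ) with v Fin.≟ u | v Fin.≟ w
      ... | yes refl | _ = w≢x (Eq.sym (isolate-alone w base (agree⇐ SQ (≢-sym u≢w) (≢-sym u≢x) Q-wx)))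
      ... | no _ | yes refl =
        u≢x (Eq.sym (alone (isolate-refines w base (agree⇐ SQ u≢w (≢-sym w≢x) (~-trans uw Q-wx)))))
      ... | no v≢u | no v≢w = ¬uw (isolate-refines w base (agree⇐ SQ (≢-sym v≢u) (≢-sym v≢w) uw))
      contra : (∃ λ a → ∃ λ b → Σ (NonAdj a b) λ h → image h ≋ S) →
        (∃ λ c → ∃ λ d → Σ (NonAdj c d) λ h' → image h' ≋ Q) → ⊥
      contra (a , b , h , e) (c , d , h' , e') =
        let R , (s , RS) , (t , RQ) , far = disjoint-images h h'
              (λ { refl → sharing (inj₁ refl) (inj₁ refl) }) (λ { refl → sharing (inj₁ refl) (inj₂ refl) })
              (λ { refl → sharing (inj₂ refl) (inj₁ refl) }) (λ { refl → sharing (inj₂ refl) (inj₂ refl) })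
        in far (isolated-growth w≢x wx ¬uw alone part PQ uw PS (isolate-refines w base) (isolate-alone w base)
                (agree-trans RS (≋⇒agree s e)) (agree-trans RQ (≋⇒agree t e')))
        where
        sharing : ∀ {v} → v ≡ a ⊎ v ≡ b → v ≡ c ⊎ v ≡ d → ⊥
        sharing v∈ v∈' = S≉Q (near-resp e e' (image-near₂ h h' v∈ v∈'
          (λ eq → S≉Q (u , ≋⇒agree u (≋-trans (≋-sym e)
            (≋-trans (to-≋ {pair₁ h} {pair₁ h'} eq) e'))))))

  private
    pair-≉ : (d : Path G₁) → ¬ pair (centre-start d) ≋ pair (centre-end d)
    pair-≉ d e with same-pair e
    ... | inj₁ (_ , eq) = start≢end d eq
    ... | inj₂ (eq , _) = apart (centre-end d) eq

  abstract
    encodePath : (d : Path G₁) → ∃ λ w → ∃ λ u → ∃ λ w' →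
      Code base (image (centre-start d)) (image (centre-end d)) w u w'
    encodePath d = Encode.encode (image-≉ (centre-start d)) (image-≉ (centre-end d))
      (pair-≉ d ∘ to-injective {pair₁ (centre-start d)} {pair₁ (centre-end d)})
      (base-noGrowth (image-bound (centre-start d))) (base-noGrowth (image-bound (centre-end d)))
      (image-near _) (image-near _)
      (image-near₂ (centre-start d) (centre-end d) (inj₁ refl) (inj₁ refl) (pair-≉ d))

  pathMap : Path G₁ → Path G₂
  pathMap d = let _ , _ , _ , c = encodePath d in code⇒path c

  pathMap-code : (d : Path G₁) → Code base (image (centre-start d)) (image (centre-end d))
    (start (pathMap d)) (centre (pathMap d)) (end (pathMap d))
  pathMap-code d = let _ , _ , _ , c = encodePath d in code⇒path-code c

  -- The code determines both images, hence both pairs, and a path is recovered from its two edges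
  -- in order: any other matching of their ends would identify two vertices of a path.
  pathMap-injective : {d e : Path G₁} → pathMap d ≈ᵖ pathMap e → d ≈ᵖ e
  pathMap-injective {d} {e} (same-path p q r) = go
    (same-pair (to-injective {pair₁ (centre-start d)} {pair₁ (centre-start e)} (proj₁ images)))
    (same-pair (to-injective {pair₁ (centre-end d)} {pair₁ (centre-end e)} (proj₂ images)))
    where
    transport : ∀ {Q Q' w u w' v y v'} → w ≡ v → u ≡ y → w' ≡ v' →
      Code base Q Q' w u w' → Code base Q Q' v y v'
    transport refl refl refl c = c
    images : image (centre-start d) ≋ image (centre-start e) × image (centre-end d) ≋ image (centre-end e)
    images = code-unique (transport p q r (pathMap-code d)) (pathMap-code e)
    go : (centre d ≡ centre e × start d ≡ start e) ⊎ (centre d ≡ start e × start d ≡ centre e) →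
      (centre d ≡ centre e × end d ≡ end e) ⊎ (centre d ≡ end e × end d ≡ centre e) → d ≈ᵖ e
    go (inj₁ (a , b)) (inj₁ (_ , c)) = same-path b a c
    go (inj₁ (a , _)) (inj₂ (b , _)) = ⊥-elim (apart (centre-end e) (Eq.trans (Eq.sym a) b))
    go (inj₂ (a , b)) (inj₁ (c , _)) = ⊥-elim (apart (centre-start e) (Eq.trans (Eq.sym c) a))
    go (inj₂ (a , _)) (inj₂ (b , _)) = ⊥-elim (start≢end e (Eq.trans (Eq.sym a) b))

-- Labelling the neighbours of a partition by edges

SamePair : {n : ℕ} → (x y x' y' : Fin n) → Set
SamePair x y x' y' = (x ≡ x' × y ≡ y') ⊎ (x ≡ y' × y ≡ x')

module Local {n : ℕ} {G : Graph n} {k : ℕ} (P : IPartition G)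
  (realised : (d : Path G) → ∃ λ Q → ∃ λ Q' → Code P Q Q' (start d) (centre d) (end d))
  (noGrowth : {Q : IPartition G} → k ≤ numParts Q → NoGrowth P Q) where

  private
    _∥_ : Fin n → Fin n → Set
    _∥_ = NonAdj {G = G}

  Lone : Fin n → Fin n → Set
  Lone x y = ∀ {z} → z ≢ x → P [ z ~ y ] → z ≡ y

  -- The targets of a `common` code are least in their parts. A companion `z` of `w` is again a
  -- nonneighbour of `u`, so the path from `z` through `u` to `w'` is realised as well, and `z` and
  -- `w` are both least.
  apart-lone : ∀ {w u w'} → u ∥ w → u ∥ w' → w ≢ w' → ¬ P [ w ~ w' ] → Lone u w
  apart-lone {w} {u} {w'} h h' ne np {z} z≢u p with z Fin.≟ w
  ... | yes e = e
  ... | no z≢w with realised (path h h' ne)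
  ... | _ , _ , rotate _ _ _ p' _ = ⊥-elim (np p')
  ... | Q , _ , common m m' l l' _ = ⊥-elim (contra (realised (path u∥z h' z≢w')))
    where
    z≢w' : z ≢ w'
    z≢w' refl = np (~-sym p)
    u∥z : u ∥ z
    u∥z with how m
    ... | inj₁ (_ , q) = ~⇒NonAdj {P = Q} (≢-sym z≢u)
                           (~-trans q (agree⇒ (off m) (≢-sym (u≢target m)) z≢u (~-sym p)))
    ... | inj₂ (q , _) = ~⇒NonAdj {P = P} (≢-sym z≢u) (~-trans q (~-sym p))
    contra : (∃ λ R → ∃ λ R' → Code P R R' z u w') → ⊥
    contra (_ , _ , rotate _ _ _ p' _) = np (~-trans (~-sym p) p')
    contra (_ , _ , common _ _ k _ _) = z≢w (FinP.toℕ-injective (ℕP.≤-antisym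
      (k (≢-sym (u≢target m)) (~-sym p)) (l z≢u p)))

  -- With `w` and `w'` together, the code that realises the path can only be a `rotate`.
  together-block : ∀ {w u w'} → u ∥ w → u ∥ w' → w ≢ w' → P [ w ~ w' ] →
    ∀ {z} → P [ z ~ w ] ⊎ P [ z ~ u ] → z ≡ w ⊎ z ≡ u ⊎ z ≡ w'
  together-block h h' ne p with realised (path h h' ne)
  ... | _ , _ , rotate _ _ _ _ block = block
  ... | _ , _ , common _ _ _ _ np = ⊥-elim (np p)

  -- A third nonneighbour `y` would be apart from `w` by `together-block`; then `apart-lone` would
  -- leave `w` without its companion `w'`.
  together-degree : ∀ {w u w'} → u ∥ w → u ∥ w' → w ≢ w' → P [ w ~ w' ] →
    ∀ {y} → u ∥ y → y ≡ w ⊎ y ≡ w'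
  together-degree {w} {u} {w'} h h' ne p {y} g with y Fin.≟ w | y Fin.≟ w'
  ... | yes e | _ = inj₁ e
  ... | no _ | yes e = inj₂ e
  ... | no y≢w | no y≢w' =
    ⊥-elim (ne (Eq.sym (apart-lone h g (≢-sym y≢w) wy (≢-sym (apart h')) (~-sym p))))
    where
    wy : ¬ P [ w ~ y ]
    wy q with together-block h h' ne p (inj₁ (~-sym q))
    ... | inj₁ e = y≢w e
    ... | inj₂ (inj₁ refl) = apart g refl
    ... | inj₂ (inj₂ e) = y≢w' e

  -- Q, a neighbour of P, stands for the pair {x , y}: in general the vertex moved
  -- and the one it joins or leaves, but a vertex leaving a part of size three
  -- stands for the two vertices left behind.
  data Mark (Q : IPartition G) (x y : Fin n) : Set where
    moves   : Move P Q x y → Lone x y → Mark Q x y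
    opposes : ∀ z → Agree z P Q → x ≢ y → z ≢ x → z ≢ y → P [ x ~ y ] → P [ z ~ x ] →
      (∀ {v} → P [ v ~ x ] → v ≡ x ⊎ v ≡ y ⊎ v ≡ z) → Alone Q z → Mark Q x y

  mark⇒NonAdj : {Q : IPartition G} {x y : Fin n} → Mark Q x y → x ∥ y
  mark⇒NonAdj (moves m _) = move⇒NonAdj m
  mark⇒NonAdj (opposes z _ x≢y _ _ p _ _ _) = ~⇒NonAdj {P = P} x≢y p

  mark-cong : {Q Q' : IPartition G} {x y : Fin n} → Q ≋ Q' → Mark Q x y → Mark Q' x y
  mark-cong e (moves (move o ne h) l) =
    moves (move (agree-trans o (≋⇒agree _ e)) ne
      (Sum.map (map₂ (≋⇒ e)) (map₂ (λ al q → al (≋⇐ e q))) h)) l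
  mark-cong e (opposes z a x≢y z≢x z≢y p q part al) =
    opposes z (agree-trans a (≋⇒agree _ e)) x≢y z≢x z≢y p q part (λ r → al (≋⇐ e r))

  -- If `w` has a further companion `z`, then `together-block` confines the parts concerned to {`w`,
  -- `u`, `z`}. By `noGrowth` the vertex `u` does not join {`w`, `z`}, so it leaves a part of size
  -- three.
  mark-exists : {Q : IPartition G} → k ≤ numParts Q → Near P Q → ¬ P ≋ Q → ∃ λ x → ∃ λ y → Mark Q x y
  mark-exists {Q} Q∈ (u , a) ne
    with w , m , _ ← agree⇒move a ne
    with FinP.any? (λ z → ¬? (z Fin.≟ u) ×-dec ~? P z w ×-dec ¬? (z Fin.≟ w))
  ... | no none = u , w , moves m lone
    where
    lone : Lone u w
    lone {z} z≢u p with z Fin.≟ w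
    ... | yes e = e
    ... | no z≢w = ⊥-elim (none (z , z≢u , p , z≢w))
  ... | yes (z , z≢u , p , z≢w) = go (how m)
    where
    u≢w = u≢target m
    u∥z : u ∥ z
    u∥z with how m
    ... | inj₁ (_ , q) = ~⇒NonAdj {P = Q} (≢-sym z≢u) (~-trans q (agree⇒ a (≢-sym u≢w) z≢u (~-sym p)))
    ... | inj₂ (q , _) = ~⇒NonAdj {P = P} (≢-sym z≢u) (~-trans q (~-sym p))
    block : ∀ {v} → P [ v ~ w ] ⊎ P [ v ~ u ] → v ≡ w ⊎ v ≡ u ⊎ v ≡ z
    block = together-block (move⇒NonAdj m) u∥z (≢-sym z≢w) (~-sym p)
    go : (¬ P [ u ~ w ] × Q [ u ~ w ]) ⊎ (P [ u ~ w ] × Alone Q u) → ∃ λ x → ∃ λ y → Mark Q x y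
    go (inj₁ (np , q)) = ⊥-elim (noGrowth Q∈ (≢-sym z≢w) (~-sym p) np alone part a q)
      where
      alone : Alone P u
      alone r with block (inj₂ (~-sym r))
      ... | inj₁ refl = ⊥-elim (np r)
      ... | inj₂ (inj₁ e) = e
      ... | inj₂ (inj₂ refl) = ⊥-elim (np (~-trans r p))
      part : ∀ {v} → P [ w ~ v ] → v ≡ w ⊎ v ≡ z
      part r with block (inj₁ (~-sym r))
      ... | inj₁ e = inj₁ e
      ... | inj₂ (inj₁ refl) = ⊥-elim (np (~-sym r))
      ... | inj₂ (inj₂ e) = inj₂ e
    go (inj₂ (q , alone)) = w , z , opposes u a (≢-sym z≢w) u≢w (≢-sym z≢u) (~-sym p) q part alone
      where
      part : ∀ {v} → P [ v ~ w ] → v ≡ w ⊎ v ≡ z ⊎ v ≡ u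
      part r with block (inj₁ r)
      ... | inj₁ e = inj₁ e
      ... | inj₂ (inj₁ e) = inj₂ (inj₂ e)
      ... | inj₂ (inj₂ e) = inj₂ (inj₁ e)

  -- The centre `u` lies on both labels. This is why a vertex leaving a part {`w`, `u`, `w'`} is
  -- given the opposite edge: for `w` and for `w'` that edge contains `u`.
  code-marks : {Q Q' : IPartition G} {w u w' : Fin n} → Code P Q Q' w u w' →
    (∃ λ x → Mark Q u x ⊎ Mark Q x u) × (∃ λ x → Mark Q' u x ⊎ Mark Q' x u)
  code-marks {w = w} {u} {w'} (common m m' _ _ np) =
    (w , inj₁ (moves m (apart-lone h h' w≢w' np))) ,
    (w' , inj₁ (moves m' (apart-lone h' h (≢-sym w≢w') (np ∘ ~-sym))))
    where
    h = move⇒NonAdj m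
    h' = move⇒NonAdj m'
    w≢w' : w ≢ w'
    w≢w' refl = np ~-refl
  code-marks {Q} {Q'} {w} {u} {w'} (rotate m m' w≢w' p block) =
    go m m' w≢w' p block ,
    go m' m (≢-sym w≢w') (~-sym p) λ q → flip3 (block (Sum.map₁ (λ r → ~-trans r (~-sym p)) q))
    where
    flip3 : ∀ {z} → z ≡ w ⊎ z ≡ u ⊎ z ≡ w' → z ≡ w' ⊎ z ≡ u ⊎ z ≡ w
    flip3 (inj₁ e) = inj₂ (inj₂ e)
    flip3 (inj₂ (inj₁ e)) = inj₂ (inj₁ e)
    flip3 (inj₂ (inj₂ e)) = inj₁ e
    go : ∀ {Q Q' w w'} → Move P Q w u → Move P Q' w' u → w ≢ w' → P [ w ~ w' ] →
      (∀ {z} → P [ z ~ w ] ⊎ P [ z ~ u ] → z ≡ w ⊎ z ≡ u ⊎ z ≡ w') →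
      ∃ λ x → Mark Q u x ⊎ Mark Q x u
    go {Q} {Q'} {w} {w'} m m' w≢w' p block with how m
    ... | inj₁ (np , _) = w , inj₂ (moves m lone)
      where
      lone : Lone w u
      lone z≢w r with block (inj₂ r)
      ... | inj₁ e = ⊥-elim (z≢w e)
      ... | inj₂ (inj₁ e) = e
      ... | inj₂ (inj₂ refl) = ⊥-elim (np (~-trans p r))
    ... | inj₂ (q , alone) = w' , inj₁ (opposes w (off m) (≢-sym (u≢target m')) (u≢target m) w≢w'
        (~-trans (~-sym q) p) q part alone)
      where
      part : ∀ {v} → P [ v ~ u ] → v ≡ u ⊎ v ≡ w' ⊎ v ≡ w
      part r with block (inj₂ r)
      ... | inj₁ e = inj₂ (inj₂ e)
      ... | inj₂ (inj₁ e) = inj₁ e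
      ... | inj₂ (inj₂ e) = inj₂ (inj₁ e)

  private
    -- The step changes whether `x` and `y` are together, so its vertex is one of them.
    mover-in : {Q : IPartition G} {x y v : Fin n} → Move P Q x y → Agree v P Q → v ≡ x ⊎ v ≡ y
    mover-in {x = x} {y} {v} m a with v Fin.≟ x | v Fin.≟ y
    ... | yes e | _ = inj₁ e
    ... | no _ | yes e = inj₂ e
    ... | no v≢x | no v≢y with how m
    ... | inj₁ (np , q) = ⊥-elim (np (agree⇐ a (≢-sym v≢x) (≢-sym v≢y) q))
    ... | inj₂ (p , al) = ⊥-elim (u≢target m (Eq.sym (al (agree⇒ a (≢-sym v≢x) (≢-sym v≢y) p))))

    moves-opposes : {Q : IPartition G} {x y x' y' z : Fin n} → Move P Q x y → Lone x y →
      Agree z P Q → x' ≢ y' → z ≢ x' → z ≢ y' → P [ x' ~ y' ] → P [ z ~ x' ] → Alone Q z → ⊥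
    moves-opposes m l a x'≢y' z≢x' z≢y' p q al with mover-in m a
    moves-opposes {x = x} {y} {x'} {y'} m l a x'≢y' z≢x' z≢y' p q al | inj₂ refl =
      x'≢y' (Eq.trans (only z≢x' (~-sym q)) (Eq.sym (only z≢y' (~-trans (~-sym p) (~-sym q)))))
      where
      only : ∀ {v} → y ≢ v → P [ v ~ y ] → v ≡ x
      only {v} y≢v r with v Fin.≟ x
      ... | yes e = e
      ... | no v≢x = ⊥-elim (y≢v (Eq.sym (l v≢x r)))
    ... | inj₁ refl with how m
    ... | inj₁ (_ , r) = u≢target m (Eq.sym (al r))
    ... | inj₂ (r , _) = x'≢y' (Eq.trans (l (≢-sym z≢x') (~-trans (~-sym q) r))
                           (Eq.sym (l (≢-sym z≢y') (~-trans (~-sym p) (~-trans (~-sym q) r)))))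

    two-of : ∀ {x y x' y' : Fin n} → x' ≢ y' → x' ≡ x ⊎ x' ≡ y → y' ≡ x ⊎ y' ≡ y → SamePair x y x' y'
    two-of ne (inj₁ e) (inj₁ e') = ⊥-elim (ne (Eq.trans e (Eq.sym e')))
    two-of ne (inj₁ e) (inj₂ e') = inj₁ (Eq.sym e , Eq.sym e')
    two-of ne (inj₂ e) (inj₁ e') = inj₂ (Eq.sym e' , Eq.sym e)
    two-of ne (inj₂ e) (inj₂ e') = ⊥-elim (ne (Eq.trans e (Eq.sym e')))

  -- The two kinds of label exclude each other, and `Q` determines which vertex has left a part of
  -- size three.
  mark-functional : {Q : IPartition G} {x y x' y' : Fin n} → Mark Q x y → Mark Q x' y' → SamePair x y x' y'
  mark-functional {Q} {x} {y} {x'} {y'} (moves m l) (moves m' l') with mover-in m (off m') | mover-in m' (off m)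
  ... | inj₁ refl | _ = inj₁ (refl , same-target (how m) (how m'))
    where
    same-target : (¬ P [ x ~ y ] × Q [ x ~ y ]) ⊎ (P [ x ~ y ] × Alone Q x) →
      (¬ P [ x ~ y' ] × Q [ x ~ y' ]) ⊎ (P [ x ~ y' ] × Alone Q x) → y ≡ y'
    same-target (inj₁ (_ , q)) (inj₁ (_ , q')) = Eq.sym (l (≢-sym (u≢target m'))
      (agree⇐ (off m) (≢-sym (u≢target m')) (≢-sym (u≢target m)) (~-trans (~-sym q') q)))
    same-target (inj₁ (_ , q)) (inj₂ (_ , al)) = ⊥-elim (u≢target m (Eq.sym (al q)))
    same-target (inj₂ (_ , al)) (inj₁ (_ , q)) = ⊥-elim (u≢target m' (Eq.sym (al q)))
    same-target (inj₂ (p , _)) (inj₂ (p' , _)) = Eq.sym (l (≢-sym (u≢target m')) (~-trans (~-sym p') p))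
  ... | inj₂ refl | inj₁ refl = ⊥-elim (u≢target m refl)
  ... | inj₂ refl | inj₂ refl = inj₂ (refl , refl)
  mark-functional (moves m l) (opposes z a x≢y z≢x z≢y p q _ al) =
    ⊥-elim (moves-opposes m l a x≢y z≢x z≢y p q al)
  mark-functional (opposes z a x≢y z≢x z≢y p q _ al) (moves m l) =
    ⊥-elim (moves-opposes m l a x≢y z≢x z≢y p q al)
  mark-functional {Q} {x} {y} {x'} {y'} (opposes z a x≢y z≢x z≢y p q part al)
    (opposes z' a' x'≢y' z'≢x' z'≢y' p' q' _ al') = two-of x'≢y'
      (choose (≢-sym z'≢x') (~-trans (~-sym q') z'~x))
      (choose (≢-sym z'≢y') (~-trans (~-sym p') (~-trans (~-sym q') z'~x)))
    where
    z≡z' : z ≡ z'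
    z≡z' with z Fin.≟ z' | z' Fin.≟ x
    ... | yes e | _ = e
    ... | no z≢z' | yes refl = ⊥-elim (z≢y (Eq.sym (al (agree⇒ a' z≢z' (≢-sym x≢y) (~-trans q p)))))
    ... | no z≢z' | no z'≢x = ⊥-elim (z≢x (Eq.sym (al (agree⇒ a' z≢z' (≢-sym z'≢x) q))))
    z'~x : P [ z' ~ x ]
    z'~x = ~-trans (≡⇒~ (Eq.sym z≡z')) q
    choose : ∀ {v} → v ≢ z' → P [ v ~ x ] → v ≡ x ⊎ v ≡ y
    choose v≢z' r with part r
    ... | inj₁ e = inj₁ e
    ... | inj₂ (inj₁ e) = inj₂ e
    ... | inj₂ (inj₂ e) = ⊥-elim (v≢z' (Eq.trans e z≡z'))

  private
    -- If `x` and `y` have no companions except possibly each other, joining or separating them can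
    -- be credited to either.
    move-flip : {Q : IPartition G} {x y : Fin n} → Lone x y → Lone y x → Move P Q y x → Move P Q x y
    move-flip {Q} {x} {y} l l' m = move (agree-shift (off m)
        (λ z≢y z≢x p → ⊥-elim (z≢y (l z≢x (~-sym p))))
        (λ z≢y z≢x q → ⊥-elim (go (how m) z≢y z≢x q)))
      (≢-sym y≢x) (how' (how m))
      where
      y≢x = u≢target m
      go : (¬ P [ y ~ x ] × Q [ y ~ x ]) ⊎ (P [ y ~ x ] × Alone Q y) →
        ∀ {z} → z ≢ y → z ≢ x → Q [ y ~ z ] → ⊥
      go (inj₁ (_ , r)) z≢y z≢x q =
        z≢x (l' z≢y (agree⇐ (off m) z≢y (≢-sym y≢x) (~-trans (~-sym q) r)))
      go (inj₂ (_ , al)) z≢y z≢x q = z≢y (al q)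
      how' : (¬ P [ y ~ x ] × Q [ y ~ x ]) ⊎ (P [ y ~ x ] × Alone Q y) →
        (¬ P [ x ~ y ] × Q [ x ~ y ]) ⊎ (P [ x ~ y ] × Alone Q x)
      how' (inj₁ (np , q)) = inj₁ (np ∘ ~-sym , ~-sym q)
      how' (inj₂ (p , al)) = inj₂ (~-sym p , alone)
        where
        alone : Alone Q x
        alone {z} q with z Fin.≟ y | z Fin.≟ x
        ... | _ | yes e = e
        ... | yes refl | no _ = ⊥-elim (y≢x (Eq.sym (al (~-sym q))))
        ... | no z≢y | no z≢x = ⊥-elim (z≢y (l z≢x
          (~-trans (~-sym (agree⇐ (off m) (≢-sym y≢x) z≢y q)) (~-sym p))))

    opposes-lone : ∀ {x y x' y' z} → SamePair x y x' y' → Lone x y → z ≢ x' → z ≢ y' →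
      P [ x' ~ y' ] → P [ z ~ x' ] → ⊥
    opposes-lone (inj₁ (refl , refl)) l z≢x' z≢y' p q = z≢y' (l z≢x' (~-trans q p))
    opposes-lone (inj₂ (refl , refl)) l z≢x' z≢y' p q = z≢x' (l z≢y' q)

  -- The kinds cannot clash: the ends of an `opposes` label have a common third companion, which
  -- `Lone` forbids.
  mark-injective : {Q Q' : IPartition G} {x y x' y' : Fin n} → Mark Q x y → Mark Q' x' y' →
    SamePair x y x' y' → Q ≋ Q'
  mark-injective (moves m _) (moves m' _) (inj₁ (refl , refl)) = move-unique m m'
  mark-injective (moves m l) (moves m' l') (inj₂ (refl , refl)) = move-unique m (move-flip l l' m')
  mark-injective (moves m l) (opposes z _ _ z≢x z≢y p q _ _) s = ⊥-elim (opposes-lone s l z≢x z≢y p q)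
  mark-injective (opposes z _ _ z≢x z≢y p q _ _) (moves m l) s = ⊥-elim (opposes-lone (flip s) l z≢x z≢y p q)
    where
    flip : ∀ {x y x' y'} → SamePair x y x' y' → SamePair x' y' x y
    flip (inj₁ (refl , refl)) = inj₁ (refl , refl)
    flip (inj₂ (refl , refl)) = inj₂ (refl , refl)
  mark-injective {x = x} {y} {x'} {y'} (opposes z a x≢y z≢x z≢y p q part al)
    (opposes z' a' x'≢y' z'≢x' z'≢y' p' q' _ al') s =
    go (third (part (z'~x s)) s)
    where
    z'~x : SamePair x y x' y' → P [ z' ~ x ]
    z'~x (inj₁ (refl , _)) = q'
    z'~x (inj₂ (refl , _)) = ~-trans q' p'
    third : z' ≡ x ⊎ z' ≡ y ⊎ z' ≡ z → SamePair x y x' y' → z' ≡ z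
    third (inj₂ (inj₂ e)) _ = e
    third (inj₁ refl) (inj₁ (refl , _)) = ⊥-elim (z'≢x' refl)
    third (inj₁ refl) (inj₂ (refl , _)) = ⊥-elim (z'≢y' refl)
    third (inj₂ (inj₁ refl)) (inj₁ (_ , refl)) = ⊥-elim (z'≢y' refl)
    third (inj₂ (inj₁ refl)) (inj₂ (_ , refl)) = ⊥-elim (z'≢x' refl)
    go : z' ≡ z → _
    go refl = move-unique (move a z≢x (inj₂ (q , al))) (move a' z≢x (inj₂ (q , al')))

  module Star {u w₁ w₂ w₃ : Fin n} {Q₁ Q₂ Q₃ R : IPartition G}
    (h₁ : u ∥ w₁) (h₂ : u ∥ w₂) (h₃ : u ∥ w₃)
    (w₁≢w₂ : w₁ ≢ w₂) (w₁≢w₃ : w₁ ≢ w₃) (w₂≢w₃ : w₂ ≢ w₃)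
    (far : ¬ Near P R) where

    private
      ne : ∀ {w w' w''} → u ∥ w → u ∥ w' → u ∥ w'' → w ≢ w' → w ≢ w'' → w' ≢ w'' → ¬ P [ w ~ w' ]
      ne h h' h'' a b c p with together-degree h h' a p h''
      ... | inj₁ e = b (Eq.sym e)
      ... | inj₂ e = c (Eq.sym e)

      toMove : ∀ {Q x y w w' w''} → u ∥ w → u ∥ w' → u ∥ w'' → w ≢ w' → w ≢ w'' → w' ≢ w'' →
        Mark Q x y → SamePair x y u w → Move P Q u w × Lone u w
      toMove h h' h'' a b c (moves m l) (inj₁ (refl , refl)) = m , l
      toMove h h' h'' a b c (moves m l) (inj₂ (refl , refl)) = move-flip l' l m , l'
        where
        l' : Lone _ _
        l' = apart-lone h h' a (ne h h' h'' a b c)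
      toMove {w' = w'} {w''} h h' h'' a b c (opposes z _ _ z≢x z≢y p q _ _) s = ⊥-elim (contra s)
        where
        pick : ∀ {w} → w ≢ w' → w ≢ w'' → w' ≡ w ⊎ w' ≡ z → w'' ≡ w ⊎ w'' ≡ z → ⊥
        pick a b (inj₁ e) _ = a (Eq.sym e)
        pick a b (inj₂ e) (inj₁ e') = b (Eq.sym e')
        pick a b (inj₂ e) (inj₂ e') = c (Eq.trans e (Eq.sym e'))
        contra : SamePair _ _ u _ → ⊥
        contra (inj₁ (refl , refl)) =
          let d = together-degree h (~⇒NonAdj {P = P} (≢-sym z≢x) (~-sym q)) (≢-sym z≢y)
                    (~-sym (~-trans q p)) in
          pick a b (d h') (d h'')
        contra (inj₂ (refl , refl)) =
          let d = together-degree h (~⇒NonAdj {P = P} (≢-sym z≢y) (~-sym (~-trans q p))) (≢-sym z≢x)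
                    (~-sym q) in
          pick a b (d h') (d h'')

      mates : ∀ {Q w} → Move P Q u w → Lone u w → ∀ {z} → z ≢ u → Q [ u ~ z ] → z ≡ w
      mates m l z≢u q with how m
      ... | inj₁ (_ , r) = l z≢u (agree⇐ (off m) z≢u (≢-sym (u≢target m)) (~-trans (~-sym q) r))
      ... | inj₂ (_ , al) = ⊥-elim (z≢u (al q))

      Joins : IPartition G → Fin n → Set
      Joins Q w = Q [ u ~ w ]

      -- Otherwise `u` and `w` are together in `R` too. `Q'` and `Q''` keep them apart, so both
      -- steps to `R` move `w`; then `u` is with `w'` in `R`, and therefore in `Q''`, where its only
      -- possible companion is `w''`.
      mover-is : ∀ {Q Q' Q'' w w' w'' s s' s''} → Move P Q u w → Lone u w → Move P Q' u w' → Lone u w' →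
        Move P Q'' u w'' → Lone u w'' → w ≢ w' → w ≢ w'' → w' ≢ w'' →
        Agree s Q R → Agree s' Q' R → Agree s'' Q'' R → s ≢ u → s' ≢ u → s'' ≢ u →
        Joins Q w → Joins Q' w' → s ≡ w
      mover-is {w = w} {w'} {w''} {s} {s'} {s''} m l m' l' m'' l'' w≢w' w≢w'' w'≢w'' a a' a'' su su' su'' j j'
        with s Fin.≟ w | s' Fin.≟ w | s'' Fin.≟ w
      ... | yes e | _ | _ = e
      ... | no s≢w | no s'≢w | _ = ⊥-elim (w≢w' (mates m' l' (≢-sym (u≢target m))
          (agree⇐ a' (≢-sym su') (≢-sym s'≢w) (agree⇒ a (≢-sym su) (≢-sym s≢w) j))))
      ... | no s≢w | yes refl | no s''≢w = ⊥-elim (w≢w'' (mates m'' l'' (≢-sym (u≢target m))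
          (agree⇐ a'' (≢-sym su'') (≢-sym s''≢w) (agree⇒ a (≢-sym su) (≢-sym s≢w) j))))
      ... | no s≢w | yes refl | yes refl = ⊥-elim (w'≢w'' (mates m'' l'' (≢-sym (u≢target m'))
          (agree⇐ a'' (≢-sym su'') (≢-sym w≢w') (agree⇒ a' (≢-sym su') (≢-sym w≢w') j'))))

      not-u : ∀ {Q w s} → Move P Q u w → Agree s Q R → s ≢ u
      not-u m a refl = far (_ , agree-trans (off m) a)

      -- By `mover-is` the steps to `R` move `w` and `w'`. So `R` agrees with `P` off `u`, except
      -- perhaps on whether `w` and `w'` are together, and the third partition `Q''` settles that.
      two-joins : ∀ {Q Q' Q'' w w' w''} → Move P Q u w → Lone u w → Move P Q' u w' → Lone u w' →
        Move P Q'' u w'' → Lone u w'' → w ≢ w' → w ≢ w'' → w' ≢ w'' → u ∥ w'' →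
        ¬ P [ w ~ w' ] → Near Q R → Near Q' R → Near Q'' R → Joins Q w → Joins Q' w' → ⊥
      two-joins {Q} {Q'} {Q''} {w} {w'} {w''} m l m' l' m'' l'' w≢w' w≢w'' w'≢w'' h'' np
        (s , a) (s' , a') (s'' , a'') j j' = far (u , record { agree⇒ = fwd ; agree⇐ = bwd })
        where
        su = not-u m a
        su' = not-u m' a'
        su'' = not-u m'' a''
        s≡w : s ≡ w
        s≡w = mover-is m l m' l' m'' l'' w≢w' w≢w'' w'≢w'' a a' a'' su su' su'' j j'
        s'≡w' : s' ≡ w'
        s'≡w' = mover-is m' l' m l m'' l'' (≢-sym w≢w') w'≢w'' w≢w'' a' a a'' su' su su'' j' j
        ¬R-ww' : ¬ R [ w ~ w' ]
        ¬R-ww' r with how m''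
        -- Otherwise `w` would have nonneighbours `u` and `w'` in different parts of `P`, which
        -- leaves `u` no companion but possibly `w`; yet `w''` is one.
        ... | inj₂ (p , _) = ≢-sym (apart h'') (apart-lone {w = u} {u = w} {w' = w'} (NonAdj-sym (move⇒NonAdj m))
                (~⇒NonAdj {P = R} w≢w' r) (u≢target m')
                (λ q → u≢target m' (Eq.sym (u-not q)))
                (≢-sym w≢w'') (~-sym p))
          where
          u-not : P [ u ~ w' ] → w' ≡ u
          u-not q with how m'
          ... | inj₁ (np , _) = ⊥-elim (np q)
          ... | inj₂ (_ , al) = al j'
        ... | inj₁ (_ , j'') with refl ← mover-is m'' l'' m l m' l' (≢-sym w≢w'') (≢-sym w'≢w'') w≢w' a'' a a' su'' su su' j'' j =
          np (agree⇐ (off m'') (≢-sym (u≢target m)) (≢-sym (u≢target m')) (agree⇐ a'' w≢w'' w'≢w'' r))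
        fwd : ∀ {x y} → x ≢ u → y ≢ u → P [ x ~ y ] → R [ x ~ y ]
        fwd {x} {y} x≢u y≢u p with x Fin.≟ y
        ... | yes e = ≡⇒~ e
        ... | no x≢y with x Fin.≟ w | y Fin.≟ w
        ... | yes refl | _ = ⊥-elim (x≢y (Eq.sym (l y≢u (~-sym p))))
        ... | no _ | yes refl = ⊥-elim (x≢y (l x≢u p))
        ... | no x≢w | no y≢w = agree⇒ a (λ e → x≢w (Eq.trans e s≡w)) (λ e → y≢w (Eq.trans e s≡w))
                                  (agree⇒ (off m) x≢u y≢u p)
        bwd : ∀ {x y} → x ≢ u → y ≢ u → R [ x ~ y ] → P [ x ~ y ]
        bwd {x} {y} x≢u y≢u r with x Fin.≟ w | y Fin.≟ w | x Fin.≟ w' | y Fin.≟ w'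
        ... | no x≢w | no y≢w | _ | _ = agree⇐ (off m) x≢u y≢u
                (agree⇐ a (λ e → x≢w (Eq.trans e s≡w)) (λ e → y≢w (Eq.trans e s≡w)) r)
        ... | yes refl | yes refl | _ | _ = ~-refl
        ... | _ | _ | no x≢w' | no y≢w' = agree⇐ (off m') x≢u y≢u
                (agree⇐ a' (λ e → x≢w' (Eq.trans e s'≡w')) (λ e → y≢w' (Eq.trans e s'≡w')) r)
        ... | yes refl | no _ | _ | yes refl = ⊥-elim (¬R-ww' r)
        ... | yes refl | no _ | yes refl | no _ = ⊥-elim (w≢w' refl)
        ... | no _ | yes refl | yes refl | _ = ⊥-elim (¬R-ww' (~-sym r))
        ... | no _ | yes refl | no _ | yes refl = ⊥-elim (w≢w' refl)

    -- By `together-degree` three nonneighbours of `u` lie in different parts, so all labels are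
    -- moves of `u`. At most one of these is a departure, and the other two are joins.
    star-impossible : ∀ {x₁ y₁ x₂ y₂ x₃ y₃} → Mark Q₁ x₁ y₁ → SamePair x₁ y₁ u w₁ →
      Mark Q₂ x₂ y₂ → SamePair x₂ y₂ u w₂ → Mark Q₃ x₃ y₃ → SamePair x₃ y₃ u w₃ →
      Near Q₁ R → Near Q₂ R → Near Q₃ R → ⊥
    star-impossible k₁ e₁ k₂ e₂ k₃ e₃ n₁ n₂ n₃
      with m₁ , l₁ ← toMove h₁ h₂ h₃ w₁≢w₂ w₁≢w₃ w₂≢w₃ k₁ e₁
         | m₂ , l₂ ← toMove h₂ h₁ h₃ (≢-sym w₁≢w₂) w₂≢w₃ w₁≢w₃ k₂ e₂
         | m₃ , l₃ ← toMove h₃ h₁ h₂ (≢-sym w₁≢w₃) (≢-sym w₂≢w₃) w₁≢w₂ k₃ e₃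
      with how m₁ | how m₂ | how m₃
    ... | inj₁ (_ , j₁) | inj₁ (_ , j₂) | _ =
      two-joins m₁ l₁ m₂ l₂ m₃ l₃ w₁≢w₂ w₁≢w₃ w₂≢w₃ h₃ (ne h₁ h₂ h₃ w₁≢w₂ w₁≢w₃ w₂≢w₃) n₁ n₂ n₃ j₁ j₂
    ... | inj₁ (_ , j₁) | inj₂ _ | inj₁ (_ , j₃) =
      two-joins m₁ l₁ m₃ l₃ m₂ l₂ w₁≢w₃ w₁≢w₂ (≢-sym w₂≢w₃) h₂
        (ne h₁ h₃ h₂ w₁≢w₃ w₁≢w₂ (≢-sym w₂≢w₃)) n₁ n₃ n₂ j₁ j₃
    ... | inj₂ _ | inj₁ (_ , j₂) | inj₁ (_ , j₃) =
      two-joins m₂ l₂ m₃ l₃ m₁ l₁ w₂≢w₃ (≢-sym w₁≢w₂) (≢-sym w₁≢w₃) h₁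
        (ne h₂ h₃ h₁ w₂≢w₃ (≢-sym w₁≢w₂) (≢-sym w₁≢w₃)) n₂ n₃ n₁ j₂ j₃
    ... | inj₂ (p , _) | inj₂ (q , _) | _ = ne h₁ h₂ h₃ w₁≢w₂ w₁≢w₃ w₂≢w₃ (~-trans (~-sym p) q)
    ... | inj₂ (p , _) | inj₁ _ | inj₂ (q , _) =
      ne h₁ h₃ h₂ w₁≢w₃ w₁≢w₂ (≢-sym w₂≢w₃) (~-trans (~-sym p) q)
    ... | inj₁ _ | inj₂ (p , _) | inj₂ (q , _) =
      ne h₂ h₃ h₁ w₂≢w₃ (≢-sym w₁≢w₂) (≢-sym w₁≢w₃) (~-trans (~-sym p) q)

-- Edges of the complement and their triangles

record Edge {n : ℕ} (G : Graph n) : Set where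
  constructor edge
  field
    {source target} : Fin n
    joined : NonAdj {G = G} source target
open Edge public

module _ {n : ℕ} {G : Graph n} where

  infix 4 _∈ᵉ_ _≈ᵉ_

  _∈ᵉ_ : Fin n → Edge G → Set
  v ∈ᵉ e = v ≡ source e ⊎ v ≡ target e

  -- Edges have two distinct ends, so one inclusion already gives a symmetric relation.
  record _≈ᵉ_ (e f : Edge G) : Set where
    constructor ⊆⇒≈
    field ≈⇒⊆ : ∀ {v} → v ∈ᵉ e → v ∈ᵉ f
  open _≈ᵉ_ public

  Adjacent : Edge G → Edge G → Set
  Adjacent e f = (∃ λ v → v ∈ᵉ e × v ∈ᵉ f) × ¬ e ≈ᵉ f

  ∈ᵉ? : ∀ v e → Dec (v ∈ᵉ e)
  ∈ᵉ? v e = (v Fin.≟ source e) ⊎-dec (v Fin.≟ target e)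

  only-ends : ∀ {e v w z} → v ≢ w → v ∈ᵉ e → w ∈ᵉ e → z ∈ᵉ e → z ≡ v ⊎ z ≡ w
  only-ends ne (inj₁ refl) (inj₁ refl) _ = ⊥-elim (ne refl)
  only-ends ne (inj₁ refl) (inj₂ refl) z∈ = z∈
  only-ends ne (inj₂ refl) (inj₁ refl) z∈ = swap z∈
  only-ends ne (inj₂ refl) (inj₂ refl) _ = ⊥-elim (ne refl)

  same-ends : ∀ {e f v w} → v ≢ w → v ∈ᵉ e → w ∈ᵉ e → v ∈ᵉ f → w ∈ᵉ f → e ≈ᵉ f
  same-ends {e} {f} ne ve we vf wf = ⊆⇒≈ λ z∈ → [ (λ { refl → vf }) , (λ { refl → wf }) ]′ (only-ends {e} ne ve we z∈)

  ≈ᵉ-sym : ∀ {e f} → e ≈ᵉ f → f ≈ᵉ e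
  ≈ᵉ-sym {e} {f} s = same-ends {f} {e} (apart (joined e)) (≈⇒⊆ s (inj₁ refl)) (≈⇒⊆ s (inj₂ refl)) (inj₁ refl) (inj₂ refl)

  ≈ᵉ-trans : ∀ {e f g} → e ≈ᵉ f → f ≈ᵉ g → e ≈ᵉ g
  ≈ᵉ-trans s t = ⊆⇒≈ (≈⇒⊆ t ∘ ≈⇒⊆ s)

  samePair⇒≈ : ∀ {e f} → SamePair (source e) (target e) (source f) (target f) → e ≈ᵉ f
  samePair⇒≈ (inj₁ (refl , refl)) = ⊆⇒≈ id
  samePair⇒≈ (inj₂ (refl , refl)) = ⊆⇒≈ swap

  ends⇒samePair : ∀ {e v w} → v ≢ w → v ∈ᵉ e → w ∈ᵉ e → SamePair (source e) (target e) v w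
  ends⇒samePair ne (inj₁ refl) (inj₁ refl) = ⊥-elim (ne refl)
  ends⇒samePair ne (inj₁ refl) (inj₂ refl) = inj₁ (refl , refl)
  ends⇒samePair ne (inj₂ refl) (inj₁ refl) = inj₂ (refl , refl)
  ends⇒samePair ne (inj₂ refl) (inj₂ refl) = ⊥-elim (ne refl)

  ends-NonAdj : ∀ e {v w} → v ≢ w → v ∈ᵉ e → w ∈ᵉ e → NonAdj {G = G} v w
  ends-NonAdj e ne ve we with ends⇒samePair {e} ne ve we
  ... | inj₁ (refl , refl) = joined e
  ... | inj₂ (refl , refl) = NonAdj-sym (joined e)

  other-end : ∀ e {v} → v ∈ᵉ e → ∃ λ w → w ∈ᵉ e × w ≢ v
  other-end e (inj₁ refl) = target e , inj₂ refl , ≢-sym (apart (joined e))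
  other-end e (inj₂ refl) = source e , inj₁ refl , apart (joined e)

  adjacent-resp : ∀ {e e' f f'} → e ≈ᵉ e' → f ≈ᵉ f' → Adjacent e f → Adjacent e' f'
  adjacent-resp s t ((v , ve , vf) , ne) =
    (v , ≈⇒⊆ s ve , ≈⇒⊆ t vf) , λ r → ne (≈ᵉ-trans s (≈ᵉ-trans r (≈ᵉ-sym t)))

  record Triangle (e f g : Edge G) : Set where
    constructor triangle
    field
      {a b c} : Fin n
      a≢b : a ≢ b
      a≢c : a ≢ c
      b≢c : b ≢ c
      a∈e : a ∈ᵉ e
      b∈e : b ∈ᵉ e
      a∈f : a ∈ᵉ f
      c∈f : c ∈ᵉ f
      b∈g : b ∈ᵉ g
      c∈g : c ∈ᵉ g

  triangle-resp : ∀ {e e' f f' g g'} → e ≈ᵉ e' → f ≈ᵉ f' → g ≈ᵉ g' → Triangle e f g → Triangle e' f' g'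
  triangle-resp r s t (triangle p q u ae be af cf bg cg) =
    triangle p q u (≈⇒⊆ r ae) (≈⇒⊆ r be) (≈⇒⊆ s af) (≈⇒⊆ s cf) (≈⇒⊆ t bg) (≈⇒⊆ t cg)

  triangle-no-common : ∀ {e f g v} → Triangle e f g → v ∈ᵉ e → v ∈ᵉ f → ¬ v ∈ᵉ g
  triangle-no-common {e} {f} {g} (triangle p q u ae be af cf bg cg) ve vf vg
    with only-ends {e} p ae be ve | only-ends {f} q af cf vf | only-ends {g} u bg cg vg
  ... | inj₁ refl | _ | inj₁ e = p e
  ... | inj₁ refl | _ | inj₂ e = q e
  ... | inj₂ refl | inj₁ e | _ = p (Eq.sym e)
  ... | inj₂ refl | inj₂ e | _ = u e

  triangle-adjacent : ∀ {e f g} → Triangle e f g → Adjacent e f × Adjacent e g × Adjacent f g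
  triangle-adjacent t@(triangle p q u ae be af cf bg cg) =
    ((_ , ae , af) , λ s → triangle-no-common t be (≈⇒⊆ s be) bg) ,
    ((_ , be , bg) , λ s → triangle-no-common t ae af (≈⇒⊆ s ae)) ,
    ((_ , cf , cg) , λ s → triangle-no-common t ae af (≈⇒⊆ s af))

  -- If `v` is not on `g`, then `g` meets `e` and `f` in their other ends.
  triangle-or-common : ∀ {e f g v} → Adjacent e f → Adjacent e g → Adjacent f g →
    v ∈ᵉ e → v ∈ᵉ f → Triangle e f g ⊎ v ∈ᵉ g
  triangle-or-common {e} {f} {g} {v} (_ , ne) ((x , xe , xg) , _) ((y , yf , yg) , _) ve vf
    with ∈ᵉ? v g
  ... | yes vg = inj₂ vg
  ... | no vg = inj₁ (triangle v≢x v≢y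
      (λ { refl → ne (same-ends {e} {f} v≢x ve xe vf yf) }) ve xe vf yf xg yg)
    where
    v≢x : v ≢ x
    v≢x refl = vg xg
    v≢y : v ≢ y
    v≢y refl = vg yg

  edgeCode : Edge G → Fin (n ℕ.* n)
  edgeCode e = Fin.combine (source e) (target e)

  edgeCode-injective : ∀ {e f} → edgeCode e ≡ edgeCode f → e ≈ᵉ f
  edgeCode-injective {e} {f} eq =
    samePair⇒≈ (inj₁ (FinP.combine-injective (source e) (target e) (source f) (target f) eq))

-- The map on edges

module EdgeMap {n₁ n₂ : ℕ} {G₁ : Graph n₁} {G₂ : Graph n₂} {k₁ k₂ : ℕ} (k₁+2≤n₁ : k₁ + 2 ≤ n₁)
  (k₂+2≤n₂ : k₂ + 2 ≤ n₂) (φ : Bell≥ k₁ G₁ ≅ Bell≥ k₂ G₂) where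

  private
    module I = Image k₁+2≤n₁ φ
    module I' = Image k₂+2≤n₂ (≅-sym φ)

    abstract
      -- The encodings of paths in both directions are injective maps between
      -- finite sets, hence bijective.
      roundTrip : Path G₂ → Path G₂
      roundTrip d = I.pathMap (I'.pathMap d)

      realises : (d : Path G₁) (e : Path G₂) → I.pathMap d ≈ᵖ e →
        Code I.base (I.image (centre-start d)) (I.image (centre-end d)) (start e) (centre e) (end e)
      realises d e (same-path p q r) = transport p q r (I.pathMap-code d)
        where
        transport : ∀ {Q Q' w u w' v y v'} → w ≡ v → u ≡ y → w' ≡ v' →
          Code I.base Q Q' w u w' → Code I.base Q Q' v y v'
        transport refl refl refl c = c

      realised : (d : Path G₂) → ∃ λ Q → ∃ λ Q' → Code I.base Q Q' (start d) (centre d) (end d)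
      realised d =
        let j , eq = periodic {A = Path G₂} {_≈_ = _≈ᵖ_} pathCode pathCode-injective {f = roundTrip}
              (λ {x} {y} e → I'.pathMap-injective {x} {y} (I.pathMap-injective {I'.pathMap x} {I'.pathMap y} e)) d
            e = I'.pathMap (iterate roundTrip j d)
        in I.image (centre-start e) , I.image (centre-end e) , realises e d eq

      noGrowth : {Q : IPartition G₂} → k₂ ≤ numParts Q → NoGrowth I.base Q
      noGrowth = I.base-noGrowth

    module L = Local {k = k₂} I.base realised (λ {Q} → noGrowth {Q})

    image : Edge G₁ → IPartition G₂
    image e = I.image (joined e)

    same-ends⇒samePair : ∀ {n} {G : Graph n} {e f : Edge G} → e ≈ᵉ f →
      SamePair (source e) (target e) (source f) (target f)
    same-ends⇒samePair {e = e} {f} s =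
      ends⇒samePair {e = e} (apart (joined f)) (≈⇒⊆ (≈ᵉ-sym s) (inj₁ refl)) (≈⇒⊆ (≈ᵉ-sym s) (inj₂ refl))

    image-cong : ∀ {e f} → e ≈ᵉ f → image e ≋ image f
    image-cong {e} {f} s =
      I.to-≋ {I.pair₁ (joined e)} {I.pair₁ (joined f)} (pair-cong (same-ends⇒samePair s))

    image-injective : ∀ {e f} → image e ≋ image f → e ≈ᵉ f
    image-injective {e} {f} s =
      samePair⇒≈ (same-pair (I.to-injective {I.pair₁ (joined e)} {I.pair₁ (joined f)} s))

    marking : ∀ e → ∃ λ x → ∃ λ y → L.Mark (image e) x y
    marking e = L.mark-exists (I.image-bound (joined e)) (I.image-near (joined e)) (I.image-≉ (joined e))

  abstract
    edgeMap : Edge G₁ → Edge G₂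
    edgeMap e = let _ , _ , m = marking e in edge (L.mark⇒NonAdj m)

    private
      edgeMap-mark : ∀ e → L.Mark (image e) (source (edgeMap e)) (target (edgeMap e))
      edgeMap-mark e = let _ , _ , m = marking e in m

  edgeMap-injective : ∀ {e f} → edgeMap e ≈ᵉ edgeMap f → e ≈ᵉ f
  edgeMap-injective {e} {f} s =
    image-injective (L.mark-injective (edgeMap-mark e) (edgeMap-mark f) (same-ends⇒samePair s))

  edgeMap-cong : ∀ {e f} → e ≈ᵉ f → edgeMap e ≈ᵉ edgeMap f
  edgeMap-cong {e} {f} s = samePair⇒≈
    (L.mark-functional (L.mark-cong (image-cong s) (edgeMap-mark e)) (edgeMap-mark f))

  -- The images of `e` and `f` have a code, and by `code-marks` its centre is on both labels.
  edgeMap-adjacent : ∀ {e f} → Adjacent e f → Adjacent (edgeMap e) (edgeMap f)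
  edgeMap-adjacent {e} {f} ((v , v∈e , v∈f) , ne) = share , ne ∘ edgeMap-injective
    where
    near : Near (image e) (image f)
    near = I.image-near₂ (joined e) (joined f) v∈e v∈f (ne ∘ samePair⇒≈ ∘ same-pair)
    mark-∈ : ∀ {u x} g → L.Mark (image g) u x ⊎ L.Mark (image g) x u → u ∈ᵉ edgeMap g
    mark-∈ g (inj₁ m) with L.mark-functional m (edgeMap-mark g)
    ... | inj₁ (e , _) = inj₁ e
    ... | inj₂ (e , _) = inj₂ e
    mark-∈ g (inj₂ m) with L.mark-functional m (edgeMap-mark g)
    ... | inj₁ (_ , e) = inj₂ e
    ... | inj₂ (_ , e) = inj₁ e
    share : ∃ λ u → u ∈ᵉ edgeMap e × u ∈ᵉ edgeMap f
    share =
      let _ , u , _ , code = Encode.encode (I.image-≉ (joined e)) (I.image-≉ (joined f)) (ne ∘ image-injective)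
            (I.base-noGrowth (I.image-bound (joined e))) (I.base-noGrowth (I.image-bound (joined f)))
            (I.image-near (joined e)) (I.image-near (joined f)) near
          (_ , m) , (_ , m') = L.code-marks code
      in u , mark-∈ e m , mark-∈ f m'

  edgeMap-star-impossible : ∀ {e f g v w₁ w₂ w₃} → Triangle e f g → w₁ ≢ v → w₂ ≢ v → w₃ ≢ v →
    w₁ ≢ w₂ → w₁ ≢ w₃ → w₂ ≢ w₃ → v ∈ᵉ edgeMap e → v ∈ᵉ edgeMap f → v ∈ᵉ edgeMap g →
    w₁ ∈ᵉ edgeMap e → w₂ ∈ᵉ edgeMap f → w₃ ∈ᵉ edgeMap g → ⊥
  edgeMap-star-impossible {e} {f} {g} {v} {w₁} {w₂} {w₃}
    (triangle {a} {b} {c} a≢b a≢c b≢c ae be af cf bg cg)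
    w₁≢v w₂≢v w₃≢v w₁≢w₂ w₁≢w₃ w₂≢w₃ v∈e v∈f v∈g w₁∈ w₂∈ w₃∈ = contra (I.triangle-images ab ac bc)
    where
    ab : NonAdj a b
    ab = ends-NonAdj e a≢b ae be
    ac : NonAdj a c
    ac = ends-NonAdj f a≢c af cf
    bc : NonAdj b c
    bc = ends-NonAdj g b≢c bg cg
    h₁ : NonAdj v w₁
    h₁ = ends-NonAdj (edgeMap e) (≢-sym w₁≢v) v∈e w₁∈
    h₂ : NonAdj v w₂
    h₂ = ends-NonAdj (edgeMap f) (≢-sym w₂≢v) v∈f w₂∈
    h₃ : NonAdj v w₃
    h₃ = ends-NonAdj (edgeMap g) (≢-sym w₃≢v) v∈g w₃∈
    near-image : ∀ {x y} (h : NonAdj x y) {e'} {R} → x ∈ᵉ e' → y ∈ᵉ e' → Near (I.image h) R → Near (image e') R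
    near-image h {e'} {R} x∈ y∈ r = near-resp {P = I.image h} {P' = image e'} {Q = R} {Q' = R}
      (image-cong {edge h} {e'} (same-ends {e = edge h} {e'} (apart h) (inj₁ refl) (inj₂ refl) x∈ y∈)) ≋-refl r
    contra : (∃ λ R → Near (I.image ab) R × Near (I.image ac) R × Near (I.image bc) R × ¬ Near I.base R) → ⊥
    contra (R , r₁ , r₂ , r₃ , far) =
      L.Star.star-impossible {u = v} {w₁} {w₂} {w₃} {image e} {image f} {image g} {R}
        h₁ h₂ h₃ w₁≢w₂ w₁≢w₃ w₂≢w₃ far
        (edgeMap-mark e) (ends⇒samePair {e = edgeMap e} (≢-sym w₁≢v) v∈e w₁∈)
        (edgeMap-mark f) (ends⇒samePair {e = edgeMap f} (≢-sym w₂≢v) v∈f w₂∈)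
        (edgeMap-mark g) (ends⇒samePair {e = edgeMap g} (≢-sym w₃≢v) v∈g w₃∈)
        (near-image ab {e} ae be r₁) (near-image ac {f} af cf r₂) (near-image bc {g} bg cg r₃)

  -- The image edges are pairwise adjacent, so they form a triangle or a star; the image of
  -- `triple`, a common neighbour far from `I.base`, rules out the star.
  edgeMap-triangle : ∀ {e f g} → Triangle e f g → Triangle (edgeMap e) (edgeMap f) (edgeMap g)
  edgeMap-triangle {e} {f} {g} t =
    go (edgeMap-adjacent {e} {f} ef) (edgeMap-adjacent {e} {g} eg) (edgeMap-adjacent {f} {g} fg)
    where
    ef : Adjacent e f
    ef = proj₁ (triangle-adjacent t)
    eg : Adjacent e g
    eg = proj₁ (proj₂ (triangle-adjacent t))
    fg : Adjacent f g
    fg = proj₂ (proj₂ (triangle-adjacent t))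
    star : ∀ {v} → v ∈ᵉ edgeMap e → v ∈ᵉ edgeMap f → v ∈ᵉ edgeMap g →
      ¬ edgeMap e ≈ᵉ edgeMap f → ¬ edgeMap e ≈ᵉ edgeMap g → ¬ edgeMap f ≈ᵉ edgeMap g → ⊥
    star v∈e v∈f v∈g ef eg fg =
      let w₁ , w₁∈ , w₁≢v = other-end (edgeMap e) v∈e
          w₂ , w₂∈ , w₂≢v = other-end (edgeMap f) v∈f
          w₃ , w₃∈ , w₃≢v = other-end (edgeMap g) v∈g
      in edgeMap-star-impossible {e} {f} {g} t w₁≢v w₂≢v w₃≢v
           (λ w₁≡w₂ → ef (same-ends {e = edgeMap e} {edgeMap f} w₁≢v w₁∈ v∈e (subst (_∈ᵉ edgeMap f) (Eq.sym w₁≡w₂) w₂∈) v∈f))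
           (λ w₁≡w₃ → eg (same-ends {e = edgeMap e} {edgeMap g} w₁≢v w₁∈ v∈e (subst (_∈ᵉ edgeMap g) (Eq.sym w₁≡w₃) w₃∈) v∈g))
           (λ w₂≡w₃ → fg (same-ends {e = edgeMap f} {edgeMap g} w₂≢v w₂∈ v∈f (subst (_∈ᵉ edgeMap g) (Eq.sym w₂≡w₃) w₃∈) v∈g))
           v∈e v∈f v∈g w₁∈ w₂∈ w₃∈
    go : Adjacent (edgeMap e) (edgeMap f) → Adjacent (edgeMap e) (edgeMap g) → Adjacent (edgeMap f) (edgeMap g) →
      Triangle (edgeMap e) (edgeMap f) (edgeMap g)
    go Bef@((v , v∈e , v∈f) , ef) Beg@(_ , eg) Bfg@(_ , fg) =
      [ id , (λ v∈g → ⊥-elim (star v∈e v∈f v∈g ef eg fg)) ]′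
        (triangle-or-common {e = edgeMap e} {edgeMap f} {edgeMap g} Bef Beg Bfg v∈e v∈f)

-- From edges to vertices

module _ {A : Set} {_≈_ : A → A → Set} {N : ℕ} (code : A → Fin N)
  (code-injective : ∀ {x y} → code x ≡ code y → x ≈ y)
  {f : A → A} (f-injective : ∀ {x y} → f x ≈ f y → x ≈ y)
  (Pr : A → Set) (Pr-resp : ∀ {x y} → x ≈ y → Pr x → Pr y) (Pr-preserved : ∀ {x} → Pr x → Pr (f x)) where

  -- Up to `≈`, `x` is itself an iterate of `f x`, so the property travels forward from `f x` to
  -- `x`.
  reflected : ∀ {x} → Pr (f x) → Pr x
  reflected {x} p = let j , e = periodic {_≈_ = _≈_} code code-injective {f = f} f-injective x in Pr-resp e (iterated j)
    where
    iterated : ∀ j → Pr (iterate f (suc j) x)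
    iterated zero = p
    iterated (suc j) = Pr-preserved (iterated j)

module VertexMap {n₁ n₂ : ℕ} {G₁ : Graph n₁} {G₂ : Graph n₂} {k₁ k₂ : ℕ} (k₁+2≤n₁ : k₁ + 2 ≤ n₁)
  (k₂+2≤n₂ : k₂ + 2 ≤ n₂) (φ : Bell≥ k₁ G₁ ≅ Bell≥ k₂ G₂) where

  private
    module M = EdgeMap k₁+2≤n₁ k₂+2≤n₂ φ
    module M' = EdgeMap k₂+2≤n₂ k₁+2≤n₁ (≅-sym φ)

    θ : Edge G₁ → Edge G₂
    θ = M.edgeMap

    -- Triples let one finiteness argument serve both triangles and, by repeating an edge,
    -- adjacency.
    E³ : Set
    E³ = Edge G₁ × Edge G₁ × Edge G₁

    _≈³_ : E³ → E³ → Set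
    (e , f , g) ≈³ (e' , f' , g') = e ≈ᵉ e' × f ≈ᵉ f' × g ≈ᵉ g'

    code³ : E³ → Fin ((n₁ ℕ.* n₁) ℕ.* ((n₁ ℕ.* n₁) ℕ.* (n₁ ℕ.* n₁)))
    code³ (e , f , g) = Fin.combine (edgeCode e) (Fin.combine (edgeCode f) (edgeCode g))

    code³-injective : ∀ {x y} → code³ x ≡ code³ y → x ≈³ y
    code³-injective {e , f , g} {e' , f' , g'} eq =
      let p , q = FinP.combine-injective (edgeCode e) (Fin.combine (edgeCode f) (edgeCode g))
                    (edgeCode e') (Fin.combine (edgeCode f') (edgeCode g')) eq
          r , s = FinP.combine-injective (edgeCode f) (edgeCode g) (edgeCode f') (edgeCode g') q
      in edgeCode-injective {e = e} {e'} p , edgeCode-injective {e = f} {f'} r , edgeCode-injective {e = g} {g'} s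

    roundTrip : Edge G₁ → Edge G₁
    roundTrip e = M'.edgeMap (θ e)

    roundTrip-injective : ∀ {e f} → roundTrip e ≈ᵉ roundTrip f → e ≈ᵉ f
    roundTrip-injective {e} {f} s =
      M.edgeMap-injective {e} {f} (M'.edgeMap-injective {θ e} {θ f} s)

    roundTrip³ : E³ → E³
    roundTrip³ (e , f , g) = roundTrip e , roundTrip f , roundTrip g

    roundTrip³-injective : ∀ {x y} → roundTrip³ x ≈³ roundTrip³ y → x ≈³ y
    roundTrip³-injective {e , f , g} {e' , f' , g'} (p , q , r) =
      roundTrip-injective {e} {e'} p , roundTrip-injective {f} {f'} q , roundTrip-injective {g} {g'} r

  reflect-adjacent : ∀ {e f} → Adjacent (θ e) (θ f) → Adjacent e f
  reflect-adjacent {e} {f} A = reflected {_≈_ = _≈³_} code³ code³-injective {f = roundTrip³}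
    (λ {x} {y} → roundTrip³-injective {x} {y})
    (λ { (e , f , _) → Adjacent e f })
    (λ { (p , q , _) → adjacent-resp p q })
    (λ { {e , f , _} A → M'.edgeMap-adjacent {θ e} {θ f} (M.edgeMap-adjacent {e} {f} A) })
    {e , f , f} (M'.edgeMap-adjacent {θ e} {θ f} A)

  reflect-triangle : ∀ {e f g} → Triangle (θ e) (θ f) (θ g) → Triangle e f g
  reflect-triangle {e} {f} {g} t = reflected {_≈_ = _≈³_} code³ code³-injective {f = roundTrip³}
    (λ {x} {y} → roundTrip³-injective {x} {y})
    (λ { (e , f , g) → Triangle e f g })
    (λ { (p , q , r) → triangle-resp p q r })
    (λ { {e , f , g} t → M'.edgeMap-triangle {θ e} {θ f} {θ g} (M.edgeMap-triangle {e} {f} {g} t) })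
    {e , f , g} (M'.edgeMap-triangle {θ e} {θ f} {θ g} t)

  θ-surjective : ∀ e → ∃ λ e' → θ e' ≈ᵉ e
  θ-surjective e =
    let j , eq = periodic {_≈_ = _≈ᵉ_} edgeCode (λ {x} {y} → edgeCode-injective {e = x} {y})
          {f = λ x → θ (M'.edgeMap x)}
          (λ {x} {y} s → M'.edgeMap-injective {x} {y} (M.edgeMap-injective {M'.edgeMap x} {M'.edgeMap y} s)) e
    in M'.edgeMap (iterate (λ x → θ (M'.edgeMap x)) j e) , eq

  private
    _∥_ : Fin n₁ → Fin n₁ → Set
    _∥_ = NonAdj {G = G₁}

    θ-∈ : ∀ {a b c} (h : a ∥ b) (e : Edge G₁) → a ∈ᵉ e → b ∈ᵉ e → c ∈ᵉ θ (edge h) → c ∈ᵉ θ e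
    θ-∈ h e a∈ b∈ = ≈⇒⊆ (M.edgeMap-cong {edge h} {e}
      (same-ends {e = edge h} {e} (apart h) (inj₁ refl) (inj₂ refl) a∈ b∈))

    adjacent-at : ∀ {b x y} (h : b ∥ x) (g : b ∥ y) → x ≢ y → Adjacent (edge h) (edge g)
    adjacent-at h g x≢y = (_ , inj₁ refl , inj₁ refl) ,
      λ s → [ (λ e → apart h (Eq.sym e)) , x≢y ]′ (≈⇒⊆ s (inj₂ refl))

    -- The images of the edges at b all share a vertex: three of them cannot form
    -- a triangle, because θ reflects triangles.
    common-vertex : ∀ {b x y m} (h : b ∥ x) (g : b ∥ y) → x ≢ y → m ∈ᵉ θ (edge h) → m ∈ᵉ θ (edge g) →
      ∀ {z} (k : b ∥ z) → m ∈ᵉ θ (edge k)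
    common-vertex {b} {x} {y} h g x≢y m∈ m∈' {z} k with z Fin.≟ x | z Fin.≟ y
    ... | yes refl | _ = θ-∈ h (edge k) (inj₁ refl) (inj₂ refl) m∈
    ... | no _ | yes refl = θ-∈ g (edge k) (inj₁ refl) (inj₂ refl) m∈'
    ... | no z≢x | no z≢y =
      [ (λ t → ⊥-elim (triangle-no-common {e = edge h} {edge g} {edge k} {b}
          (reflect-triangle {edge h} {edge g} {edge k} t) (inj₁ refl) (inj₁ refl) (inj₁ refl))) , id ]′
        (triangle-or-common {e = θ (edge h)} {θ (edge g)} {θ (edge k)}
          (M.edgeMap-adjacent {edge h} {edge g} (adjacent-at h g x≢y))
          (M.edgeMap-adjacent {edge h} {edge k} (adjacent-at h k (≢-sym z≢x)))
          (M.edgeMap-adjacent {edge g} {edge k} (adjacent-at g k (≢-sym z≢y))) m∈ m∈')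

    Second : Fin n₁ → Fin n₁ → Set
    Second a b = ∃ λ x → a ∥ x × x ≢ b

    Second? : ∀ a b → Dec (Second a b)
    Second? a b = FinP.any? λ x → NonAdj? a x ×-dec ¬? (x Fin.≟ b)

    -- An edge that is a component of its own is mapped so as to preserve the order
    -- of its ends.
    record Corresponds (a : Fin n₁) (c : Fin n₂) : Set where
      field
        at-all  : ∀ {b} (h : a ∥ b) → c ∈ᵉ θ (edge h)
        at-leaf : ∀ {b} → a ∥ b → ¬ Second a b → ∀ {y} (g : b ∥ y) → y ≢ a → ¬ c ∈ᵉ θ (edge g)
        at-pair : ∀ {b} (h : a ∥ b) → ¬ Second a b → ¬ Second b a →
          (toℕ a ℕ.< toℕ b → ∀ {z} → z ∈ᵉ θ (edge h) → toℕ c ≤ toℕ z) ×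
          (toℕ b ℕ.< toℕ a → ∀ {z} → z ∈ᵉ θ (edge h) → toℕ z ≤ toℕ c)
    open Corresponds

    min-end : ∀ {n} {G : Graph n} (e : Edge G) → ∃ λ c → c ∈ᵉ e × (∀ {z} → z ∈ᵉ e → toℕ c ≤ toℕ z)
    min-end e with ℕP.≤-total (toℕ (source e)) (toℕ (target e))
    ... | inj₁ le = source e , inj₁ refl , λ { (inj₁ refl) → ℕP.≤-refl ; (inj₂ refl) → le }
    ... | inj₂ ge = target e , inj₂ refl , λ { (inj₁ refl) → ge ; (inj₂ refl) → ℕP.≤-refl }

    max-end : ∀ {n} {G : Graph n} (e : Edge G) → ∃ λ c → c ∈ᵉ e × (∀ {z} → z ∈ᵉ e → toℕ z ≤ toℕ c)
    max-end e with ℕP.≤-total (toℕ (source e)) (toℕ (target e))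
    ... | inj₁ le = target e , inj₂ refl , λ { (inj₁ refl) → le ; (inj₂ refl) → ℕP.≤-refl }
    ... | inj₂ ge = source e , inj₁ refl , λ { (inj₁ refl) → ℕP.≤-refl ; (inj₂ refl) → ge }

    unique-neighbour : ∀ {a b} → ¬ Second a b → ∀ {y} → a ∥ y → y ≡ b
    unique-neighbour {a} {b} ns {y} h with y Fin.≟ b
    ... | yes e = e
    ... | no y≢b = ⊥-elim (ns (y , h , y≢b))

    corresponds-branch : ∀ {a b x} → a ∥ b → a ∥ x → x ≢ b → ∃ (Corresponds a)
    corresponds-branch {a} {b} {x} h g x≢b =
      let (c , c∈ , c∈') , _ = M.edgeMap-adjacent {edge h} {edge g} (adjacent-at h g (≢-sym x≢b))
      in c , record
        { at-all = common-vertex h g (≢-sym x≢b) c∈ c∈'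
        ; at-leaf = λ h' ns → ⊥-elim (two ns)
        ; at-pair = λ h' ns → ⊥-elim (two ns) }
      where
      two : ∀ {b'} → ¬ Second a b' → ⊥
      two ns = x≢b (Eq.trans (unique-neighbour ns g) (Eq.sym (unique-neighbour ns h)))

    -- The images of the edges at `b` share `m`, so `a` receives the other end of its image edge. If
    -- another of these images contained that end, it would have both ends in common with the first,
    -- against injectivity.
    corresponds-leaf : ∀ {a b y} → a ∥ b → ¬ Second a b → b ∥ y → y ≢ a → ∃ (Corresponds a)
    corresponds-leaf {a} {b} {y} h ns g y≢a =
      let (m , m∈ , m∈') , _ = M.edgeMap-adjacent {edge (NonAdj-sym h)} {edge g} (adjacent-at (NonAdj-sym h) g (≢-sym y≢a))
          c , c∈ , c≢m = other-end (θ (edge (NonAdj-sym h))) m∈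
      in c , record
        { at-all = λ {b'} h' → θ-∈ (NonAdj-sym h) (edge h') (inj₂ (Eq.sym (unique-neighbour ns h'))) (inj₁ refl) c∈
        ; at-leaf = λ {b'} h' _ {y'} g' y'≢a c∈g → leaf m∈ m∈' c∈ c≢m
            (subst (_∥ y') (unique-neighbour ns h') g') y'≢a
            (θ-∈ g' (edge (subst (_∥ y') (unique-neighbour ns h') g'))
              (inj₁ (unique-neighbour ns h')) (inj₂ refl) c∈g)
        ; at-pair = λ {b'} h' _ ns' → ⊥-elim (ns' (y , subst (_∥ y) (Eq.sym (unique-neighbour ns h')) g , y≢a)) }
      where
      leaf : ∀ {m c} → m ∈ᵉ θ (edge (NonAdj-sym h)) → m ∈ᵉ θ (edge g) → c ∈ᵉ θ (edge (NonAdj-sym h)) → c ≢ m →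
        ∀ {y'} (g' : b ∥ y') → y' ≢ a → ¬ c ∈ᵉ θ (edge g')
      leaf m∈ m∈' c∈ c≢m g' y'≢a c∈g =
        proj₂ (adjacent-at (NonAdj-sym h) g' (≢-sym y'≢a))
          (M.edgeMap-injective {edge (NonAdj-sym h)} {edge g'}
            (same-ends {e = θ (edge (NonAdj-sym h))} {θ (edge g')} c≢m c∈ m∈ c∈g
              (common-vertex (NonAdj-sym h) g (≢-sym y≢a) m∈ m∈' g')))

    corresponds-pair : ∀ {a b} → a ∥ b → ¬ Second a b → ¬ Second b a → ∃ (Corresponds a)
    corresponds-pair {a} {b} h ns ns' = go (ℕP.<-cmp (toℕ a) (toℕ b))
      where
      leaf : ∀ {c b'} → a ∥ b' → ¬ Second a b' → ∀ {y} (g : b' ∥ y) → y ≢ a → ¬ c ∈ᵉ θ (edge g)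
      leaf h' _ {y} g y≢a _ = ns' (y , subst (_∥ y) (unique-neighbour ns h') g , y≢a)
      all : ∀ {c b'} → c ∈ᵉ θ (edge h) → (h' : a ∥ b') → c ∈ᵉ θ (edge h')
      all c∈ h' = θ-∈ h (edge h') (inj₁ refl) (inj₂ (Eq.sym (unique-neighbour ns h'))) c∈
      back : ∀ {c b'} (h' : a ∥ b') → c ∈ᵉ θ (edge h') → c ∈ᵉ θ (edge h)
      back h' = θ-∈ h' (edge h) (inj₁ refl) (inj₂ (unique-neighbour ns h'))
      go : Tri (toℕ a ℕ.< toℕ b) (toℕ a ≡ toℕ b) (toℕ b ℕ.< toℕ a) → ∃ (Corresponds a)
      go (tri≈ _ e _) = ⊥-elim (apart h (FinP.toℕ-injective e))
      go (tri< lt _ ≯) =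
        let c , c∈ , le = min-end (θ (edge h)) in c , record
        { at-all = all c∈ ; at-leaf = leaf
        ; at-pair = λ h' _ _ → (λ _ z∈ → le (back h' z∈)) ,
            λ gt → ⊥-elim (≯ (subst (λ v → toℕ v ℕ.< toℕ a) (unique-neighbour ns h') gt)) }
      go (tri> ≮ _ gt) =
        let c , c∈ , ge = max-end (θ (edge h)) in c , record
        { at-all = all c∈ ; at-leaf = leaf
        ; at-pair = λ h' _ _ →
            (λ lt → ⊥-elim (≮ (subst (λ v → toℕ a ℕ.< toℕ v) (unique-neighbour ns h') lt))) ,
            λ _ z∈ → ge (back h' z∈) }

    corresponds-exists : ∀ {a b} → a ∥ b → ∃ (Corresponds a)
    corresponds-exists {a} {b} h = go (Second? a b) (Second? b a)
      where
      go : Dec (Second a b) → Dec (Second b a) → ∃ (Corresponds a)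
      go (yes (x , g , x≢b)) _ = corresponds-branch h g x≢b
      go (no ns) (yes (y , g , y≢a)) = corresponds-leaf h ns g y≢a
      go (no ns) (no ns') = corresponds-pair h ns ns'

    -- With `at-all` this makes the vertices chosen for `a` and `b` the two ends of the image edge.
    corresponds-≢ : ∀ {a b c d} → a ∥ b → Corresponds a c → Corresponds b d → c ≢ d
    corresponds-≢ {a} {b} {c} h ca cb refl = go (Second? a b) (Second? b a)
      where
      h⁻ = NonAdj-sym h
      order : toℕ a ℕ.< toℕ b ⊎ toℕ b ℕ.< toℕ a
      order with ℕP.<-cmp (toℕ a) (toℕ b)
      ... | tri< lt _ _ = inj₁ lt
      ... | tri≈ _ e _ = ⊥-elim (apart h (FinP.toℕ-injective e))
      ... | tri> _ _ gt = inj₂ gt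
      equal-ends : (∀ {z} → z ∈ᵉ θ (edge h) → toℕ c ≤ toℕ z) → (∀ {z} → z ∈ᵉ θ (edge h) → toℕ z ≤ toℕ c) → ⊥
      equal-ends le ge = apart (joined (θ (edge h))) (FinP.toℕ-injective
        (Eq.trans (ℕP.≤-antisym (ge (inj₁ refl)) (le (inj₁ refl))) (ℕP.≤-antisym (le (inj₂ refl)) (ge (inj₂ refl)))))
      turn : ∀ {z} → z ∈ᵉ θ (edge h) → z ∈ᵉ θ (edge h⁻)
      turn = θ-∈ h (edge h⁻) (inj₂ refl) (inj₁ refl)
      go : Dec (Second a b) → Dec (Second b a) → ⊥
      go (no ns) (yes (y , g , y≢a)) = at-leaf ca h ns g y≢a (at-all cb g)
      go (yes (x , g , x≢b)) (no ns) = at-leaf cb h⁻ ns g x≢b (at-all ca g)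
      go (no ns) (no ns') = pair-case order
        where
        pair-case : toℕ a ℕ.< toℕ b ⊎ toℕ b ℕ.< toℕ a → ⊥
        pair-case (inj₁ lt) = equal-ends (λ z∈ → proj₁ (at-pair ca h ns ns') lt z∈)
          (λ z∈ → proj₂ (at-pair cb h⁻ ns' ns) lt (turn z∈))
        pair-case (inj₂ gt) = equal-ends (λ z∈ → proj₁ (at-pair cb h⁻ ns' ns) gt (turn z∈))
          (λ z∈ → proj₂ (at-pair ca h ns ns') gt z∈)
      -- Edges a x, b y at either end have images meeting in c, so x = y and the
      -- triangle a b x would have a star as image.
      go (yes (x , g , x≢b)) (yes (y , g' , y≢a)) = meet
        (reflect-adjacent {edge g} {edge g'} ((c , at-all ca g , at-all cb g') , λ s →
          distinct (M.edgeMap-injective {edge g} {edge g'} s)))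
        where
        distinct : ¬ edge g ≈ᵉ edge g'
        distinct s = [ apart h , (λ e → y≢a (Eq.sym e)) ]′ (≈⇒⊆ s (inj₁ refl))
        tri : x ≡ y → ⊥
        tri refl = triangle-no-common {e = θ (edge h)} {θ (edge g)} {θ (edge g')}
          (M.edgeMap-triangle {edge h} {edge g} {edge g'}
            (triangle (apart h) (apart g) (≢-sym x≢b) (inj₁ refl) (inj₂ refl) (inj₁ refl) (inj₂ refl) (inj₁ refl) (inj₂ refl)))
          (at-all ca h) (at-all ca g) (at-all cb g')
        meet : Adjacent (edge g) (edge g') → ⊥
        meet ((_ , inj₁ refl , inj₁ e) , _) = apart h e
        meet ((_ , inj₁ refl , inj₂ e) , _) = y≢a (Eq.sym e)
        meet ((_ , inj₂ refl , inj₁ e) , _) = x≢b e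
        meet ((_ , inj₂ refl , inj₂ e) , _) = tri e

    -- Two image edges through `c` come from edges that meet. If they meet in a common neighbour of
    -- `a` and `a'`, both images contain `c` and the vertex chosen for that neighbour, so the edges
    -- coincide.
    corresponds-injective : ∀ {a a' b b' c} → a ∥ b → a' ∥ b' → Corresponds a c → Corresponds a' c → a ≡ a'
    corresponds-injective {a} {a'} {b} {b'} {c} h h' ca ca' with a Fin.≟ a'
    ... | yes e = e
    ... | no a≢a' = ⊥-elim (meet (reflect-adjacent {edge h} {edge h'}
            ((c , at-all ca h , at-all ca' h') , λ s → distinct (M.edgeMap-injective {edge h} {edge h'} s))))
      where
      ¬a∥a' : ¬ a ∥ a'
      ¬a∥a' g = corresponds-≢ g ca ca' refl
      distinct : ¬ edge h ≈ᵉ edge h'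
      distinct s with ≈⇒⊆ s (inj₁ refl)
      ... | inj₁ e = a≢a' e
      ... | inj₂ refl = ¬a∥a' (NonAdj-sym h')
      meet : Adjacent (edge h) (edge h') → ⊥
      meet ((_ , inj₁ refl , inj₁ e) , _) = a≢a' e
      meet ((_ , inj₁ refl , inj₂ refl) , _) = ¬a∥a' (NonAdj-sym h')
      meet ((_ , inj₂ refl , inj₁ refl) , _) = ¬a∥a' h
      meet ((_ , inj₂ refl , inj₂ refl) , _) =
        let d , cd = corresponds-exists (NonAdj-sym h)
        in distinct (M.edgeMap-injective {edge h} {edge h'} (same-ends {e = θ (edge h)} {θ (edge h')}
             (corresponds-≢ h ca cd) (at-all ca h)
             (θ-∈ (NonAdj-sym h) (edge h) (inj₂ refl) (inj₁ refl) (at-all cd (NonAdj-sym h)))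
             (at-all ca' h')
             (θ-∈ (NonAdj-sym h') (edge h') (inj₂ refl) (inj₁ refl) (at-all cd (NonAdj-sym h')))))

    neighbour? : ∀ a → Dec (∃ λ b → a ∥ b)
    neighbour? a = FinP.any? (NonAdj? a)

    -- The neighbour comes from the decision and not from the given proof, which makes the chosen
    -- vertex independent of the proof.
    vertex-aux : ∀ {a} → Dec (∃ λ b → a ∥ b) → (∃ λ b → a ∥ b) → ∃ (Corresponds a)
    vertex-aux (yes (_ , h)) _ = corresponds-exists h
    vertex-aux (no none) p = ⊥-elim (none p)

    vertex : ∀ a → (∃ λ b → a ∥ b) → ∃ (Corresponds a)
    vertex a = vertex-aux (neighbour? a)

  abstract
    vertexMap : ∀ a → (∃ λ b → a ∥ b) → Fin n₂
    vertexMap a p = proj₁ (vertex a p)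

    private
      vertexMap-corresponds : ∀ a p → Corresponds a (vertexMap a p)
      vertexMap-corresponds a p = proj₂ (vertex a p)

    vertexMap-irrelevant : ∀ a p q → vertexMap a p ≡ vertexMap a q
    vertexMap-irrelevant a p q = go (neighbour? a)
      where
      go : (d : Dec (∃ λ b → a ∥ b)) → proj₁ (vertex-aux d p) ≡ proj₁ (vertex-aux d q)
      go (yes _) = refl
      go (no none) = ⊥-elim (none p)

  vertexMap-injective : ∀ {a a'} p q → vertexMap a p ≡ vertexMap a' q → a ≡ a'
  vertexMap-injective {a} {a'} p q e = corresponds-injective (proj₂ p) (proj₂ q)
    (vertexMap-corresponds a p) (subst (Corresponds a') (Eq.sym e) (vertexMap-corresponds a' q))

  vertexMap-NonAdj : ∀ {a b} p q → a ∥ b → NonAdj {G = G₂} (vertexMap a p) (vertexMap b q)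
  vertexMap-NonAdj {a} {b} p q h = ends-NonAdj (θ (edge h))
    (corresponds-≢ h (vertexMap-corresponds a p) (vertexMap-corresponds b q))
    (at-all (vertexMap-corresponds a p) h)
    (θ-∈ (NonAdj-sym h) (edge h) (inj₂ refl) (inj₁ refl) (at-all (vertexMap-corresponds b q) (NonAdj-sym h)))

  vertexMap-covers : ∀ {c d} → NonAdj {G = G₂} c d →
    ∃ λ a → ∃ λ b → Σ (a ∥ b) λ h → vertexMap a (b , h) ≡ c × vertexMap b (a , NonAdj-sym h) ≡ d
  vertexMap-covers {c} {d} g = go (θ-surjective (edge g))
    where
    go : (∃ λ e → θ e ≈ᵉ edge g) →
      ∃ λ a → ∃ λ b → Σ (a ∥ b) λ h → vertexMap a (b , h) ≡ c × vertexMap b (a , NonAdj-sym h) ≡ d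
    go (edge {a} {b} h , s) = pick (ends⇒samePair {e = edge g}
        (corresponds-≢ h (vertexMap-corresponds a (b , h)) (vertexMap-corresponds b (a , NonAdj-sym h)))
        (≈⇒⊆ s (at-all (vertexMap-corresponds a (b , h)) h))
        (≈⇒⊆ s (θ-∈ (NonAdj-sym h) (edge h) (inj₂ refl) (inj₁ refl)
          (at-all (vertexMap-corresponds b (a , NonAdj-sym h)) (NonAdj-sym h)))))
      where
      pick : SamePair c d (vertexMap a (b , h)) (vertexMap b (a , NonAdj-sym h)) → _
      pick (inj₁ (p , q)) = a , b , h , Eq.sym p , Eq.sym q
      pick (inj₂ (p , q)) = b , a , NonAdj-sym h , Eq.sym p ,
        Eq.trans (vertexMap-irrelevant a _ _) (Eq.sym q)

  vertexMap-reflects : ∀ {a b} p q → NonAdj {G = G₂} (vertexMap a p) (vertexMap b q) → a ∥ b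
  vertexMap-reflects {a} {b} p q g =
    let x , y , h , e , f = vertexMap-covers g
    in Eq.subst₂ _∥_ (vertexMap-injective _ _ e) (vertexMap-injective _ _ f) h

-- Universal vertices and the isomorphism of the reduced graphs

module _ {n : ℕ} (G : Graph n) where

  degree≡count : ∀ v → degree G v ≡ count (λ u → adj G u v)
  degree≡count v = countB-allFin (λ u → adj G u v)

module _ {n : ℕ} {G : Graph n} where

  Universal? : ∀ v → Dec (Universal G v)
  Universal? v = degree G v ℕ.≟ n ∸ 1

-- The neighbours of `a` together with `b` inject into the `m` vertices other than `a`, so the
-- degree is less than `m`.
NonAdj⇒¬Universal : ∀ {n} {G : Graph n} {a b} → NonAdj {G = G} a b → ¬ Universal G a
NonAdj⇒¬Universal {suc m} {G} {a} {b} h u =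
  ℕP.1+n≰n (subst (λ d → suc d ≤ m) (Eq.trans (Eq.sym (degree≡count G a)) u) (FinP.injective⇒≤ {f = f} f-injective))
  where
  p : Fin (suc m) → Bool
  p u = adj G u a
  neighbour : (i : Fin (count p)) → a ≢ unrank p i
  neighbour i e with () ← Eq.trans (Eq.sym (unrank-holds p i)) (subst (λ x → adj G x a ≡ false) e (irrefl G a))
  f : Fin (suc (count p)) → Fin m
  f zero = Fin.punchOut (apart h)
  f (suc i) = Fin.punchOut (neighbour i)
  not-b : ∀ i → unrank p i ≢ b
  not-b i e with () ← Eq.trans (Eq.sym (unrank-holds p i))
    (subst (λ x → adj G x a ≡ false) (Eq.sym e) (no-adj (NonAdj-sym h)))
  f-injective : ∀ {i j} → f i ≡ f j → i ≡ j
  f-injective {zero} {zero} _ = refl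
  f-injective {zero} {suc j} e = ⊥-elim (not-b j (Eq.sym (FinP.punchOut-injective (apart h) (neighbour j) e)))
  f-injective {suc i} {zero} e = ⊥-elim (not-b i (FinP.punchOut-injective (neighbour i) (apart h) e))
  f-injective {suc i} {suc j} e = cong suc (unrank-injective p (FinP.punchOut-injective (neighbour i) (neighbour j) e))

¬Universal⇒NonAdj : ∀ {n} {G : Graph n} {a} → ¬ Universal G a → ∃ λ b → NonAdj {G = G} a b
¬Universal⇒NonAdj {suc m} {G} {a} nu with FinP.any? (NonAdj? {G = G} a)
... | yes p = p
... | no none = ⊥-elim (nu (Eq.trans (degree≡count G a) (ℕP.≤-antisym
        (FinP.injective⇒≤ {f = λ i → Fin.punchOut (neighbour i)}
          (λ {i} {j} e → unrank-injective p (FinP.punchOut-injective (neighbour i) (neighbour j) e)))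
        (FinP.injective⇒≤ {f = λ j → proj₁ (unrank-surjective p (all-adj j))} ranks-injective))))
  where
  p : Fin (suc m) → Bool
  p u = adj G u a
  neighbour : (i : Fin (count p)) → a ≢ unrank p i
  neighbour i e with () ← Eq.trans (Eq.sym (unrank-holds p i)) (subst (λ x → adj G x a ≡ false) e (irrefl G a))
  all-adj : ∀ j → p (Fin.punchIn a j) ≡ true
  all-adj j with p (Fin.punchIn a j) in eq
  ... | true = refl
  ... | false = ⊥-elim (none (Fin.punchIn a j , NonAdj-sym (nonAdj (FinP.punchInᵢ≢i a j) eq)))
  ranks-injective : ∀ {i j} → proj₁ (unrank-surjective p (all-adj i)) ≡ proj₁ (unrank-surjective p (all-adj j)) → i ≡ j
  ranks-injective {i} {j} e = FinP.punchIn-injective a i j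
    (Eq.trans (Eq.sym (proj₂ (unrank-surjective p (all-adj i))))
      (Eq.trans (cong (unrank p) e) (proj₂ (unrank-surjective p (all-adj j)))))

module _ {n₁ n₂ : ℕ} {G₁ : Graph n₁} {G₂ : Graph n₂} {k₁ k₂ : ℕ} (k₁+2≤n₁ : k₁ + 2 ≤ n₁)
  (k₂+2≤n₂ : k₂ + 2 ≤ n₂) (φ : Bell≥ k₁ G₁ ≅ Bell≥ k₂ G₂) where

  private
    open VertexMap k₁+2≤n₁ k₂+2≤n₂ φ

    V₁ = Σ (Fin n₁) λ v → ¬ Universal G₁ v
    V₂ = Σ (Fin n₂) λ v → ¬ Universal G₂ v

    to : V₁ → V₂
    to (a , nu) = let p = ¬Universal⇒NonAdj nu in vertexMap a p ,
      NonAdj⇒¬Universal (vertexMap-NonAdj p (a , NonAdj-sym (proj₂ p)) (proj₂ p))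

    to-cong : ∀ {x y} → proj₁ x ≡ proj₁ y → proj₁ (to x) ≡ proj₁ (to y)
    to-cong {a , _} refl = vertexMap-irrelevant a _ _

    to-injective : ∀ {x y} → proj₁ (to x) ≡ proj₁ (to y) → proj₁ x ≡ proj₁ y
    to-injective = vertexMap-injective _ _

    from : V₂ → V₁
    from (c , nu) = let _ , g = ¬Universal⇒NonAdj nu ; a , _ , h , _ = vertexMap-covers g in
      a , NonAdj⇒¬Universal h

    to-from : ∀ y → proj₁ (to (from y)) ≡ proj₁ y
    to-from (c , nu) = let _ , g = ¬Universal⇒NonAdj nu ; a , _ , _ , e , _ = vertexMap-covers g in
      Eq.trans (vertexMap-irrelevant a _ _) e

    adjacent-or-NonAdj : ∀ {n} {G : Graph n} {x y} → x ≢ y → adj G x y ≡ true ⊎ NonAdj {G = G} x y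
    adjacent-or-NonAdj {G = G} {x} {y} ne with adj G x y in eq
    ... | true = inj₁ refl
    ... | false = inj₂ (nonAdj ne eq)

    adjacent-apart : ∀ {n} {G : Graph n} {x y} → adj G x y ≡ true → x ≢ y
    adjacent-apart {G = G} {x} e refl with () ← Eq.trans (Eq.sym e) (irrefl G x)

    adjacent-not-NonAdj : ∀ {n} {G : Graph n} {x y} → adj G x y ≡ true → ¬ NonAdj {G = G} x y
    adjacent-not-NonAdj e h with () ← Eq.trans (Eq.sym e) (no-adj h)

  deleteUniversal-iso : deleteUniversal G₁ ≅ deleteUniversal G₂
  deleteUniversal-iso = record
    { to = to
    ; from = from
    ; to-cong = λ {x} {y} → to-cong {x} {y}
    ; from-cong = λ {x} {y} e → to-injective {from x} {from y} (Eq.trans (to-from x) (Eq.trans e (Eq.sym (to-from y))))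
    ; to-from = to-from
    ; from-to = λ x → to-injective {from (to x)} {x} (to-from (to x))
    ; E-to = λ x y e → [ id , (λ g → ⊥-elim (adjacent-not-NonAdj e (vertexMap-reflects _ _ g))) ]′
        (adjacent-or-NonAdj (λ eq → adjacent-apart {G = G₁} e (to-injective {x} {y} eq)))
    ; E-from = λ x y e → [ id , (λ g → ⊥-elim (adjacent-not-NonAdj {G = G₂} e (vertexMap-NonAdj _ _ g))) ]′
        (adjacent-or-NonAdj {G = G₁} (λ eq → adjacent-apart {G = G₂} e (to-cong {x} {y} eq))) }

-- Transferring partitions

module Transfer {n₁ n₂ : ℕ} {G₁ : Graph n₁} {G₂ : Graph n₂} (ψ : deleteUniversal G₁ ≅ deleteUniversal G₂) where

  private
    module ψ = _≅_ ψ

    preimage : ∀ {y} → Dec (Universal G₂ y) → Maybe (Fin n₁)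
    preimage (yes _) = nothing
    preimage {y} (no nu) = just (proj₁ (ψ.from (y , nu)))

    pre : Fin n₂ → Maybe (Fin n₁)
    pre y = preimage (Universal? {G = G₂} y)

    pre-just : ∀ {y} (nu : ¬ Universal G₂ y) → pre y ≡ just (proj₁ (ψ.from (y , nu)))
    pre-just {y} nu with Universal? {G = G₂} y
    ... | yes u = ⊥-elim (nu u)
    ... | no nu' = cong just (ψ.from-cong refl)

    pre-inv : ∀ {y a} → pre y ≡ just a → Σ (¬ Universal G₂ y) λ nu → proj₁ (ψ.from (y , nu)) ≡ a
    pre-inv {y} e with Universal? {G = G₂} y
    pre-inv {y} refl | no nu = nu , refl

    data Linked (P : IPartition G₁) : Maybe (Fin n₁) → Maybe (Fin n₁) → Set where
      link : ∀ {a b} → P [ a ~ b ] → Linked P (just a) (just b)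

    linked? : ∀ P a b → Dec (Linked P a b)
    linked? P (just a) (just b) = map′ link (λ { (link p) → p }) (~? P a b)
    linked? P (just a) nothing = no λ ()
    linked? P nothing b = no λ ()

    linked-sym : ∀ {P a b} → Linked P a b → Linked P b a
    linked-sym (link p) = link (~-sym p)

    linked-trans : ∀ {P a b c} → Linked P a b → Linked P b c → Linked P a c
    linked-trans (link p) (link q) = link (~-trans p q)

    adj-to : ∀ {x y} (nx : ¬ Universal G₂ x) (ny : ¬ Universal G₂ y) → adj G₂ x y ≡ true →
      adj G₁ (proj₁ (ψ.from (x , nx))) (proj₁ (ψ.from (y , ny))) ≡ true
    adj-to nx ny e = ψ.E-from _ _
      (Eq.subst₂ (λ a b → adj G₂ a b ≡ true) (Eq.sym (ψ.to-from (_ , nx))) (Eq.sym (ψ.to-from (_ , ny))) e)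

    linked-indep : ∀ {P x y} → Linked P (pre x) (pre y) → x ≢ y → NonAdj {G = G₂} x y
    linked-indep {P} {x} {y} l ne with pre x in ex | pre y in ey
    linked-indep {P} {x} {y} (link p) ne | just a | just b
      with nx , refl ← pre-inv {x} ex | ny , refl ← pre-inv {y} ey
      with adj G₂ x y in eq
    ... | false = nonAdj ne eq
    ... | true with () ← Eq.trans (Eq.sym (adj-to nx ny eq)) (indep P _ _ (same≡ p))

    -- At universal vertices `pre` is `nothing`, which is linked to nothing, so these become
    -- singletons.
    transferRel : IPartition G₁ → PartRel {G = G₂}
    transferRel P = record
      { _R_ = λ x y → x ≡ y ⊎ Linked P (pre x) (pre y)
      ; _R?_ = λ x y → (x Fin.≟ y) ⊎-dec linked? P (pre x) (pre y)
      ; equiv = record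
          { refl = inj₁ refl
          ; sym = λ { (inj₁ e) → inj₁ (Eq.sym e) ; (inj₂ l) → inj₂ (linked-sym l) }
          ; trans = λ { (inj₁ refl) r → r ; r (inj₁ refl) → r ; (inj₂ l) (inj₂ l') → inj₂ (linked-trans l l') } }
      ; R-ind = λ { (inj₁ e) ne → ⊥-elim (ne e) ; (inj₂ l) ne → linked-indep l ne } }

  abstract
    transfer : IPartition G₁ → IPartition G₂
    transfer P = fromRel (transferRel P)

    transfer⇒ : ∀ {P x y} (nx : ¬ Universal G₂ x) (ny : ¬ Universal G₂ y) → transfer P [ x ~ y ] →
      P [ proj₁ (ψ.from (x , nx)) ~ proj₁ (ψ.from (y , ny)) ]
    transfer⇒ {P} {x} {y} nx ny t with ~⇒rel (transferRel P) t
    ... | inj₁ refl = ≡⇒~ (ψ.from-cong refl)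
    ... | inj₂ l with Eq.subst₂ (Linked P) (pre-just {x} nx) (pre-just {y} ny) l
    ... | link p = p

    transfer⇐ : ∀ {P x y} (nx : ¬ Universal G₂ x) (ny : ¬ Universal G₂ y) →
      P [ proj₁ (ψ.from (x , nx)) ~ proj₁ (ψ.from (y , ny)) ] → transfer P [ x ~ y ]
    transfer⇐ {P} {x} {y} nx ny p = rel⇒~ (transferRel P)
      (inj₂ (Eq.subst₂ (Linked P) (Eq.sym (pre-just {x} nx)) (Eq.sym (pre-just {y} ny)) (link p)))

module _ {n : ℕ} {G : Graph n} where

  ~⇒¬Universal : {P : IPartition G} {x y : Fin n} → x ≢ y → P [ x ~ y ] → ¬ Universal G x × ¬ Universal G y
  ~⇒¬Universal {P} ne p = NonAdj⇒¬Universal (~⇒NonAdj {P = P} ne p) ,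
    NonAdj⇒¬Universal (~⇒NonAdj {P = P} (≢-sym ne) (~-sym p))

module _ {n₁ n₂ : ℕ} {G₁ : Graph n₁} {G₂ : Graph n₂} (ψ : deleteUniversal G₁ ≅ deleteUniversal G₂) where

  open Transfer ψ
  private module ψ = _≅_ ψ

  transfer-cong : {P Q : IPartition G₁} → P ≋ Q → transfer P ≋ transfer Q
  transfer-cong e = ext (go e) (go (≋-sym e))
    where
    go : ∀ {P Q} → P ≋ Q → ∀ {x y} → x ≢ y → transfer P [ x ~ y ] → transfer Q [ x ~ y ]
    go {P} e ne t =
      let nx , ny = ~⇒¬Universal {P = transfer P} ne t in transfer⇐ nx ny (≋⇒ e (transfer⇒ nx ny t))

  transfer-near : {P Q : IPartition G₁} → Near P Q → ¬ P ≋ Q → Near (transfer P) (transfer Q)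
  transfer-near {P} {Q} (v , a) ne with Universal? {G = G₁} v
  -- A universal vertex is alone in every partition, so a step at `v` would change nothing.
  ... | yes u = ⊥-elim (ne (agree-ext a
          (λ y≢v p → ⊥-elim (proj₁ (~⇒¬Universal {P = P} (≢-sym y≢v) p) u))
          (λ y≢v q → ⊥-elim (proj₁ (~⇒¬Universal {P = Q} (≢-sym y≢v) q) u))))
  ... | no nu = v' , record { agree⇒ = go a ; agree⇐ = go (agree-sym a) }
    where
    v' = proj₁ (ψ.to (v , nu))
    avoid : ∀ {x} (nx : ¬ Universal G₂ x) → x ≢ v' → proj₁ (ψ.from (x , nx)) ≢ v
    avoid nx x≢v' e = x≢v' (Eq.trans (Eq.sym (ψ.to-from (_ , nx))) (ψ.to-cong e))
    go : ∀ {P Q} → Agree v P Q → ∀ {x y} → x ≢ v' → y ≢ v' → transfer P [ x ~ y ] → transfer Q [ x ~ y ]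
    go {P} a {x} {y} x≢ y≢ t with x Fin.≟ y
    ... | yes e = ≡⇒~ e
    ... | no ne = let nx , ny = ~⇒¬Universal {P = transfer P} ne t in
      transfer⇐ nx ny (agree⇒ a (avoid nx x≢) (avoid ny y≢) (transfer⇒ nx ny t))

module _ {n₁ n₂ : ℕ} {G₁ : Graph n₁} {G₂ : Graph n₂} (ψ : deleteUniversal G₁ ≅ deleteUniversal G₂) where

  open Transfer ψ
  private
    module ψ = _≅_ ψ
    module T⁻ = Transfer (≅-sym ψ)

  transfer-inverse : (P : IPartition G₁) → T⁻.transfer (transfer P) ≋ P
  transfer-inverse P = ext fwd bwd
    where
    fwd : ∀ {x y} → x ≢ y → T⁻.transfer (transfer P) [ x ~ y ] → P [ x ~ y ]
    fwd ne t =
      let nx , ny = ~⇒¬Universal {P = T⁻.transfer (transfer P)} ne t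
          p = transfer⇒ (proj₂ (ψ.to (_ , nx))) (proj₂ (ψ.to (_ , ny))) (T⁻.transfer⇒ nx ny t)
      in ~-trans (≡⇒~ (Eq.sym (ψ.from-to (_ , nx)))) (~-trans p (≡⇒~ (ψ.from-to (_ , ny))))
    bwd : ∀ {x y} → x ≢ y → P [ x ~ y ] → T⁻.transfer (transfer P) [ x ~ y ]
    bwd ne p =
      let nx , ny = ~⇒¬Universal {P = P} ne p
      in T⁻.transfer⇐ nx ny (transfer⇐ (proj₂ (ψ.to (_ , nx))) (proj₂ (ψ.to (_ , ny)))
           (~-trans (≡⇒~ (ψ.from-to (_ , nx))) (~-trans p (≡⇒~ (Eq.sym (ψ.from-to (_ , ny)))))))

  -- The parts of P and the vertices of G₂ inject into the parts of its transfer and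
  -- the vertices of G₁, the universal vertices changing sides.
  numParts-transfer-≤ : (P : IPartition G₁) → numParts P + n₂ ≤ numParts (transfer P) + n₁
  numParts-transfer-≤ P = FinP.injective⇒≤ {f = Fin.join (numParts (transfer P)) n₁ ∘ f ∘ Fin.splitAt (numParts P)}
      λ {i} {j} e → splitAt-injective (f-injective (Fin.splitAt (numParts P) i) (Fin.splitAt (numParts P) j)
        (Eq.trans (Eq.sym (FinP.splitAt-join _ _ _)) (Eq.trans (cong (Fin.splitAt _) e) (FinP.splitAt-join _ _ _))))
    where
    splitAt-injective : ∀ {i j} → Fin.splitAt (numParts P) i ≡ Fin.splitAt (numParts P) j → i ≡ j
    splitAt-injective {i} {j} e = Eq.trans (Eq.sym (FinP.join-splitAt (numParts P) n₂ i))
      (Eq.trans (cong (Fin.join (numParts P) n₂) e) (FinP.join-splitAt (numParts P) n₂ j))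
    part : Fin n₂ → Fin (numParts (transfer P))
    part = partIndex (transfer P)
    part-universal : ∀ {x y} → Universal G₂ y → part x ≡ part y → x ≡ y
    part-universal {x} {y} u e with x Fin.≟ y
    ... | yes eq = eq
    ... | no ne = ⊥-elim (proj₂ (~⇒¬Universal {P = transfer P} ne (partIndex⇒~ (transfer P) e)) u)
    fromPart : ∀ {a} → Dec (Universal G₁ a) → Fin (numParts (transfer P)) ⊎ Fin n₁
    fromPart {a} (yes _) = inj₂ a
    fromPart {a} (no nu) = inj₁ (part (proj₁ (ψ.to (a , nu))))
    fromVertex : ∀ {y} → Dec (Universal G₂ y) → Fin (numParts (transfer P)) ⊎ Fin n₁
    fromVertex {y} (yes _) = inj₁ (part y)
    fromVertex {y} (no nu) = inj₂ (proj₁ (ψ.from (y , nu)))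
    f : Fin (numParts P) ⊎ Fin n₂ → Fin (numParts (transfer P)) ⊎ Fin n₁
    f (inj₁ i) = fromPart (Universal? {G = G₁} (leader P i))
    f (inj₂ y) = fromVertex (Universal? {G = G₂} y)
    same-leader : ∀ {i j} → P [ leader P i ~ leader P j ] → _≡_ {A = Fin (numParts P) ⊎ Fin n₂} (inj₁ i) (inj₁ j)
    same-leader p = cong inj₁ (leader-apart P p)
    mixed : ∀ {i y} (d : Dec (Universal G₁ (leader P i))) (d' : Dec (Universal G₂ y)) → fromPart d ≢ fromVertex d'
    mixed (yes u) (no nu) e = proj₂ (ψ.from (_ , nu)) (subst (Universal G₁) (inj₂-injective e) u)
    mixed (no nu) (yes u) e = proj₂ (ψ.to (_ , nu)) (subst (Universal G₂) (Eq.sym (part-universal u (inj₁-injective e))) u)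
    f-injective : ∀ x y → f x ≡ f y → x ≡ y
    f-injective (inj₁ i) (inj₁ j) e = go (Universal? {G = G₁} (leader P i)) (Universal? {G = G₁} (leader P j)) e
      where
      go : (d : Dec (Universal G₁ (leader P i))) (d' : Dec (Universal G₁ (leader P j))) → fromPart d ≡ fromPart d' →
        _≡_ {A = Fin (numParts P) ⊎ Fin n₂} (inj₁ i) (inj₁ j)
      go (yes _) (yes _) e = same-leader (≡⇒~ (inj₂-injective e))
      go (no nu) (no nu') e = same-leader (~-trans (≡⇒~ (Eq.sym (ψ.from-to (_ , nu))))
        (~-trans (transfer⇒ (proj₂ (ψ.to (_ , nu))) (proj₂ (ψ.to (_ , nu')))
          (partIndex⇒~ (transfer P) (inj₁-injective e))) (≡⇒~ (ψ.from-to (_ , nu')))))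
    f-injective (inj₁ i) (inj₂ y) e = ⊥-elim (mixed (Universal? {G = G₁} (leader P i)) (Universal? {G = G₂} y) e)
    f-injective (inj₂ y) (inj₁ i) e = ⊥-elim (mixed (Universal? {G = G₁} (leader P i)) (Universal? {G = G₂} y) (Eq.sym e))
    f-injective (inj₂ x) (inj₂ y) e = cong inj₂ (go (Universal? {G = G₂} x) (Universal? {G = G₂} y) e)
      where
      go : (d : Dec (Universal G₂ x)) (d' : Dec (Universal G₂ y)) → fromVertex d ≡ fromVertex d' → x ≡ y
      go (yes _) (yes u) e = part-universal u (inj₁-injective e)
      go (no nu) (no nu') e = Eq.trans (Eq.sym (ψ.to-from (x , nu)))
        (Eq.trans (ψ.to-cong (inj₂-injective e)) (ψ.to-from (y , nu')))

module _ {n₁ n₂ : ℕ} {G₁ : Graph n₁} {G₂ : Graph n₂} (ψ : deleteUniversal G₁ ≅ deleteUniversal G₂) where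

  open Transfer ψ
  private module T⁻ = Transfer (≅-sym ψ)

  -- Reversing `ψ` twice restores its maps but not its proof fields, so the two transfers are first
  -- matched vertex by vertex.
  transfer-inverse⁻ : (Q : IPartition G₂) → transfer (T⁻.transfer Q) ≋ Q
  transfer-inverse⁻ Q = ≋-trans (ext
      (λ ne t → let nx , ny = ~⇒¬Universal {P = transfer (T⁻.transfer Q)} ne t in T⁻⁻.transfer⇐ nx ny (transfer⇒ nx ny t))
      (λ ne t → let nx , ny = ~⇒¬Universal {P = T⁻⁻.transfer (T⁻.transfer Q)} ne t in transfer⇐ nx ny (T⁻⁻.transfer⇒ nx ny t)))
    (transfer-inverse (≅-sym ψ) Q)
    where module T⁻⁻ = Transfer (≅-sym (≅-sym ψ))

  -- Invariance of the number of vertices minus the number of parts, in sums to avoid truncated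
  -- subtraction.
  numParts-transfer : (P : IPartition G₁) → numParts P + n₂ ≡ numParts (transfer P) + n₁
  numParts-transfer P = ℕP.≤-antisym (numParts-transfer-≤ ψ P)
    (subst (λ m → numParts (transfer P) + n₁ ≤ m + n₂) (numParts-resp (transfer-inverse ψ P))
      (numParts-transfer-≤ (≅-sym ψ) (transfer P)))

  module _ {k₁ k₂ : ℕ} (fwd : ∀ P → k₁ ≤ numParts P → k₂ ≤ numParts (transfer P))
    (bwd : ∀ Q → k₂ ≤ numParts Q → k₁ ≤ numParts (T⁻.transfer Q)) where

    private
      B₁ = Σ (IPartition G₁) λ P → k₁ ≤ numParts P
      B₂ = Σ (IPartition G₂) λ P → k₂ ≤ numParts P

      to-edge : ∀ {P Q : IPartition G₁} → ¬ P ≈P Q × (∃[ v ] SameAfterDeleting v P Q) →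
        ¬ transfer P ≈P transfer Q × (∃[ v ] SameAfterDeleting v (transfer P) (transfer Q))
      to-edge {P} {Q} (ne , v , s) =
        let v' , a = transfer-near ψ (v , same⇒agree s) (ne ∘ ≋⇒≈) in
        (λ e → ne (≋⇒≈ (≋-trans (≋-sym (transfer-inverse ψ P))
          (≋-trans (transfer-cong (≅-sym ψ) (≈⇒≋ e)) (transfer-inverse ψ Q))))) ,
        v' , agree⇒same a

      from-edge : ∀ {P Q : IPartition G₁} →
        ¬ transfer P ≈P transfer Q × (∃[ v ] SameAfterDeleting v (transfer P) (transfer Q)) →
        ¬ P ≈P Q × (∃[ v ] SameAfterDeleting v P Q)
      from-edge {P} {Q} (ne , v , s) =
        let v' , a = near-resp (transfer-inverse ψ P) (transfer-inverse ψ Q)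
              (transfer-near (≅-sym ψ) (v , same⇒agree s) (ne ∘ ≋⇒≈)) in
        (λ e → ne (≋⇒≈ (transfer-cong ψ (≈⇒≋ e)))) , v' , agree⇒same a

    transfer-iso : Bell≥ k₁ G₁ ≅ Bell≥ k₂ G₂
    transfer-iso = record
      { to = λ (P , le) → transfer P , fwd P le
      ; from = λ (Q , le) → T⁻.transfer Q , bwd Q le
      ; to-cong = λ e → ≋⇒≈ (transfer-cong ψ (≈⇒≋ e))
      ; from-cong = λ e → ≋⇒≈ (transfer-cong (≅-sym ψ) (≈⇒≋ e))
      ; to-from = λ (Q , _) → ≋⇒≈ (transfer-inverse⁻ Q)
      ; from-to = λ (P , _) → ≋⇒≈ (transfer-inverse ψ P)
      ; E-to = λ _ _ → to-edge
      ; E-from = λ _ _ → from-edge }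

-- Finiteness of the set of partitions, intermediate numbers of parts, colourings

module _ {n : ℕ} {G : Graph n} where

  private
    bit : Bool → Fin 2
    bit false = zero
    bit true = suc zero

    bit-injective : ∀ {b c} → bit b ≡ bit c → b ≡ c
    bit-injective {false} {false} _ = refl
    bit-injective {true} {true} _ = refl

  partitionCode : IPartition G → Fin ((2 ℕ.^ n) ℕ.^ n)
  partitionCode P = Fin.funToFin λ x → Fin.funToFin λ y → bit (same P x y)

  partitionCode-injective : {P Q : IPartition G} → partitionCode P ≡ partitionCode Q → P ≋ Q
  partitionCode-injective e = ≈⇒≋ λ x y → bit-injective (fun-injective (fun-injective e x) y)
    where
    fun-injective : ∀ {m k} {f g : Fin m → Fin k} → Fin.funToFin f ≡ Fin.funToFin g → ∀ x → f x ≡ g x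
    fun-injective {f = f} {g} e x = Eq.trans (Eq.sym (FinP.finToFun-funToFin f x))
      (Eq.trans (cong (λ c → Fin.finToFun c x) e) (FinP.finToFun-funToFin g x))

  -- Merging the vertices into Q one at a time changes the number of parts by at
  -- most one per step.
  numParts-intermediate : (Q : IPartition G) {m : ℕ} → numParts Q ≤ m → m ≤ n → ∃ λ R → numParts {G = G} R ≡ m
  numParts-intermediate Q {m} Q≤m m≤n =
    go n (ℕP.≤-trans (numParts-refine λ q → restrict-keeps n (FinP.toℕ<n _) (FinP.toℕ<n _) q) Q≤m)
    where
    module Cut (j : ℕ) = Restrict (λ x → toℕ x ℕ.< j) (λ x → toℕ x ℕ.<? j) Q
    open Cut
    step : ∀ j → numParts (restrict j) ≤ suc (numParts (restrict (suc j)))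
    step j with j ℕ.<? n
    ... | yes j<n = numParts-agree {v = Fin.fromℕ< j<n} record { agree⇒ = up ; agree⇐ = down }
      where
      shrink : ∀ {x} → x ≢ Fin.fromℕ< j<n → toℕ x ℕ.< suc j → toℕ x ℕ.< j
      shrink ne lt = ℕP.≤∧≢⇒< (ℕP.≤-pred lt)
        (λ e → ne (FinP.toℕ-injective (Eq.trans e (Eq.sym (FinP.toℕ-fromℕ< j<n)))))
      up : ∀ {x y} → x ≢ Fin.fromℕ< j<n → y ≢ Fin.fromℕ< j<n → restrict j [ x ~ y ] → restrict (suc j) [ x ~ y ]
      up _ _ r with restrict-cases j r
      ... | inj₁ e = ≡⇒~ e
      ... | inj₂ (a , b , q) = restrict-keeps (suc j) (ℕP.m<n⇒m<1+n a) (ℕP.m<n⇒m<1+n b) q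
      down : ∀ {x y} → x ≢ Fin.fromℕ< j<n → y ≢ Fin.fromℕ< j<n → restrict (suc j) [ x ~ y ] → restrict j [ x ~ y ]
      down x≢ y≢ r with restrict-cases (suc j) r
      ... | inj₁ e = ≡⇒~ e
      ... | inj₂ (a , b , q) = restrict-keeps j (shrink x≢ a) (shrink y≢ b) q
    ... | no j≮n = ℕP.≤-trans (numParts-refine down) (ℕP.n≤1+n _)
      where
      down : ∀ {x y} → restrict (suc j) [ x ~ y ] → restrict j [ x ~ y ]
      down r = restrict-keeps j (ℕP.<-≤-trans (FinP.toℕ<n _) (ℕP.≮⇒≥ j≮n))
        (ℕP.<-≤-trans (FinP.toℕ<n _) (ℕP.≮⇒≥ j≮n)) (restrict-refines (suc j) r)
    go : ∀ j → numParts (restrict j) ≤ m → ∃ λ R → numParts {G = G} R ≡ m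
    go zero le = restrict 0 , ℕP.≤-antisym le (ℕP.≤-trans m≤n (≤numParts (restrict 0) id discrete))
      where
      discrete : ∀ {x y} → restrict 0 [ x ~ y ] → x ≡ y
      discrete r with restrict-cases 0 r
      ... | inj₁ e = e
    go (suc j) le with numParts (restrict (suc j)) ℕ.≟ m
    ... | yes e = restrict (suc j) , e
    ... | no ne = go j (ℕP.≤-trans (step j) (ℕP.≤∧≢⇒< le ne))

  colouring-partition : ∀ {m} → Colourable G m → ∃ λ P → numParts {G = G} P ≤ m
  colouring-partition {m} (c , proper) = fromRel rel , numParts≤ (fromRel rel) c (rel⇒~ rel)
    where
    rel : PartRel
    rel = record
      { _R_ = λ x y → c x ≡ c y
      ; _R?_ = λ x y → c x Fin.≟ c y
      ; equiv = record { refl = refl ; sym = Eq.sym ; trans = Eq.trans }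
      ; R-ind = λ {x} {y} e ne → nonAdj ne (BoolP.¬-not (λ a → proper x y a e)) }

  partition-colouring : (P : IPartition G) → Colourable G (numParts P)
  partition-colouring P = partIndex P , λ x y a e →
    BoolP.not-¬ {x = false} refl (Eq.trans (Eq.sym (indep P x y (same≡ (partIndex⇒~ P e)))) a)

-- The case of unequal differences of vertices and thresholds

module SmallerSide {n₁ n₂ : ℕ} {G₁ : Graph n₁} {G₂ : Graph n₂} {k₁ k₂ : ℕ}
  (k₁≤n₁ : k₁ ≤ n₁) (φ : Bell≥ k₁ G₁ ≅ Bell≥ k₂ G₂)
  (ψ : deleteUniversal G₁ ≅ deleteUniversal G₂) (lt : k₂ + n₁ ℕ.< k₁ + n₂) where

  private
    module φ = _≅_ φ
    open Transfer ψ
    B₂ = Σ (IPartition G₂) λ Q → k₂ ≤ numParts Q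

    shift : (P : IPartition G₁) → k₁ ≤ numParts P → k₁ + n₂ ≤ numParts (transfer P) + n₁
    shift P le = subst (k₁ + n₂ ≤_) (numParts-transfer ψ P) (ℕP.+-monoˡ-≤ n₂ le)

    -- An injective endomap of the larger Bell graph whose image avoids the
    -- partitions with few parts; being surjective, it shows that there are none.
    endo : B₂ → B₂
    endo (Q , le) = let P , le' = φ.from (Q , le) in
      transfer P , ℕP.+-cancelʳ-≤ n₁ k₂ _ (ℕP.≤-trans (ℕP.<⇒≤ lt) (shift P le'))

    _≈₂_ : B₂ → B₂ → Set
    p ≈₂ q = proj₁ p ≋ proj₁ q

    to-from : ∀ p → proj₁ (φ.to (φ.from p)) ≋ proj₁ p
    to-from p = ≈⇒≋ (φ.to-from p)

    endo-injective : ∀ {p q} → endo p ≈₂ endo q → p ≈₂ q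
    endo-injective {p} {q} e = ≋-trans (≋-sym (to-from p)) (≋-trans to-≋ (to-from q))
      where
      from-≋ : proj₁ (φ.from p) ≋ proj₁ (φ.from q)
      from-≋ = ≋-trans (≋-sym (transfer-inverse ψ (proj₁ (φ.from p))))
        (≋-trans (transfer-cong (≅-sym ψ) e) (transfer-inverse ψ (proj₁ (φ.from q))))
      to-≋ : proj₁ (φ.to (φ.from p)) ≋ proj₁ (φ.to (φ.from q))
      to-≋ = ≈⇒≋ (φ.to-cong {φ.from p} {φ.from q} (≋⇒≈ from-≋))

    bounded : (p : B₂) → k₁ + n₂ ≤ numParts (proj₁ p) + n₁
    bounded p =
      let j , e = periodic {_≈_ = _≈₂_} (partitionCode ∘ proj₁) partitionCode-injective {f = endo}
                    (λ {x} {y} → endo-injective {x} {y}) p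
          q = iterate endo j p
      in subst (λ m → k₁ + n₂ ≤ m + n₁) (numParts-resp e) (shift (proj₁ (φ.from q)) (proj₂ (φ.from q)))

  -- `bounded` speaks only of partitions above the threshold `k₂`; a smaller `Q` would have one of
  -- them above it, with a number of parts that `bounded` forbids.
  no-small : (Q : IPartition G₂) → ¬ numParts Q + n₁ ℕ.< k₁ + n₂
  no-small Q small = ℕP.1+n≰n (subst (_≤ m + n₁) (Eq.sym m+n₁) (subst (λ v → k₁ + n₂ ≤ v + n₁) R≡m (bounded (R , k₂≤R))))
    where
    -- The largest number of parts that `bounded` forbids; since `lt` is strict, it is still at
    -- least `k₂`.
    m = k₁ + n₂ ∸ suc n₁
    n₁<k₁+n₂ : suc n₁ ≤ k₁ + n₂
    n₁<k₁+n₂ = ℕP.≤-trans (s≤s (ℕP.m≤n+m n₁ _)) small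
    m+n₁ : suc (m + n₁) ≡ k₁ + n₂
    m+n₁ = Eq.trans (Eq.sym (ℕP.+-suc m n₁)) (ℕP.m∸n+n≡m n₁<k₁+n₂)
    below : ∀ {v} → suc (v + n₁) ≤ k₁ + n₂ → v ≤ m
    below {v} le = ℕP.+-cancelʳ-≤ n₁ v m (ℕP.≤-pred (subst (suc (v + n₁) ≤_) (Eq.sym m+n₁) le))
    m≤n₂ : m ≤ n₂
    m≤n₂ = ℕP.+-cancelʳ-≤ (suc n₁) m n₂ (subst (_≤ n₂ + suc n₁) (Eq.sym (ℕP.m∸n+n≡m n₁<k₁+n₂))
      (subst (k₁ + n₂ ≤_) (ℕP.+-comm (suc n₁) n₂) (ℕP.+-monoˡ-≤ n₂ (ℕP.m≤n⇒m≤1+n k₁≤n₁))))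
    found : ∃ λ R → numParts {G = G₂} R ≡ m
    found = numParts-intermediate Q (below small) m≤n₂
    R : IPartition G₂
    R = proj₁ found
    R≡m : numParts R ≡ m
    R≡m = proj₂ found
    k₂≤R : k₂ ≤ numParts R
    k₂≤R = subst (k₂ ≤_) (Eq.sym R≡m) (below lt)

  -- A colouring with too few colours gives a partition excluded by `no-small`, for `G₁` after
  -- transfer to `G₂`.
  below-χ : k₁ ≤χ G₁ × k₂ ≤χ G₂
  below-χ = below₁ , below₂
    where
    below₁ : k₁ ≤χ G₁
    below₁ m c = ℕP.≮⇒≥ λ m<k₁ → let P , P≤m = colouring-partition c in
      no-small (transfer P) (subst (ℕ._< k₁ + n₂) (numParts-transfer ψ P)
        (ℕP.+-monoˡ-< n₂ (ℕP.≤-<-trans P≤m m<k₁)))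
    below₂ : k₂ ≤χ G₂
    below₂ m c = ℕP.≮⇒≥ λ m<k₂ → let Q , Q≤m = colouring-partition c in
      no-small Q (ℕP.<-trans (ℕP.+-monoˡ-< n₁ (ℕP.≤-<-trans Q≤m m<k₂)) lt)

-- Puts the comparison into the form with sums that `SmallerSide` uses.
corank-< : ∀ {n₁ n₂ k₁ k₂} → k₁ ≤ n₁ → k₂ ≤ n₂ → n₁ ∸ k₁ ℕ.< n₂ ∸ k₂ → k₂ + n₁ ℕ.< k₁ + n₂
corank-< {n₁} {n₂} {k₁} {k₂} k₁≤n₁ k₂≤n₂ lt = begin-strict
  k₂ + n₁                ≡⟨ cong (k₂ +_) (ℕP.m+[n∸m]≡n k₁≤n₁) ⟨
  k₂ + (k₁ + (n₁ ∸ k₁))  <⟨ ℕP.+-monoʳ-< k₂ (ℕP.+-monoʳ-< k₁ lt) ⟩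
  k₂ + (k₁ + (n₂ ∸ k₂))  ≡⟨ ℕP.+-assoc k₂ k₁ _ ⟨
  k₂ + k₁ + (n₂ ∸ k₂)    ≡⟨ cong (_+ (n₂ ∸ k₂)) (ℕP.+-comm k₂ k₁) ⟩
  k₁ + k₂ + (n₂ ∸ k₂)    ≡⟨ ℕP.+-assoc k₁ k₂ _ ⟩
  k₁ + (k₂ + (n₂ ∸ k₂))  ≡⟨ cong (k₁ +_) (ℕP.m+[n∸m]≡n k₂≤n₂) ⟩
  k₁ + n₂                ∎
  where open ℕP.≤-Reasoning

corank-≡ : ∀ {n₁ n₂ k₁ k₂} → k₁ ≤ n₁ → k₂ ≤ n₂ → n₁ ∸ k₁ ≡ n₂ ∸ k₂ → k₂ + n₁ ≡ k₁ + n₂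
corank-≡ {n₁} {n₂} {k₁} {k₂} k₁≤n₁ k₂≤n₂ e = begin
  k₂ + n₁                ≡⟨ cong (k₂ +_) (ℕP.m+[n∸m]≡n k₁≤n₁) ⟨
  k₂ + (k₁ + (n₁ ∸ k₁))  ≡⟨ ℕP.+-assoc k₂ k₁ _ ⟨
  k₂ + k₁ + (n₁ ∸ k₁)    ≡⟨ Eq.cong₂ _+_ (ℕP.+-comm k₂ k₁) e ⟩
  k₁ + k₂ + (n₂ ∸ k₂)    ≡⟨ ℕP.+-assoc k₁ k₂ _ ⟩
  k₁ + (k₂ + (n₂ ∸ k₂))  ≡⟨ cong (k₁ +_) (ℕP.m+[n∸m]≡n k₂≤n₂) ⟩
  k₁ + n₂                ∎
  where open Eq.≡-Reasoning

transfer-corank : {n₁ n₂ : ℕ} {G₁ : Graph n₁} {G₂ : Graph n₂} {k₁ k₂ : ℕ} (ψ : deleteUniversal G₁ ≅ deleteUniversal G₂) →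
  k₂ + n₁ ≡ k₁ + n₂ → ∀ P → k₁ ≤ numParts P → k₂ ≤ numParts (Transfer.transfer ψ P)
transfer-corank {n₁} {n₂} {k₁ = k₁} {k₂} ψ e P le = ℕP.+-cancelʳ-≤ n₁ k₂ _
  (subst (_≤ numParts (Transfer.transfer ψ P) + n₁) (Eq.sym e)
    (subst (k₁ + n₂ ≤_) (numParts-transfer ψ P) (ℕP.+-monoˡ-≤ n₂ le)))

theorem1p5 : (n₁ n₂ : ℕ) (G₁ : Graph n₁) (G₂ : Graph n₂) (k₁ k₂ : ℕ) →
    k₁ + 2 ≤ n₁ → k₂ + 2 ≤ n₂ →
    ((Bell≥ k₁ G₁ ≅ Bell≥ k₂ G₂) →
    (deleteUniversal G₁ ≅ deleteUniversal G₂) ×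
    ((k₁ ≤χ G₁ × k₂ ≤χ G₂) ⊎ n₁ ∸ k₁ ≡ n₂ ∸ k₂))
    × ((deleteUniversal G₁ ≅ deleteUniversal G₂) ×
    ((k₁ ≤χ G₁ × k₂ ≤χ G₂) ⊎ n₁ ∸ k₁ ≡ n₂ ∸ k₂) →
    Bell≥ k₁ G₁ ≅ Bell≥ k₂ G₂)
theorem1p5 n₁ n₂ G₁ G₂ k₁ k₂ k₁+2≤n₁ k₂+2≤n₂ = forward , backward
  where
  k₁≤n₁ : k₁ ≤ n₁
  k₁≤n₁ = ℕP.m+n≤o⇒m≤o k₁ k₁+2≤n₁
  k₂≤n₂ : k₂ ≤ n₂
  k₂≤n₂ = ℕP.m+n≤o⇒m≤o k₂ k₂+2≤n₂

  forward : Bell≥ k₁ G₁ ≅ Bell≥ k₂ G₂ →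
    (deleteUniversal G₁ ≅ deleteUniversal G₂) × ((k₁ ≤χ G₁ × k₂ ≤χ G₂) ⊎ n₁ ∸ k₁ ≡ n₂ ∸ k₂)
  forward φ = ψ , bounds (ℕP.<-cmp (n₁ ∸ k₁) (n₂ ∸ k₂))
    where
    ψ : deleteUniversal G₁ ≅ deleteUniversal G₂
    ψ = deleteUniversal-iso k₁+2≤n₁ k₂+2≤n₂ φ
    bounds : Tri (n₁ ∸ k₁ ℕ.< n₂ ∸ k₂) (n₁ ∸ k₁ ≡ n₂ ∸ k₂) (n₂ ∸ k₂ ℕ.< n₁ ∸ k₁) →
      (k₁ ≤χ G₁ × k₂ ≤χ G₂) ⊎ n₁ ∸ k₁ ≡ n₂ ∸ k₂
    bounds (tri< lt _ _) = inj₁ (SmallerSide.below-χ k₁≤n₁ φ ψ (corank-< k₁≤n₁ k₂≤n₂ lt))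
    bounds (tri≈ _ e _) = inj₂ e
    bounds (tri> _ _ gt) =
      inj₁ (Product.swap (SmallerSide.below-χ k₂≤n₂ (≅-sym φ) (≅-sym ψ) (corank-< k₂≤n₂ k₁≤n₁ gt)))

  backward : (deleteUniversal G₁ ≅ deleteUniversal G₂) × ((k₁ ≤χ G₁ × k₂ ≤χ G₂) ⊎ n₁ ∸ k₁ ≡ n₂ ∸ k₂) →
    Bell≥ k₁ G₁ ≅ Bell≥ k₂ G₂
  -- The parts of any partition are the classes of a proper colouring, so both thresholds hold for
  -- all partitions.
  backward (ψ , inj₁ (χ₁ , χ₂)) = transfer-iso ψ
    (λ P _ → χ₂ _ (partition-colouring (Transfer.transfer ψ P)))
    (λ Q _ → χ₁ _ (partition-colouring (Transfer.transfer (≅-sym ψ) Q)))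
  backward (ψ , inj₂ e) = transfer-iso ψ
    (transfer-corank ψ (corank-≡ k₁≤n₁ k₂≤n₂ e)) (transfer-corank (≅-sym ψ) (corank-≡ k₂≤n₂ k₁≤n₁ (Eq.sym e)))
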